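{- Let $n\ge3$ be an odd integer. Then $$259\,\tau(n)=-\tfrac{1}{2^3}\sum_{d\mid n,\,d>0}d^{11}+\tfrac{691}{2^3\cdot3^2}\sum_{d\mid n,\,d>0}d^3\left(17+8d^2+2d^4\right)$$ $$\qquad-\tfrac{691\cdot2^2}{3^2}\sum_{\substack{m_1>m_2\ge1\\ m_1+m_2\le n\\ \gcd(m_1,m_2)\mid n}}(-1)^{m_1+m_2}(m_1m_2)^3(m_1^2-m_2^2)^2\sum_{\substack{y_1,y_2\ge1\\ m_1y_1+m_2y_2=n}}1 ,$$ where $m_1,m_2,y_1,y_2$ range over integers.
   Context: Ramanujan's tau function $\tau(n)$ is defined by $q\prod_{r\ge1}(1-q^r)^{24}=\sum_{n=1}^{\infty}\tau(n)q^n$. -}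

module Defs where

open import Data.Bool.Base using (if_then_else_)
open import Data.Integer.Base as ℤ using (ℤ; +_; 0ℤ; 1ℤ)
import Data.Integer.Properties as ℤ
open import Data.List.Base using (List; []; _∷_; foldr; map; filter; upTo; applyUpTo; cartesianProduct)
open import Data.List.Membership.Propositional using (_∈_)
open import Data.List.Membership.Propositional.Properties
  using (∈-map⁺; ∈-map⁻; ∈-upTo⁺; ∈-upTo⁻; ∈-filter⁺; ∈-filter⁻; ∈-cartesianProduct⁺; ∈-applyUpTo⁻)
open import Data.List.Relation.Unary.Any using (here; there)
open import Data.List.Relation.Unary.Unique.Propositional using (Unique)
import Data.List.Relation.Unary.Unique.Propositional.Properties as Unique
open import Data.Nat.Base using (ℕ; zero; suc; _+_; _*_; _∸_; _≤_; _<_; _≡ᵇ_; z≤n; s≤s; z<s; _≤′_; ≤′-refl; ≤′-step; >-nonZero)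
open import Data.Nat.Divisibility using (_∣_; _∣?_; ∣⇒≤)
open import Data.Nat.GCD using (gcd)
open import Data.Nat.Properties
  using (_≟_; _≤?_; _<?_; ≤-trans; ≤-refl; ≤-<-trans; m∸n≤m; m≤m+n; m≤n+m; m≤n*m; suc-injective; ≤⇒≤′; ≤′⇒≤)
open import Data.Product.Base using (_×_; _,_; proj₂)
open import Data.Rational.Base using (ℚ; _/_)
open import Function.Base using (_∘_)
open import Relation.Binary.PropositionalEquality
open import Relation.Nullary.Decidable using (_×-dec_)
open import Relation.Unary using (Decidable)

------------------------------------------------------------------------
-- Finite sums of integers

∑ : ∀ {a} {A : Set a} → List A → (A → ℤ) → ℤ
∑ xs f = foldr ℤ._+_ 0ℤ (map f xs)

infix 5 ∑
syntax ∑ xs (λ x → e) = ∑[ x ∈ xs ] e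

fromℤ : ℤ → ℚ
fromℤ z = z / 1

------------------------------------------------------------------------
-- Formal power series in q over ℤ, given by their coefficients

Series : Set
Series = ℕ → ℤ

infixl 6 _-ˢ_
infixl 7 _*ˢ_
infixr 8 _^ˢ_

q^_ : ℕ → Series
(q^ r) n = if n ≡ᵇ r then 1ℤ else 0ℤ

1ˢ : Series
1ˢ = q^ 0

_-ˢ_ : Series → Series → Series
(f -ˢ g) n = f n ℤ.- g n

_*ˢ_ : Series → Series → Series
(f *ˢ g) n = ∑[ i ∈ upTo (suc n) ] (f i ℤ.* g (n ∸ i))

_^ˢ_ : Series → ℕ → Series
f ^ˢ zero  = 1ˢ
f ^ˢ suc k = f *ˢ f ^ˢ k

∏[1⋯_] : ℕ → (ℕ → Series) → Series
∏[1⋯ zero  ] F = 1ˢ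
∏[1⋯ suc N ] F = F (suc N) *ˢ ∏[1⋯ N ] F

-- The infinite product over r ≥ 1, for families with F r ≡ 1 mod q^r:
-- the n-th coefficient of the partial products is constant from N = n on
-- (see `∏∞-limit`), so it may be read off at N = n.
∏∞ : (ℕ → Series) → Series
∏∞ F n = (∏[1⋯ n ] F) n

eulerFactor²⁴ : ℕ → Series
eulerFactor²⁴ r = (1ˢ -ˢ q^ r) ^ˢ 24

τ : ℕ → ℤ
τ = q^ 1 *ˢ ∏∞ eulerFactor²⁴

------------------------------------------------------------------------
-- Convergence of the infinite product

-- Congruence modulo q^r.
_≈_mod-q^_ : Series → Series → ℕ → Set
f ≈ g mod-q^ r = ∀ i → i < r → f i ≡ g i

private
  ∑-cong : ∀ (xs : List ℕ) {f g : ℕ → ℤ} → (∀ {x} → x ∈ xs → f x ≡ g x) → ∑ xs f ≡ ∑ xs g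
  ∑-cong []       e = refl
  ∑-cong (x ∷ xs) e = cong₂ ℤ._+_ (e (here refl)) (∑-cong xs (e ∘ there))

  ∑-zero : ∀ (xs : List ℕ) → ∑[ x ∈ xs ] 0ℤ ≡ 0ℤ
  ∑-zero []       = refl
  ∑-zero (x ∷ xs) = trans (ℤ.+-identityˡ _) (∑-zero xs)

  *ˢ-congˡ : ∀ {f f′ r} g → f ≈ f′ mod-q^ r → (f *ˢ g) ≈ (f′ *ˢ g) mod-q^ r
  *ˢ-congˡ g e n n<r = ∑-cong (upTo (suc n)) λ {i} i∈ →
    cong (ℤ._* g (n ∸ i)) (e i (≤-trans (∈-upTo⁻ i∈) n<r))

  *ˢ-identityˡ : ∀ g n → (1ˢ *ˢ g) n ≡ g n
  *ˢ-identityˡ g n = begin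
    1ℤ ℤ.* g n ℤ.+ ∑ (applyUpTo suc n) (λ i → 1ˢ i ℤ.* g (n ∸ i))
      ≡⟨ cong₂ ℤ._+_ (ℤ.*-identityˡ (g n)) (trans (∑-cong (applyUpTo suc n) vanish) (∑-zero (applyUpTo suc n))) ⟩
    g n ℤ.+ 0ℤ
      ≡⟨ ℤ.+-identityʳ (g n) ⟩
    g n ∎
    where
    open ≡-Reasoning
    vanish : ∀ {i} → i ∈ applyUpTo suc n → 1ˢ i ℤ.* g (n ∸ i) ≡ 0ℤ
    vanish i∈ with ∈-applyUpTo⁻ suc i∈
    ... | j , _ , refl = ℤ.*-zeroˡ (g (n ∸ suc j))

  *ˢ-unit : ∀ {f r} g → f ≈ 1ˢ mod-q^ r → (f *ˢ g) ≈ g mod-q^ r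
  *ˢ-unit g e n n<r = trans (*ˢ-congˡ g e n n<r) (*ˢ-identityˡ g n)

  ^ˢ-unit : ∀ {f r} k → f ≈ 1ˢ mod-q^ r → (f ^ˢ k) ≈ 1ˢ mod-q^ r
  ^ˢ-unit zero    e n n<r = refl
  ^ˢ-unit {f} (suc k) e n n<r = trans (*ˢ-unit (f ^ˢ k) e n n<r) (^ˢ-unit k e n n<r)

  q^-vanishes : ∀ r i → i < r → (q^ r) i ≡ 0ℤ
  q^-vanishes (suc r) zero    _         = refl
  q^-vanishes (suc r) (suc i) (s≤s i<r) = q^-vanishes r i i<r

∏∞-limit : ∀ F → (∀ r → F r ≈ 1ˢ mod-q^ r) →
           ∀ n N → n ≤ N → (∏[1⋯ N ] F) n ≡ ∏∞ F n
∏∞-limit F e n N n≤N = go (≤⇒≤′ n≤N)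
  where
  go : ∀ {N} → n ≤′ N → (∏[1⋯ N ] F) n ≡ ∏∞ F n
  go ≤′-refl            = refl
  go (≤′-step {N} n≤′N) =
    trans (*ˢ-unit (∏[1⋯ N ] F) (e (suc N)) n (s≤s (≤′⇒≤ n≤′N))) (go n≤′N)

eulerFactor²⁴-unit : ∀ r → eulerFactor²⁴ r ≈ 1ˢ mod-q^ r
eulerFactor²⁴-unit r = ^ˢ-unit {1ˢ -ˢ q^ r} {r} 24 λ i i<r →
  trans (cong (λ z → 1ˢ i ℤ.- z) (q^-vanishes r i i<r)) (ℤ.+-identityʳ (1ˢ i))

------------------------------------------------------------------------
-- Index sets of the sums

[1⋯_] : ℕ → List ℕ
[1⋯ n ] = map suc (upTo n)

divisors : ℕ → List ℕ
divisors n = filter (_∣? n) [1⋯ n ]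

Admissible : ℕ → ℕ × ℕ → Set
Admissible n (m₁ , m₂) = m₂ < m₁ × 1 ≤ m₂ × m₁ + m₂ ≤ n × gcd m₁ m₂ ∣ n

admissible? : ∀ n → Decidable (Admissible n)
admissible? n (m₁ , m₂) = m₂ <? m₁ ×-dec 1 ≤? m₂ ×-dec m₁ + m₂ ≤? n ×-dec gcd m₁ m₂ ∣? n

admissiblePairs : ℕ → List (ℕ × ℕ)
admissiblePairs n = filter (admissible? n) (cartesianProduct [1⋯ n ] [1⋯ n ])

Solution : ℕ → ℕ → ℕ → ℕ × ℕ → Set
Solution n m₁ m₂ (y₁ , y₂) = 1 ≤ y₁ × 1 ≤ y₂ × m₁ * y₁ + m₂ * y₂ ≡ n

solution? : ∀ n m₁ m₂ → Decidable (Solution n m₁ m₂)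
solution? n m₁ m₂ (y₁ , y₂) = 1 ≤? y₁ ×-dec 1 ≤? y₂ ×-dec m₁ * y₁ + m₂ * y₂ ≟ n

solutions : ℕ → ℕ → ℕ → List (ℕ × ℕ)
solutions n m₁ m₂ = filter (solution? n m₁ m₂) (cartesianProduct [1⋯ n ] [1⋯ n ])

------------------------------------------------------------------------
-- The search box [1⋯ n ] loses nothing, and nothing is listed twice

private
  ∈-[1⋯] : ∀ {n k} → 1 ≤ k → k ≤ n → k ∈ [1⋯ n ]
  ∈-[1⋯] (s≤s _) k≤n = ∈-map⁺ suc (∈-upTo⁺ k≤n)

  [1⋯]-positive : ∀ {n k} → k ∈ [1⋯ n ] → 1 ≤ k
  [1⋯]-positive k∈ with ∈-map⁻ suc k∈
  ... | _ , _ , refl = z<s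

  [1⋯]-unique : ∀ n → Unique [1⋯ n ]
  [1⋯]-unique n = Unique.map⁺ suc-injective (Unique.upTo⁺ n)

divisors-complete : ∀ {n d} → 1 ≤ n → 1 ≤ d → d ∣ n → d ∈ divisors n
divisors-complete {n} 1≤n 1≤d d∣n =
  ∈-filter⁺ (_∣? n) (∈-[1⋯] 1≤d (∣⇒≤ {{>-nonZero 1≤n}} d∣n)) d∣n

divisors-sound : ∀ {n d} → d ∈ divisors n → 1 ≤ d × d ∣ n
divisors-sound {n} d∈ with ∈-filter⁻ (_∣? n) {xs = [1⋯ n ]} d∈
... | d∈box , d∣n = [1⋯]-positive d∈box , d∣n

divisors-unique : ∀ n → Unique (divisors n)
divisors-unique n = Unique.filter⁺ (_∣? n) ([1⋯]-unique n)

admissiblePairs-complete : ∀ {n p} → Admissible n p → p ∈ admissiblePairs n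
admissiblePairs-complete {n} {m₁ , m₂} a@(m₂<m₁ , 1≤m₂ , m₁+m₂≤n , _) =
  ∈-filter⁺ (admissible? n)
    (∈-cartesianProduct⁺ (∈-[1⋯] (≤-<-trans z≤n m₂<m₁) (≤-trans (m≤m+n m₁ m₂) m₁+m₂≤n))
                         (∈-[1⋯] 1≤m₂ (≤-trans (m≤n+m m₂ m₁) m₁+m₂≤n)))
    a

admissiblePairs-sound : ∀ {n p} → p ∈ admissiblePairs n → Admissible n p
admissiblePairs-sound {n} p∈ =
  proj₂ (∈-filter⁻ (admissible? n) {xs = cartesianProduct [1⋯ n ] [1⋯ n ]} p∈)

admissiblePairs-unique : ∀ n → Unique (admissiblePairs n)
admissiblePairs-unique n =
  Unique.filter⁺ (admissible? n) (Unique.cartesianProduct⁺ ([1⋯]-unique n) ([1⋯]-unique n))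

solutions-complete : ∀ {n m₁ m₂ y} → 1 ≤ m₁ → 1 ≤ m₂ → Solution n m₁ m₂ y → y ∈ solutions n m₁ m₂
solutions-complete {n} {m₁} {m₂} {y₁ , y₂} 1≤m₁ 1≤m₂ s@(1≤y₁ , 1≤y₂ , refl) =
  ∈-filter⁺ (solution? n m₁ m₂)
    (∈-cartesianProduct⁺
      (∈-[1⋯] 1≤y₁ (≤-trans (m≤n*m y₁ m₁ {{>-nonZero 1≤m₁}}) (m≤m+n (m₁ * y₁) (m₂ * y₂))))
      (∈-[1⋯] 1≤y₂ (≤-trans (m≤n*m y₂ m₂ {{>-nonZero 1≤m₂}}) (m≤n+m (m₂ * y₂) (m₁ * y₁)))))
    s

solutions-sound : ∀ {n m₁ m₂ y} → y ∈ solutions n m₁ m₂ → Solution n m₁ m₂ y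
solutions-sound {n} {m₁} {m₂} y∈ =
  proj₂ (∈-filter⁻ (solution? n m₁ m₂) {xs = cartesianProduct [1⋯ n ] [1⋯ n ]} y∈)

solutions-unique : ∀ n m₁ m₂ → Unique (solutions n m₁ m₂)
solutions-unique n m₁ m₂ =
  Unique.filter⁺ (solution? n m₁ m₂) (Unique.cartesianProduct⁺ ([1⋯]-unique n) ([1⋯]-unique n))

module Submission where

-- Write X a = q^a / (1 - q^a) and L φ = Σ φ(a) X a, so that the products L φ · L ψ generate the
-- sums over m₁ y₁ + m₂ y₂ = n. Summing X a · X b = X (a + b) · (1 + X a + X b) against suitable
-- weights evaluates combinations of such products in closed form. This gives Liouville-type
-- relations between the series A k = L ((-1)^d d^k): with D = q d/dq and
--     e = 1 + 24 Σ_{d odd} d X d,   U = 1 - 8 A 1,   B = 1 + 16 A 3,   E = e² - B,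
-- they amount to
--     2 D e = U e - B,   D B = (U - e) B,   D E = U E,
-- together with expressions for A 5, A 7, A 9 and A 11 as polynomials in e and B. In particular
--     9 B³ = B (17 + 32 A 7) - 8 (1 - 8 A 5)²,   691 + 16 A 11 = 691 B³ + 518 B² E + 16 B E²,
-- and the sum over (m₁, m₂) is the coefficient of A 3 · A 7 - A 5 · A 5.
-- Finally B² E and q ∏ (1 - q^r)^24 both solve D F = (1 - 24 Σ d X d) F, so that
-- B² E = 64 Σ τ(n) q^n, while D (B E²) = H B E² with H even and H(0) = 2, which makes the odd
-- coefficients of B E² vanish.

open import Algebra.Bundles using (CommutativeRing)
import Algebra.Construct.Pointwise as Pointwise
import Algebra.Solver.Ring as RingSolver
open import Algebra.Solver.Ring.AlmostCommutativeRing using (_-Raw-AlmostCommutative⟶_; fromCommutativeRing)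
open import Algebra.Structures using (IsCommutativeRing)
open import Data.Bool.Base using (if_then_else_)
open import Data.Empty using (⊥-elim)
open import Data.Integer.Base as ℤ using (+_; -1ℤ; -[1+_]; 0ℤ; 1ℤ; ℤ)
import Data.Integer.Properties as ℤₚ
open import Data.Integer.Solver using (module +-*-Solver)
open import Data.List.Base using (List; []; _++_; _∷_; applyUpTo; cartesianProduct; filter; map; upTo)
import Data.List.Properties as Listₚ
import Data.Maybe.Base as Maybe
open import Data.Nat.Base as ℕ using (_<_; _∸_; _≤_; pred; suc; s≤s; zero; z≤n; ℕ)
open import Data.Nat.Divisibility using (>⇒∤; _∣?_; _∣_; _∤_; divides; ∣-refl; ∣-trans; ∣m+n∣m⇒∣n; ∣m⇒∣m*n; ∣m∣n⇒∣m+n)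
open import Data.Nat.GCD using (gcd[m,n]∣m; gcd[m,n]∣n)
open import Data.Nat.Induction using (<-rec)
import Data.Nat.Properties as ℕₚ
open import Data.Product.Base using (_,_; _×_)
import Data.Rational.Base as ℚ
import Data.Rational.Properties as ℚₚ
import Data.Rational.Unnormalised.Base as ℚᵘ
import Data.Rational.Unnormalised.Properties as ℚᵘₚ
open import Data.Sum.Base using (_⊎_; inj₁; inj₂)
open import Data.Unit.Base using (tt; ⊤)
open import Function.Base using (_∘_; flip; id)
open import Level using (0ℓ)
open import Relation.Binary.PropositionalEquality hiding (setoid)
import Relation.Binary.Reasoning.Setoid as SetoidReasoning
open import Relation.Nullary.Decidable using (Dec; dec-false; dec-true; dec⇒maybe; does; no; yes)
open import Relation.Nullary.Negation using (¬_)
open import Relation.Unary using (Decidable)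
open import Defs

-- No theory of modular forms is used, but it explains the choices. With η(q) = q^(1/24) ∏ (1 - q^r)
-- one has B = η(q)^16 / η(q²)^8 and E = 64 η(q²)^16 / η(q)^8, so B² E = 64 Δ(q) and B E² = 4096
-- Δ(q²), a series in q². Finite dimension of spaces of forms is replaced by the equation D F = H F,
-- which determines F up to its coefficient at n = H(0). With the alternating signs, the series
-- attached to A 5, A 7, A 9 and A 11 are all multiples of B, so no E³ occurs in weight 12. The
-- constant term 691 of the last one forces the coefficient of B³. To turn B³ into divisor sums, e²
-- B² is eliminated between a product of weights 4 and 8 and a square of weight 6; this brings in A
-- 3 · A 7 - A 5 · A 5. Oddness of n acts twice: it kills B E², and it turns the coefficient of A k
-- into -Σ d^k. The factor of τ(n) comes from 9 · 518 · 64 / 16 = 72 · 259.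

private module Solver = +-*-Solver

∑-applyUpTo : ∀ {a} {A : Set a} (g : ℕ → A) n (f : A → ℤ) →
              ∑ (applyUpTo g n) f ≡ ∑ (upTo n) (f ∘ g)
∑-applyUpTo g n f = trans (lemma g n f) (sym (lemma id n (f ∘ g)))
  where
  unrolled : ℕ → (ℕ → ℤ) → ℤ
  unrolled zero    h = 0ℤ
  unrolled (suc n) h = h 0 ℤ.+ unrolled n (h ∘ suc)
  lemma : ∀ {a} {A : Set a} (g : ℕ → A) n (f : A → ℤ) → ∑ (applyUpTo g n) f ≡ unrolled n (f ∘ g)
  lemma g zero    f = refl
  lemma g (suc n) f = cong (λ z → f (g 0) ℤ.+ z) (lemma (g ∘ suc) n f)

-- The ring of formal power series and its derivation D.

infix 4 _≈ˢ_
infixl 6 _+ˢ_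
infix 8 -ˢ_

_≈ˢ_ : Series → Series → Set
f ≈ˢ g = ∀ n → f n ≡ g n

_+ˢ_ : Series → Series → Series
(f +ˢ g) n = f n ℤ.+ g n

-ˢ_ : Series → Series
(-ˢ f) n = ℤ.- f n

const : ℤ → Series
const c zero    = c
const c (suc n) = 0ℤ

const-zero : ∀ n → const 0ℤ n ≡ 0ℤ
const-zero zero    = refl
const-zero (suc n) = refl

tail : Series → Series
tail f n = f (suc n)

infix 8 D_
D_ : Series → Series
(D f) n = + n ℤ.* f n

infixl 7 _·_

-- Cauchy product, kept opaque so that the ring solver treats products as atoms.
opaque
  _·_ : Series → Series → Series
  _·_ = _*ˢ_

  ·-def : ∀ f g → (f *ˢ g) ≈ˢ (f · g)
  ·-def f g n = refl

  ·-zero : ∀ f g → (f · g) 0 ≡ f 0 ℤ.* g 0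
  ·-zero f g = ℤₚ.+-identityʳ _

  -- Splits f as f 0 + q · tail f. Together with `·-zero` it replaces the sum over `upTo` by a
  -- recursion, on which the ring laws are proved by induction.
  ·-suc : ∀ f g n → (f · g) (suc n) ≡ f 0 ℤ.* g (suc n) ℤ.+ (tail f · g) n
  ·-suc f g n = cong (λ z → f 0 ℤ.* g (suc n) ℤ.+ z)
    (∑-applyUpTo suc (suc n) (λ i → f i ℤ.* g (suc n ∸ i)))

-- This licenses the later truncations of infinite sums and products inside a Cauchy product:
-- coefficient n sees nothing beyond degree n of either factor.
·-cong-≤ : ∀ n {f f′ g g′} → (∀ i → i ≤ n → f i ≡ f′ i) → (∀ i → i ≤ n → g i ≡ g′ i) →
            (f · g) n ≡ (f′ · g′) n
·-cong-≤ zero {f} {f′} {g} {g′} p q =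
  trans (·-zero f g) (trans (cong₂ ℤ._*_ (p 0 z≤n) (q 0 z≤n)) (sym (·-zero f′ g′)))
·-cong-≤ (suc n) {f} {f′} {g} {g′} p q =
  trans (·-suc f g n) (trans
    (cong₂ ℤ._+_ (cong₂ ℤ._*_ (p 0 z≤n) (q (suc n) ℕₚ.≤-refl))
      (·-cong-≤ n (λ i i≤n → p (suc i) (s≤s i≤n)) (λ i i≤n → q i (ℕₚ.m≤n⇒m≤1+n i≤n))))
    (sym (·-suc f′ g′ n)))

·-cong : ∀ {f f′ g g′} → f ≈ˢ f′ → g ≈ˢ g′ → (f · g) ≈ˢ (f′ · g′)
·-cong p q n = ·-cong-≤ n (λ i _ → p i) (λ i _ → q i)

·-vanish : ∀ n {f} g → (∀ i → i ≤ n → f i ≡ 0ℤ) → (f · g) n ≡ 0ℤ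
·-vanish zero    {f} g p = trans (·-zero f g) (cong (ℤ._* g 0) (p 0 z≤n))
·-vanish (suc n) {f} g p = trans (·-suc f g n)
  (cong₂ ℤ._+_ (cong (ℤ._* g (suc n)) (p 0 z≤n)) (·-vanish n g (λ i i≤n → p (suc i) (s≤s i≤n))))

const-· : ∀ c f n → (const c · f) n ≡ c ℤ.* f n
const-· c f zero    = ·-zero (const c) f
const-· c f (suc n) = trans (·-suc (const c) f n)
  (trans (cong (λ z → c ℤ.* f (suc n) ℤ.+ z) (·-vanish n f λ _ _ → refl)) (ℤₚ.+-identityʳ _))

·-distribʳ : ∀ h f g → ((f +ˢ g) · h) ≈ˢ (f · h +ˢ g · h)
·-distribʳ h f g zero
  rewrite ·-zero (f +ˢ g) h | ·-zero f h | ·-zero g h = ℤₚ.*-distribʳ-+ (h 0) (f 0) (g 0)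
·-distribʳ h f g (suc n)
  rewrite ·-suc (f +ˢ g) h n | ·-suc f h n | ·-suc g h n | ·-distribʳ h (tail f) (tail g) n =
  Solver.solve 5 (λ a b c x y → (a :+ b) :* c :+ (x :+ y) := (a :* c :+ x) :+ (b :* c :+ y)) refl
    (f 0) (g 0) (h (suc n)) ((tail f · h) n) ((tail g · h) n)
  where open Solver

scale-· : ∀ c f g n → ((λ i → c ℤ.* f i) · g) n ≡ c ℤ.* (f · g) n
scale-· c f g zero
  rewrite ·-zero (λ i → c ℤ.* f i) g | ·-zero f g = ℤₚ.*-assoc c (f 0) (g 0)
scale-· c f g (suc n)
  rewrite ·-suc (λ i → c ℤ.* f i) g n | ·-suc f g n | scale-· c (tail f) g n =
  Solver.solve 4 (λ c a b x → c :* a :* b :+ c :* x := c :* (a :* b :+ x)) refl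
    c (f 0) (g (suc n)) ((tail f · g) n)
  where open Solver

-- The constant terms of both factors are stripped off in turn; both orders meet in
-- `tail f · tail g`, two degrees lower, hence the two base cases.
·-comm : ∀ f g → (f · g) ≈ˢ (g · f)
·-comm f g zero
  rewrite ·-zero f g | ·-zero g f = ℤₚ.*-comm (f 0) (g 0)
·-comm f g (suc zero)
  rewrite ·-suc f g 0 | ·-suc g f 0 | ·-zero (tail f) g | ·-zero (tail g) f =
  Solver.solve 4 (λ a b c d → a :* b :+ c :* d := d :* c :+ b :* a) refl (f 0) (g 1) (f 1) (g 0)
  where open Solver
·-comm f g (suc (suc n)) = begin
  (f · g) (2 ℕ.+ n)
    ≡⟨ ·-suc f g (suc n) ⟩
  f 0 ℤ.* g (2 ℕ.+ n) ℤ.+ (tail f · g) (suc n)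
    ≡⟨ cong (λ z → f 0 ℤ.* g (2 ℕ.+ n) ℤ.+ z) (trans (·-comm (tail f) g (suc n)) (·-suc g (tail f) n)) ⟩
  f 0 ℤ.* g (2 ℕ.+ n) ℤ.+ (g 0 ℤ.* f (2 ℕ.+ n) ℤ.+ (tail g · tail f) n)
    ≡⟨ cong (λ z → f 0 ℤ.* g (2 ℕ.+ n) ℤ.+ (g 0 ℤ.* f (2 ℕ.+ n) ℤ.+ z)) (·-comm (tail g) (tail f) n) ⟩
  f 0 ℤ.* g (2 ℕ.+ n) ℤ.+ (g 0 ℤ.* f (2 ℕ.+ n) ℤ.+ (tail f · tail g) n)
    ≡⟨ Solver.solve 3 (λ a b x → a :+ (b :+ x) := b :+ (a :+ x)) refl
        (f 0 ℤ.* g (2 ℕ.+ n)) (g 0 ℤ.* f (2 ℕ.+ n)) ((tail f · tail g) n) ⟩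
  g 0 ℤ.* f (2 ℕ.+ n) ℤ.+ (f 0 ℤ.* g (2 ℕ.+ n) ℤ.+ (tail f · tail g) n)
    ≡⟨ cong (λ z → g 0 ℤ.* f (2 ℕ.+ n) ℤ.+ z) (trans (sym (·-suc f (tail g) n)) (·-comm f (tail g) (suc n))) ⟩
  g 0 ℤ.* f (2 ℕ.+ n) ℤ.+ (tail g · f) (suc n)
    ≡⟨ sym (·-suc g f (suc n)) ⟩
  (g · f) (2 ℕ.+ n) ∎
  where open ≡-Reasoning
        open Solver

·-assoc : ∀ f g h → ((f · g) · h) ≈ˢ (f · (g · h))
·-assoc f g h zero
  rewrite ·-zero (f · g) h | ·-zero f g | ·-zero f (g · h) | ·-zero g h = ℤₚ.*-assoc (f 0) (g 0) (h 0)
·-assoc f g h (suc n) = begin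
  ((f · g) · h) (suc n)
    ≡⟨ ·-suc (f · g) h n ⟩
  (f · g) 0 ℤ.* h (suc n) ℤ.+ (tail (f · g) · h) n
    ≡⟨ cong₂ (λ x y → x ℤ.* h (suc n) ℤ.+ y) (·-zero f g) (·-cong {g = h} (·-suc f g) (λ _ → refl) n) ⟩
  f 0 ℤ.* g 0 ℤ.* h (suc n) ℤ.+ (((λ i → f 0 ℤ.* tail g i) +ˢ (tail f · g)) · h) n
    ≡⟨ cong (λ y → f 0 ℤ.* g 0 ℤ.* h (suc n) ℤ.+ y) (trans (·-distribʳ h _ _ n)
        (cong₂ ℤ._+_ (scale-· (f 0) (tail g) h n) (·-assoc (tail f) g h n))) ⟩
  f 0 ℤ.* g 0 ℤ.* h (suc n) ℤ.+ (f 0 ℤ.* (tail g · h) n ℤ.+ (tail f · (g · h)) n)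
    ≡⟨ Solver.solve 5 (λ a b c x y → a :* b :* c :+ (a :* x :+ y) := a :* (b :* c :+ x) :+ y) refl
        (f 0) (g 0) (h (suc n)) ((tail g · h) n) ((tail f · (g · h)) n) ⟩
  f 0 ℤ.* (g 0 ℤ.* h (suc n) ℤ.+ (tail g · h) n) ℤ.+ (tail f · (g · h)) n
    ≡⟨ cong (λ y → f 0 ℤ.* y ℤ.+ (tail f · (g · h)) n) (sym (·-suc g h n)) ⟩
  f 0 ℤ.* (g · h) (suc n) ℤ.+ (tail f · (g · h)) n
    ≡⟨ sym (·-suc f (g · h) n) ⟩
  (f · (g · h)) (suc n) ∎
  where open ≡-Reasoning
        open Solver

-- Induction through `tail`, with which D does not commute: `tail (D f)` is `tail f +ˢ D (tail f)`.
-- The extra `tail f` accounts for the factor n + 1 in place of n.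
D-· : ∀ f g → D (f · g) ≈ˢ (D f · g +ˢ f · D g)
D-· f g zero = begin
  0ℤ ℤ.* (f · g) 0                    ≡⟨ sym (ℤₚ.*-zeroʳ (f 0)) ⟩
  f 0 ℤ.* (D g) 0                      ≡⟨ sym (·-zero f (D g)) ⟩
  (f · D g) 0                         ≡⟨ sym (ℤₚ.+-identityˡ _) ⟩
  0ℤ ℤ.+ (f · D g) 0                  ≡⟨ cong (ℤ._+ (f · D g) 0) (sym (·-zero (D f) g)) ⟩
  (D f · g) 0 ℤ.+ (f · D g) 0        ∎
  where open ≡-Reasoning
D-· f g (suc n) = begin
  + suc n ℤ.* (f · g) (suc n)
    ≡⟨ cong (+ suc n ℤ.*_) (·-suc f g n) ⟩
  (1ℤ ℤ.+ + n) ℤ.* (f 0 ℤ.* g (suc n) ℤ.+ (tail f · g) n)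
    ≡⟨ Solver.solve 4 (λ m a b x → (con 1ℤ :+ m) :* (a :* b :+ x) := x :+ m :* x :+ a :* ((con 1ℤ :+ m) :* b)) refl
        (+ n) (f 0) (g (suc n)) ((tail f · g) n) ⟩
  (tail f · g) n ℤ.+ + n ℤ.* (tail f · g) n ℤ.+ f 0 ℤ.* (+ suc n ℤ.* g (suc n))
    ≡⟨ cong (λ z → (tail f · g) n ℤ.+ z ℤ.+ f 0 ℤ.* (+ suc n ℤ.* g (suc n))) (D-· (tail f) g n) ⟩
  (tail f · g) n ℤ.+ ((D (tail f) · g) n ℤ.+ (tail f · D g) n) ℤ.+ f 0 ℤ.* (+ suc n ℤ.* g (suc n))
    ≡⟨ Solver.solve 4 (λ x y z w → x :+ (y :+ z) :+ w := (con 0ℤ :+ (x :+ y)) :+ (w :+ z)) refl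
        ((tail f · g) n) ((D (tail f) · g) n) ((tail f · D g) n) (f 0 ℤ.* (+ suc n ℤ.* g (suc n))) ⟩
  (0ℤ ℤ.+ ((tail f · g) n ℤ.+ (D (tail f) · g) n)) ℤ.+ (f 0 ℤ.* (D g) (suc n) ℤ.+ (tail f · D g) n)
    ≡⟨ cong₂ (λ x y → (0ℤ ℤ.+ x) ℤ.+ y)
        (trans (sym (·-distribʳ g (tail f) (D (tail f)) n))
               (·-cong {g = g} (λ i → Solver.solve 2 (λ m x → x :+ m :* x := (con 1ℤ :+ m) :* x) refl (+ i) (f (suc i)))
                        (λ _ → refl) n))
        (sym (·-suc f (D g) n)) ⟩
  (0ℤ ℤ.* g (suc n) ℤ.+ (tail (D f) · g) n) ℤ.+ (f · D g) (suc n)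
    ≡⟨ cong (ℤ._+ (f · D g) (suc n)) (sym (·-suc (D f) g n)) ⟩
  (D f · g) (suc n) ℤ.+ (f · D g) (suc n) ∎
  where open ≡-Reasoning
        open Solver

1ˢ-const : 1ˢ ≈ˢ const 1ℤ
1ˢ-const zero    = refl
1ˢ-const (suc n) = refl

·-identityˡ : ∀ f → (const 1ℤ · f) ≈ˢ f
·-identityˡ f n = trans (const-· 1ℤ f n) (ℤₚ.*-identityˡ (f n))

seriesRing : CommutativeRing 0ℓ 0ℓ
seriesRing = record
  { Carrier = Series
  ; _≈_ = _≈ˢ_
  ; _+_ = _+ˢ_
  ; _*_ = _·_
  ; -_  = -ˢ_
  ; 0#  = λ _ → 0ℤ
  ; 1#  = const 1ℤ
  ; isCommutativeRing = record
    { isRing = record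
      { +-isAbelianGroup = Pointwise.isAbelianGroup ℕ ℤₚ.+-0-isAbelianGroup
      ; *-cong = ·-cong
      ; *-assoc = ·-assoc
      ; *-identity = ·-identityˡ , λ f n → trans (·-comm f (const 1ℤ) n) (·-identityˡ f n)
      ; distrib = (λ f g h n → trans (·-comm f (g +ˢ h) n) (trans (·-distribʳ f g h n)
                    (cong₂ ℤ._+_ (·-comm g f n) (·-comm h f n))))
                , ·-distribʳ
      }
    ; *-comm = ·-comm
    }
  }

-- Finite sums

Σ : ℕ → (ℕ → ℤ) → ℤ
Σ zero    f = 0ℤ
Σ (suc n) f = Σ n f ℤ.+ f (suc n)

Σ-cong : ∀ n {f g : ℕ → ℤ} → (∀ i → i < n → f (suc i) ≡ g (suc i)) → Σ n f ≡ Σ n g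
Σ-cong zero    e = refl
Σ-cong (suc n) e = cong₂ ℤ._+_ (Σ-cong n (λ i i<n → e i (ℕₚ.m≤n⇒m≤1+n i<n))) (e n ℕₚ.≤-refl)

Σ-zero : ∀ n {f : ℕ → ℤ} → (∀ i → i < n → f (suc i) ≡ 0ℤ) → Σ n f ≡ 0ℤ
Σ-zero zero    e = refl
Σ-zero (suc n) e = cong₂ ℤ._+_ (Σ-zero n (λ i i<n → e i (ℕₚ.m≤n⇒m≤1+n i<n))) (e n ℕₚ.≤-refl)

Σ-+ : ∀ n (f g : ℕ → ℤ) → Σ n (λ i → f i ℤ.+ g i) ≡ Σ n f ℤ.+ Σ n g
Σ-+ zero    f g = refl
Σ-+ (suc n) f g = trans (cong (ℤ._+ (f (suc n) ℤ.+ g (suc n))) (Σ-+ n f g))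
  (Solver.solve 4 (λ a b c d → a :+ b :+ (c :+ d) := a :+ c :+ (b :+ d)) refl
    (Σ n f) (Σ n g) (f (suc n)) (g (suc n)))
  where open Solver

Σ-* : ∀ n c (f : ℕ → ℤ) → Σ n (λ i → c ℤ.* f i) ≡ c ℤ.* Σ n f
Σ-* zero    c f = sym (ℤₚ.*-zeroʳ c)
Σ-* (suc n) c f = trans (cong (ℤ._+ c ℤ.* f (suc n)) (Σ-* n c f)) (sym (ℤₚ.*-distribˡ-+ c _ _))

Σ-- : ∀ n (f g : ℕ → ℤ) → Σ n (λ i → f i ℤ.- g i) ≡ Σ n f ℤ.- Σ n g
Σ-- zero    f g = refl
Σ-- (suc n) f g = trans (cong (ℤ._+ (f (suc n) ℤ.- g (suc n))) (Σ-- n f g))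
  (Solver.solve 4 (λ a b c d → a :- b :+ (c :- d) := a :+ c :- (b :+ d)) refl
    (Σ n f) (Σ n g) (f (suc n)) (g (suc n)))
  where open Solver

Σ-extend : ∀ {n N} {f : ℕ → ℤ} → n ≤ N → (∀ i → n ≤ i → f (suc i) ≡ 0ℤ) → Σ N f ≡ Σ n f
Σ-extend {n} {N} {f} n≤N e = go (ℕₚ.≤⇒≤′ n≤N)
  where
  go : ∀ {N} → n ℕ.≤′ N → Σ N f ≡ Σ n f
  go ℕ.≤′-refl        = refl
  go (ℕ.≤′-step n≤′N) = trans (cong₂ ℤ._+_ (go n≤′N) (e _ (ℕₚ.≤′⇒≤ n≤′N))) (ℤₚ.+-identityʳ _)

Σ-single : ∀ n j {f : ℕ → ℤ} → j < n → (∀ i → i ≢ j → f (suc i) ≡ 0ℤ) → Σ n f ≡ f (suc j)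
Σ-single n j {f} j<n e =
  trans (Σ-extend j<n (λ i 1+j≤i → e i (ℕₚ.<⇒≢ 1+j≤i ∘ sym)))
  (trans (cong (ℤ._+ f (suc j)) (Σ-zero j (λ i i<j → e i (ℕₚ.<⇒≢ i<j)))) (ℤₚ.+-identityˡ _))

Σ-head : ∀ n (f : ℕ → ℤ) → Σ (suc n) f ≡ f 1 ℤ.+ Σ n (f ∘ suc)
Σ-head zero    f = trans (ℤₚ.+-identityˡ (f 1)) (sym (ℤₚ.+-identityʳ (f 1)))
Σ-head (suc n) f = trans (cong (ℤ._+ f (2 ℕ.+ n)) (Σ-head n f)) (ℤₚ.+-assoc (f 1) (Σ n (f ∘ suc)) (f (2 ℕ.+ n)))

Σ-reverse : ∀ n (f : ℕ → ℤ) → Σ n (λ i → f (suc n ∸ i)) ≡ Σ n f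
Σ-reverse zero    f = refl
Σ-reverse (suc n) f = trans (Σ-head n (λ i → f (2 ℕ.+ n ∸ i)))
  (trans (cong (λ z → f (suc n) ℤ.+ z) (Σ-reverse n f)) (ℤₚ.+-comm (f (suc n)) (Σ n f)))

Σ-telescope : ∀ n (f T : ℕ → ℤ) → (∀ i → i < n → f (suc i) ≡ T (2 ℕ.+ i) ℤ.- T (suc i)) →
              Σ n f ≡ T (suc n) ℤ.- T 1
Σ-telescope zero    f T e = sym (ℤₚ.+-inverseʳ (T 1))
Σ-telescope (suc n) f T e = trans
  (cong₂ ℤ._+_ (Σ-telescope n f T (λ i i<n → e i (ℕₚ.m≤n⇒m≤1+n i<n))) (e n ℕₚ.≤-refl))
  (Solver.solve 3 (λ x y z → y :- z :+ (x :- y) := x :- z) refl (T (2 ℕ.+ n)) (T (suc n)) (T 1))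
  where open Solver

square : ℕ → (ℕ → ℕ → ℤ) → ℤ
square n F = Σ n (λ a → Σ n (F a))

-- The bound `pred c` makes this the sum over 1 ≤ a < c ≤ n.
triangle : ℕ → (ℕ → ℕ → ℤ) → ℤ
triangle n F = Σ n (λ c → Σ (pred c) (λ a → F a c))

square-cong : ∀ n {F G : ℕ → ℕ → ℤ} → (∀ a b → F (suc a) (suc b) ≡ G (suc a) (suc b)) → square n F ≡ square n G
square-cong n e = Σ-cong n (λ a _ → Σ-cong n (λ b _ → e a b))

square-+ : ∀ n (F G : ℕ → ℕ → ℤ) → square n (λ a b → F a b ℤ.+ G a b) ≡ square n F ℤ.+ square n G
square-+ n F G = trans (Σ-cong n (λ a _ → Σ-+ n (F (suc a)) (G (suc a)))) (Σ-+ n _ _)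

square-* : ∀ n c (F : ℕ → ℕ → ℤ) → square n (λ a b → c ℤ.* F a b) ≡ c ℤ.* square n F
square-* n c F = trans (Σ-cong n (λ a _ → Σ-* n c (F (suc a)))) (Σ-* n c _)

triangle-cong : ∀ n {F G : ℕ → ℕ → ℤ} → (∀ a c → a < c → F (suc a) (suc c) ≡ G (suc a) (suc c)) →
                triangle n F ≡ triangle n G
triangle-cong n e = Σ-cong n (λ c _ → Σ-cong c (λ a a<c → e a c a<c))

triangle-+ : ∀ n (F G : ℕ → ℕ → ℤ) → triangle n (λ a b → F a b ℤ.+ G a b) ≡ triangle n F ℤ.+ triangle n G
triangle-+ n F G = trans (Σ-cong n (λ c _ → Σ-+ c (λ a → F a (suc c)) (λ a → G a (suc c)))) (Σ-+ n _ _)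

triangle-reverse : ∀ n (F : ℕ → ℕ → ℤ) → triangle n (λ a c → F (c ∸ a) c) ≡ triangle n F
triangle-reverse n F = Σ-cong n (λ c _ → Σ-reverse c (λ a → F a (suc c)))

square-split : ∀ n (F : ℕ → ℕ → ℤ) →
               square n F ≡ triangle n F ℤ.+ triangle n (flip F) ℤ.+ Σ n (λ a → F a a)
square-split zero    F = refl
square-split (suc n) F = begin
  Σ n (λ a → Σ n (F a) ℤ.+ F a (suc n)) ℤ.+ (Σ n (F (suc n)) ℤ.+ F (suc n) (suc n))
    ≡⟨ cong (ℤ._+ (Σ n (F (suc n)) ℤ.+ F (suc n) (suc n)))
        (trans (Σ-+ n _ _) (cong (ℤ._+ Σ n (λ a → F a (suc n))) (square-split n F))) ⟩
  triangle n F ℤ.+ triangle n (flip F) ℤ.+ Σ n (λ a → F a a) ℤ.+ Σ n (λ a → F a (suc n))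
    ℤ.+ (Σ n (F (suc n)) ℤ.+ F (suc n) (suc n))
    ≡⟨ Solver.solve 6 (λ a b c d e f → a :+ b :+ c :+ d :+ (e :+ f) := (a :+ d) :+ (b :+ e) :+ (c :+ f)) refl
        (triangle n F) (triangle n (flip F)) (Σ n (λ a → F a a)) (Σ n (λ a → F a (suc n)))
        (Σ n (F (suc n))) (F (suc n) (suc n)) ⟩
  triangle (suc n) F ℤ.+ triangle (suc n) (flip F) ℤ.+ Σ (suc n) (λ a → F a a) ∎
  where open ≡-Reasoning
        open Solver

-- Setting c = a + b maps the part a + b ≤ n of the square onto the triangle a < c ≤ n; the
-- hypothesis disposes of the rest of the square.
square-antidiagonals : ∀ n {G : ℕ → ℕ → ℤ} → (∀ a b → n < suc a ℕ.+ suc b → G (suc a) (suc b) ≡ 0ℤ) →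
                       square n G ≡ triangle n (λ a c → G a (c ∸ a))
square-antidiagonals n {G} vanish =
  trans (Σ-cong n (λ a a<n → Σ-extend (ℕₚ.m∸n≤m n (suc a)) (λ b n∸a≤b → vanish a b (bound a b a<n n∸a≤b)))) (go n)
  where
  bound : ∀ a b → a < n → n ∸ suc a ≤ b → n < suc a ℕ.+ suc b
  bound a b a<n le rewrite ℕₚ.+-suc a b = s≤s (subst (_≤ suc a ℕ.+ b) (ℕₚ.m+[n∸m]≡n a<n) (ℕₚ.+-monoʳ-≤ (suc a) le))
  go : ∀ N → Σ N (λ a → Σ (N ∸ a) (G a)) ≡ triangle N (λ a c → G a (c ∸ a))
  go zero    = refl
  go (suc N) = begin
    Σ N (λ a → Σ (suc N ∸ a) (G a)) ℤ.+ Σ (N ∸ N) (G (suc N))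
      ≡⟨ cong₂ ℤ._+_ (Σ-cong N (λ a a<N → lemma (suc a) a<N)) (cong (λ m → Σ m (G (suc N))) (ℕₚ.n∸n≡0 N)) ⟩
    Σ N (λ a → Σ (N ∸ a) (G a) ℤ.+ G a (suc N ∸ a)) ℤ.+ 0ℤ
      ≡⟨ trans (ℤₚ.+-identityʳ _) (Σ-+ N _ _) ⟩
    Σ N (λ a → Σ (N ∸ a) (G a)) ℤ.+ Σ N (λ a → G a (suc N ∸ a))
      ≡⟨ cong (ℤ._+ Σ N (λ a → G a (suc N ∸ a))) (go N) ⟩
    triangle (suc N) (λ a c → G a (c ∸ a)) ∎
    where
    open ≡-Reasoning
    lemma : ∀ a → a ≤ N → Σ (suc N ∸ a) (G a) ≡ Σ (N ∸ a) (G a) ℤ.+ G a (suc N ∸ a)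
    lemma a a≤N rewrite ℕₚ.+-∸-assoc 1 a≤N = refl

-- Series arithmetic

const-morphism : ℤ.+-*-rawRing -Raw-AlmostCommutative⟶ fromCommutativeRing seriesRing
const-morphism = record
  { ⟦_⟧    = const
  ; +-homo = λ { x y zero → refl ; x y (suc n) → refl }
  ; *-homo = λ { x y zero → sym (const-·  x (const y) zero)
               ; x y (suc n) → sym (trans (const-· x (const y) (suc n)) (ℤₚ.*-zeroʳ x)) }
  ; -‿homo = λ { x zero → refl ; x (suc n) → refl }
  ; 0-homo = λ { zero → refl ; (suc n) → refl }
  ; 1-homo = λ n → refl
  }

module SeriesSolver = RingSolver ℤ.+-*-rawRing (fromCommutativeRing seriesRing) const-morphism
  (λ x y → Maybe.map (λ x≡y n → cong (λ z → const z n) x≡y) (dec⇒maybe (x ℤₚ.≟ y)))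

open CommutativeRing seriesRing public using ()
  renaming (refl to reflˢ; sym to symˢ; trans to transˢ; +-cong to +ˢ-cong; -‿cong to -ˢ-cong; setoid to seriesSetoid)

module ≈ˢ-Reasoning = SetoidReasoning seriesSetoid

q-suc : ∀ r f n → (q^ suc r · f) (suc n) ≡ (q^ r · f) n
q-suc r f n = trans (·-suc (q^ suc r) f n)
  (trans (ℤₚ.+-identityˡ _) refl)

q-shift : ∀ r f n → (q^ r · f) (r ℕ.+ n) ≡ f n
q-shift zero    f n = trans (·-cong {1ˢ} {const 1ℤ} {f} 1ˢ-const (λ _ → refl) n) (·-identityˡ f n)
q-shift (suc r) f n = trans (q-suc r f (r ℕ.+ n)) (q-shift r f n)

q-vanish : ∀ r f n → n < r → (q^ r · f) n ≡ 0ℤ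
q-vanish (suc r) f zero    _         = ·-zero (q^ suc r) f
q-vanish (suc r) f (suc n) (s≤s n<r) = trans (q-suc r f n) (q-vanish r f n n<r)

q-+ : ∀ a b → q^ a · q^ b ≈ˢ q^ (a ℕ.+ b)
q-+ zero    b n       = q-shift 0 (q^ b) n
q-+ (suc a) b zero    = ·-zero (q^ suc a) (q^ b)
q-+ (suc a) b (suc n) = trans (q-suc a (q^ b) n) (q-+ a b n)

-- The series q^a / (1 - q^a).

opaque
  -- The value at 0 is set apart because every a divides 0, while q^a / (1 - q^a) has no constant
  -- term.
  X : ℕ → Series
  X a zero    = 0ℤ
  X a (suc n) = if does (a ∣? suc n) then 1ℤ else 0ℤ

  X-zero : ∀ a → X a 0 ≡ 0ℤ
  X-zero a = refl

  X-if : ∀ a n → X a (suc n) ≡ (if does (a ∣? suc n) then 1ℤ else 0ℤ)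
  X-if a n = refl

X-∣ : ∀ {a n} → a ∣ suc n → X a (suc n) ≡ 1ℤ
X-∣ {a} {n} a∣n = trans (X-if a n) (cong (if_then 1ℤ else 0ℤ) (dec-true (a ∣? suc n) a∣n))

X-∤ : ∀ {a n} → a ∤ suc n → X a (suc n) ≡ 0ℤ
X-∤ {a} {n} a∤n = trans (X-if a n) (cong (if_then 1ℤ else 0ℤ) (dec-false (a ∣? suc n) a∤n))

X-vanish : ∀ a n → n < a → X a n ≡ 0ℤ
X-vanish a zero    _   = X-zero a
X-vanish a (suc n) n<a = X-∤ (>⇒∤ n<a)

-- The equation x = q^a (1 + x) stands in for division by 1 - q^a. `X-product`, `D-X` and `linear-′`
-- use no other property of `X`.
X-fixpoint : ∀ a → X (suc a) ≈ˢ q^ suc a · (const 1ℤ +ˢ X (suc a))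
X-fixpoint a n with n ℕₚ.<? suc a
... | yes n<a = trans (X-vanish (suc a) n n<a) (sym (q-vanish (suc a) _ n n<a))
... | no  n≮a with ℕₚ.m+[n∸m]≡n (ℕₚ.≮⇒≥ n≮a)
... | eq = subst (λ n → X (suc a) n ≡ (q^ suc a · (const 1ℤ +ˢ X (suc a))) n) eq
             (trans (lemma (n ∸ suc a)) (sym (q-shift (suc a) _ (n ∸ suc a))))
  where
  lemma : ∀ m → X (suc a) (suc a ℕ.+ m) ≡ const 1ℤ m ℤ.+ X (suc a) m
  lemma zero rewrite ℕₚ.+-identityʳ a | X-zero (suc a) = X-∣ {suc a} {a} ∣-refl
  lemma (suc m) with suc a ∣? suc m
  ... | yes a∣m = trans (X-∣ (∣m∣n⇒∣m+n ∣-refl a∣m)) (sym (trans (ℤₚ.+-identityˡ _) (X-∣ a∣m)))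
  ... | no  a∤m = trans (X-∤ (λ a∣a+m → a∤m (∣m+n∣m⇒∣n a∣a+m ∣-refl))) (sym (trans (ℤₚ.+-identityˡ _) (X-∤ a∤m)))

-- Writing x y as x y (1 + z) - z x y and inserting x = u (1 + x), y = v (1 + y), z = u v (1 + z)
-- makes u v (1 + z) = z a common factor, with cofactor (1 + x)(1 + y) - x y. No series has to be
-- inverted.
X-product : ∀ a b → X (suc a) · X (suc b) ≈ˢ X (suc a ℕ.+ suc b) · (const 1ℤ +ˢ X (suc a) +ˢ X (suc b))
X-product a b = begin
  x · y
    ≈⟨ solve 3 (λ x y z → x :* y := x :* y :* (con 1ℤ :+ z) :- z :* (x :* y)) reflˢ x y z ⟩
  x · y · (one +ˢ z) +ˢ -ˢ (z · (x · y))
    ≈⟨ +ˢ-cong (·-cong (·-cong (X-fixpoint a) (X-fixpoint b)) reflˢ) (-ˢ-cong (·-cong z-fix reflˢ)) ⟩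
  (u · (one +ˢ x)) · (v · (one +ˢ y)) · (one +ˢ z) +ˢ -ˢ ((u · v · (one +ˢ z)) · (x · y))
    ≈⟨ solve 5 (λ x y z u v → (u :* (con 1ℤ :+ x)) :* (v :* (con 1ℤ :+ y)) :* (con 1ℤ :+ z) :- u :* v :* (con 1ℤ :+ z) :* (x :* y)
                           := u :* v :* (con 1ℤ :+ z) :* (con 1ℤ :+ x :+ y)) reflˢ x y z u v ⟩
  (u · v · (one +ˢ z)) · (one +ˢ x +ˢ y)
    ≈⟨ ·-cong (symˢ z-fix) reflˢ ⟩
  z · (one +ˢ x +ˢ y) ∎
  where
  open ≈ˢ-Reasoning
  open SeriesSolver
  one = const 1ℤ
  x = X (suc a)
  y = X (suc b)
  z = X (suc a ℕ.+ suc b)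
  u = q^ suc a
  v = q^ suc b
  z-fix : z ≈ˢ u · v · (one +ˢ z)
  z-fix = transˢ (X-fixpoint (a ℕ.+ suc b)) (·-cong (symˢ (q-+ (suc a) (suc b))) reflˢ)

D-q : ∀ r → D (q^ r) ≈ˢ const (+ r) · q^ r
D-q r n = trans (lemma r n) (sym (const-· (+ r) (q^ r) n))
  where
  lemma : ∀ r n → + n ℤ.* (q^ r) n ≡ + r ℤ.* (q^ r) n
  lemma zero    zero    = refl
  lemma zero    (suc n) = ℤₚ.*-zeroʳ (+ suc n)
  lemma (suc r) zero    = sym (ℤₚ.*-zeroʳ (+ suc r))
  lemma (suc r) (suc n) = begin
    (1ℤ ℤ.+ + n) ℤ.* (q^ r) n          ≡⟨ ℤₚ.*-distribʳ-+ ((q^ r) n) 1ℤ (+ n) ⟩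
    1ℤ ℤ.* (q^ r) n ℤ.+ + n ℤ.* (q^ r) n ≡⟨ cong (λ z → 1ℤ ℤ.* (q^ r) n ℤ.+ z) (lemma r n) ⟩
    1ℤ ℤ.* (q^ r) n ℤ.+ + r ℤ.* (q^ r) n ≡⟨ sym (ℤₚ.*-distribʳ-+ ((q^ r) n) 1ℤ (+ r)) ⟩
    (1ℤ ℤ.+ + r) ℤ.* (q^ r) n ∎
    where open ≡-Reasoning

D-cong : ∀ {f g} → f ≈ˢ g → D f ≈ˢ D g
D-cong e n = cong (+ n ℤ.*_) (e n)

D-+ : ∀ f g → D (f +ˢ g) ≈ˢ D f +ˢ D g
D-+ f g n = ℤₚ.*-distribˡ-+ (+ n) (f n) (g n)

D-neg : ∀ f → D (-ˢ f) ≈ˢ -ˢ (D f)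
D-neg f n = sym (ℤₚ.neg-distribʳ-* (+ n) (f n))

D-const : ∀ c → D (const c) ≈ˢ const 0ℤ
D-const c zero    = refl
D-const c (suc n) = ℤₚ.*-zeroʳ (+ suc n)

-- Differentiating x = u (1 + x) gives D x = a u (1 + x) + u D x. In (1 + x) D x - x D x the terms u
-- (1 + x) D x cancel, again without inverting 1 - u.
D-X : ∀ a → D (X (suc a)) ≈ˢ const (+ suc a) · X (suc a) · (const 1ℤ +ˢ X (suc a))
D-X a = begin
  D x
    ≈⟨ solve 2 (λ x d → d := (con 1ℤ :+ x) :* d :- x :* d) reflˢ x (D x) ⟩
  (one +ˢ x) · D x +ˢ -ˢ (x · D x)
    ≈⟨ +ˢ-cong (·-cong reflˢ dx) (-ˢ-cong (·-cong (X-fixpoint a) reflˢ)) ⟩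
  (one +ˢ x) · (r · u · (one +ˢ x) +ˢ u · D x) +ˢ -ˢ ((u · (one +ˢ x)) · D x)
    ≈⟨ solve 4 (λ x d u r → (con 1ℤ :+ x) :* (r :* u :* (con 1ℤ :+ x) :+ u :* d) :- u :* (con 1ℤ :+ x) :* d
                         := r :* (u :* (con 1ℤ :+ x)) :* (con 1ℤ :+ x)) reflˢ x (D x) u r ⟩
  r · (u · (one +ˢ x)) · (one +ˢ x)
    ≈⟨ ·-cong (·-cong (reflˢ {r}) (symˢ (X-fixpoint a))) reflˢ ⟩
  r · x · (one +ˢ x) ∎
  where
  open ≈ˢ-Reasoning
  open SeriesSolver
  one = const 1ℤ
  x = X (suc a)
  u = q^ suc a
  r = const (+ suc a)
  dx : D x ≈ˢ r · u · (one +ˢ x) +ˢ u · D x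
  dx = begin
    D x ≈⟨ D-cong (X-fixpoint a) ⟩
    D (u · (one +ˢ x)) ≈⟨ D-· u (one +ˢ x) ⟩
    D u · (one +ˢ x) +ˢ u · D (one +ˢ x)
      ≈⟨ +ˢ-cong (·-cong (D-q (suc a)) reflˢ) (·-cong (reflˢ {u}) (transˢ (D-+ one x) (+ˢ-cong (D-const 1ℤ) reflˢ))) ⟩
    r · u · (one +ˢ x) +ˢ u · (const 0ℤ +ˢ D x)
      ≈⟨ solve 4 (λ x d u r → r :* u :* (con 1ℤ :+ x) :+ u :* (con 0ℤ :+ d) := r :* u :* (con 1ℤ :+ x) :+ u :* d) reflˢ x (D x) u r ⟩
    r · u · (one +ˢ x) +ˢ u · D x ∎

-- Lambert series

opaque
  L : (ℕ → ℤ) → Series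
  L φ n = Σ n (λ a → φ a ℤ.* X a n)

  L-def : ∀ φ n → L φ n ≡ Σ n (λ a → φ a ℤ.* X a n)
  L-def φ n = refl

-- Terms with a > n contribute nothing to coefficient n. In a product all coefficients up to n can
-- therefore share one cut-off.
L-truncate : ∀ φ {n N} → n ≤ N → L φ n ≡ Σ N (λ a → φ a ℤ.* X a n)
L-truncate φ {n} n≤N = trans (L-def φ n) (sym (Σ-extend n≤N λ a n≤a →
  trans (cong (φ (suc a) ℤ.*_) (X-vanish (suc a) n (s≤s n≤a))) (ℤₚ.*-zeroʳ (φ (suc a)))))

L-zero : ∀ φ → L φ 0 ≡ 0ℤ
L-zero φ = L-def φ 0

L-cong : ∀ {φ ψ} → (∀ a → φ (suc a) ≡ ψ (suc a)) → L φ ≈ˢ L ψ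
L-cong {φ} {ψ} e n = trans (L-def φ n) (trans (Σ-cong n (λ a _ → cong (ℤ._* X (suc a) n) (e a))) (sym (L-def ψ n)))

L-+ : ∀ φ ψ → L (λ a → φ a ℤ.+ ψ a) ≈ˢ L φ +ˢ L ψ
L-+ φ ψ n = trans (L-def _ n) (trans (Σ-cong n (λ a _ → ℤₚ.*-distribʳ-+ (X (suc a) n) (φ (suc a)) (ψ (suc a))))
  (trans (Σ-+ n _ _) (sym (cong₂ ℤ._+_ (L-def φ n) (L-def ψ n)))))

L-* : ∀ c φ → L (λ a → c ℤ.* φ a) ≈ˢ const c · L φ
L-* c φ n = trans (L-def _ n) (trans (Σ-cong n (λ a _ → ℤₚ.*-assoc c (φ (suc a)) (X (suc a) n)))
  (trans (Σ-* n c _) (trans (cong (c ℤ.*_) (sym (L-def φ n))) (sym (const-· c (L φ) n)))))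

Σ-·-Σ : ∀ M N (F G : ℕ → Series) n →
        ((λ i → Σ M (λ a → F a i)) · (λ i → Σ N (λ b → G b i))) n ≡ Σ M (λ a → Σ N (λ b → (F a · G b) n))
Σ-·-Σ M N F G n = trans (left M F (λ i → Σ N (λ b → G b i))) (Σ-cong M (λ a _ → row (F (suc a))))
  where
  left : ∀ M (F : ℕ → Series) g → ((λ i → Σ M (λ a → F a i)) · g) n ≡ Σ M (λ a → (F a · g) n)
  left zero    F g = ·-vanish n g (λ _ _ → refl)
  left (suc M) F g = trans (·-distribʳ g (λ i → Σ M (λ a → F a i)) (F (suc M)) n)
    (cong (ℤ._+ (F (suc M) · g) n) (left M F g))
  row : ∀ f → (f · (λ i → Σ N (λ b → G b i))) n ≡ Σ N (λ b → (f · G b) n)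
  row f = trans (·-comm f (λ i → Σ N (λ b → G b i)) n) (trans (left N G f) (Σ-cong N (λ b _ → ·-comm (G (suc b)) f n)))

L-·-L : ∀ φ ψ n → (L φ · L ψ) n ≡ square n (λ a b → φ a ℤ.* ψ b ℤ.* (X a · X b) n)
L-·-L φ ψ n = begin
  (L φ · L ψ) n
    ≡⟨ ·-cong-≤ n (λ i i≤n → L-truncate φ i≤n) (λ i i≤n → L-truncate ψ i≤n) ⟩
  ((λ i → Σ n (λ a → φ a ℤ.* X a i)) · (λ i → Σ n (λ b → ψ b ℤ.* X b i))) n
    ≡⟨ Σ-·-Σ n n (λ a i → φ a ℤ.* X a i) (λ b i → ψ b ℤ.* X b i) n ⟩
  square n (λ a b → ((λ i → φ a ℤ.* X a i) · (λ i → ψ b ℤ.* X b i)) n)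
    ≡⟨ square-cong n (λ a b → term (φ (suc a)) (ψ (suc b)) (X (suc a)) (X (suc b))) ⟩
  square n (λ a b → φ a ℤ.* ψ b ℤ.* (X a · X b) n) ∎
  where
  open ≡-Reasoning
  term : ∀ c d f g → ((λ i → c ℤ.* f i) · (λ i → d ℤ.* g i)) n ≡ c ℤ.* d ℤ.* (f · g) n
  term c d f g = begin
    ((λ i → c ℤ.* f i) · (λ i → d ℤ.* g i)) n   ≡⟨ scale-· c f (λ i → d ℤ.* g i) n ⟩
    c ℤ.* (f · (λ i → d ℤ.* g i)) n             ≡⟨ cong (c ℤ.*_) (trans (·-comm f (λ i → d ℤ.* g i) n) (scale-· d g f n)) ⟩
    c ℤ.* (d ℤ.* (g · f) n)                     ≡⟨ cong (λ z → c ℤ.* (d ℤ.* z)) (·-comm g f n) ⟩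
    c ℤ.* (d ℤ.* (f · g) n)                     ≡⟨ sym (ℤₚ.*-assoc c d ((f · g) n)) ⟩
    c ℤ.* d ℤ.* (f · g) n ∎

-- A bilinear form Σ c φ(a) ψ(b), given by the list of its terms (c , φ , ψ).
Form : Set
Form = List (ℤ × (ℕ → ℤ) × (ℕ → ℤ))

formAt : Form → ℕ → ℕ → ℤ
formAt []                 a b = 0ℤ
formAt ((c , φ , ψ) ∷ ts) a b = c ℤ.* (φ a ℤ.* ψ b) ℤ.+ formAt ts a b

formˢ : Form → Series
formˢ []                 = const 0ℤ
formˢ ((c , φ , ψ) ∷ ts) = const c · (L φ · L ψ) +ˢ formˢ ts

formˢ-square : ∀ ts n → square n (λ a b → formAt ts a b ℤ.* (X a · X b) n) ≡ formˢ ts n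
formˢ-square [] n = trans (Σ-zero n (λ a _ → Σ-zero n (λ b _ → refl))) (sym (const-zero n))
formˢ-square ((c , φ , ψ) ∷ ts) n = begin
  square n (λ a b → (c ℤ.* (φ a ℤ.* ψ b) ℤ.+ formAt ts a b) ℤ.* (X a · X b) n)
    ≡⟨ square-cong n (λ a b → Solver.solve 4 (λ c p f x → (c :* p :+ f) :* x := c :* (p :* x) :+ f :* x) refl
         c (φ (suc a) ℤ.* ψ (suc b)) (formAt ts (suc a) (suc b)) ((X (suc a) · X (suc b)) n)) ⟩
  square n (λ a b → c ℤ.* (φ a ℤ.* ψ b ℤ.* (X a · X b) n) ℤ.+ formAt ts a b ℤ.* (X a · X b) n)
    ≡⟨ trans (square-+ n _ _) (cong₂ ℤ._+_ (trans (square-* n c _) (cong (c ℤ.*_) (sym (L-·-L φ ψ n)))) (formˢ-square ts n)) ⟩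
  c ℤ.* (L φ · L ψ) n ℤ.+ formˢ ts n
    ≡⟨ cong (ℤ._+ formˢ ts n) (sym (const-· c (L φ · L ψ) n)) ⟩
  formˢ ((c , φ , ψ) ∷ ts) n ∎
  where open ≡-Reasoning
        open Solver

-- Summing X a · X b = X (a + b) · (1 + X a + X b) against h: the substitution c = a + b
-- turns the last two terms into sums over a < c of k against X a · X c.
module _ (h k : ℕ → ℕ → ℤ) (h-sym : ∀ a b → h a b ≡ h b a) (k-sym : ∀ a b → k a b ≡ k b a)
         (k≡h : ∀ a b → k a (a ℕ.+ b) ≡ h a b) where

  private
    t : ℕ → ℕ → Series
    t a b = X a · X b

    t-comm : ∀ a b → t a b ≈ˢ t b a
    t-comm a b = ·-comm (X a) (X b)

    Ψ : ℕ → ℤ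
    Ψ c = Σ (pred c) (λ a → k a c)

    t-expand : ∀ a b → t (suc a) (suc b) ≈ˢ X (suc a ℕ.+ suc b) +ˢ t (suc a) (suc a ℕ.+ suc b) +ˢ t (suc b) (suc a ℕ.+ suc b)
    t-expand a b = transˢ (X-product a b)
      (SeriesSolver.solve 3 (λ x y z → z :* (con 1ℤ :+ x :+ y) := z :+ x :* z :+ y :* z) reflˢ
        (X (suc a)) (X (suc b)) (X (suc a ℕ.+ suc b)))
      where open SeriesSolver

    square-h : ∀ n → square n (λ a b → h a b ℤ.* t a b n)
                   ≡ L Ψ n ℤ.+ (triangle n (λ a c → k a c ℤ.* t a c n) ℤ.+ triangle n (λ a c → k a c ℤ.* t a c n))
    square-h n = begin
      square n (λ a b → h a b ℤ.* t a b n)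
        ≡⟨ square-antidiagonals n vanish ⟩
      triangle n (λ a c → h a (c ∸ a) ℤ.* t a (c ∸ a) n)
        ≡⟨ triangle-cong n expand ⟩
      triangle n (λ a c → k a c ℤ.* X c n ℤ.+ (k a c ℤ.* t a c n ℤ.+ k (c ∸ a) c ℤ.* t (c ∸ a) c n))
        ≡⟨ trans (triangle-+ n _ _) (cong₂ ℤ._+_ main (triangle-+ n _ _)) ⟩
      L Ψ n ℤ.+ (triangle n (λ a c → k a c ℤ.* t a c n) ℤ.+ triangle n (λ a c → k (c ∸ a) c ℤ.* t (c ∸ a) c n))
        -- The reflection a ↦ c - a fixes c and carries the terms X b · X c to the terms X a · X c.
        ≡⟨ cong (λ z → L Ψ n ℤ.+ (triangle n (λ a c → k a c ℤ.* t a c n) ℤ.+ z)) (triangle-reverse n (λ a c → k a c ℤ.* t a c n)) ⟩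
      L Ψ n ℤ.+ (triangle n (λ a c → k a c ℤ.* t a c n) ℤ.+ triangle n (λ a c → k a c ℤ.* t a c n)) ∎
      where
      open ≡-Reasoning
      vanish : ∀ a b → n < suc a ℕ.+ suc b → h (suc a) (suc b) ℤ.* t (suc a) (suc b) n ≡ 0ℤ
      vanish a b n<a+b = trans (cong (h (suc a) (suc b) ℤ.*_) (trans (X-product a b n)
        (·-vanish n _ (λ i i≤n → X-vanish _ i (ℕₚ.≤-<-trans i≤n n<a+b))))) (ℤₚ.*-zeroʳ (h (suc a) (suc b)))
      expand′ : ∀ a b → let c = suc a ℕ.+ suc b in
        h (suc a) (suc b) ℤ.* t (suc a) (suc b) n ≡
        k (suc a) c ℤ.* X c n ℤ.+ (k (suc a) c ℤ.* t (suc a) c n ℤ.+ k (suc b) c ℤ.* t (suc b) c n)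
      expand′ a b = begin
        h (suc a) (suc b) ℤ.* t (suc a) (suc b) n
          ≡⟨ cong (h (suc a) (suc b) ℤ.*_) (t-expand a b n) ⟩
        h (suc a) (suc b) ℤ.* (X c n ℤ.+ t (suc a) c n ℤ.+ t (suc b) c n)
          ≡⟨ Solver.solve 4 (λ h x y z → h :* (x :+ y :+ z) := h :* x :+ (h :* y :+ h :* z)) refl
              (h (suc a) (suc b)) (X c n) (t (suc a) c n) (t (suc b) c n) ⟩
        h (suc a) (suc b) ℤ.* X c n ℤ.+ (h (suc a) (suc b) ℤ.* t (suc a) c n ℤ.+ h (suc a) (suc b) ℤ.* t (suc b) c n)
          -- One copy of h a b becomes k a c; the other, by the symmetry of h, becomes k b c.
          ≡⟨ cong₂ (λ u v → u ℤ.* X c n ℤ.+ (u ℤ.* t (suc a) c n ℤ.+ v ℤ.* t (suc b) c n))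
              (sym (k≡h (suc a) (suc b)))
              (trans (h-sym (suc a) (suc b)) (trans (sym (k≡h (suc b) (suc a))) (cong (k (suc b)) (ℕₚ.+-comm (suc b) (suc a))))) ⟩
        k (suc a) c ℤ.* X c n ℤ.+ (k (suc a) c ℤ.* t (suc a) c n ℤ.+ k (suc b) c ℤ.* t (suc b) c n) ∎
        where c = suc a ℕ.+ suc b
              open Solver
      expand : ∀ a c → a < c →
        h (suc a) (c ∸ a) ℤ.* t (suc a) (c ∸ a) n ≡
        k (suc a) (suc c) ℤ.* X (suc c) n ℤ.+
          (k (suc a) (suc c) ℤ.* t (suc a) (suc c) n ℤ.+ k (c ∸ a) (suc c) ℤ.* t (c ∸ a) (suc c) n)
      expand a c a<c = subst₂
        (λ b c → h (suc a) b ℤ.* t (suc a) b n ≡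
          k (suc a) c ℤ.* X c n ℤ.+ (k (suc a) c ℤ.* t (suc a) c n ℤ.+ k b c ℤ.* t b c n))
        suc-b≡ (cong suc (trans (cong (a ℕ.+_) suc-b≡) (ℕₚ.m+[n∸m]≡n (ℕₚ.<⇒≤ a<c))))
        (expand′ a (c ∸ suc a))
        where
        suc-b≡ : suc (c ∸ suc a) ≡ c ∸ a
        suc-b≡ = sym (ℕₚ.+-∸-assoc 1 a<c)
      main : triangle n (λ a c → k a c ℤ.* X c n) ≡ L Ψ n
      main = trans (Σ-cong n (λ c _ → trans
          (Σ-cong c (λ a _ → ℤₚ.*-comm (k (suc a) (suc c)) (X (suc c) n)))
          (trans (Σ-* c (X (suc c) n) _) (ℤₚ.*-comm (X (suc c) n) _))))
        (sym (L-def Ψ n))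

    square-k : ∀ n → square n (λ a b → k a b ℤ.* t a b n)
                   ≡ triangle n (λ a c → k a c ℤ.* t a c n) ℤ.+ triangle n (λ a c → k a c ℤ.* t a c n)
                       ℤ.+ Σ n (λ a → k a a ℤ.* t a a n)
    square-k n = trans (square-split n _)
      (cong (λ z → triangle n (λ a c → k a c ℤ.* t a c n) ℤ.+ z ℤ.+ Σ n (λ a → k a a ℤ.* t a a n))
        (triangle-cong n (λ a c _ → cong₂ ℤ._*_ (k-sym (suc c) (suc a)) (t-comm (suc c) (suc a) n))))

  -- Both squares contain the triangle sum of k a c against X a · X c twice: the square of h through
  -- the substitution c = a + b, that of k through its two halves. Subtraction leaves a single
  -- Lambert series and the diagonal of k.
  square-difference : ∀ n → square n (λ a b → (h a b ℤ.- k a b) ℤ.* (X a · X b) n)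
                          ≡ L (λ c → Σ (pred c) (λ a → k a c)) n ℤ.- Σ n (λ a → k a a ℤ.* (X a · X a) n)
  square-difference n = begin
    square n (λ a b → (h a b ℤ.- k a b) ℤ.* t a b n)
      ≡⟨ square-cong n (λ a b → Solver.solve 3 (λ h k x → (h :- k) :* x := h :* x :+ con (ℤ.- 1ℤ) :* (k :* x)) refl
            (h (suc a) (suc b)) (k (suc a) (suc b)) (t (suc a) (suc b) n)) ⟩
    square n (λ a b → h a b ℤ.* t a b n ℤ.+ (ℤ.- 1ℤ) ℤ.* (k a b ℤ.* t a b n))
      ≡⟨ trans (square-+ n _ _) (cong₂ ℤ._+_ (square-h n) (trans (square-* n (ℤ.- 1ℤ) _) (cong ((ℤ.- 1ℤ) ℤ.*_) (square-k n)))) ⟩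
    L Ψ n ℤ.+ (T ℤ.+ T) ℤ.+ (ℤ.- 1ℤ) ℤ.* (T ℤ.+ T ℤ.+ Σ n (λ a → k a a ℤ.* t a a n))
      ≡⟨ Solver.solve 3 (λ l t d → l :+ (t :+ t) :+ con (ℤ.- 1ℤ) :* (t :+ t :+ d) := l :- d) refl
            (L Ψ n) T (Σ n (λ a → k a a ℤ.* t a a n)) ⟩
    L Ψ n ℤ.- Σ n (λ a → k a a ℤ.* t a a n) ∎
    where
    open ≡-Reasoning
    open Solver
    T = triangle n (λ a c → k a c ℤ.* t a c n)

-- D (X a) = a (X a + X a · X a) trades the squares for a derivative; the factor a is the reason for
-- asking a weight of the form a · m a.
diagonal : ∀ (m : ℕ → ℤ) n → Σ n (λ a → + a ℤ.* m a ℤ.* (X a · X a) n) ≡ (D (L m)) n ℤ.- L (λ a → + a ℤ.* m a) n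
diagonal m n = begin
  Σ n (λ a → + a ℤ.* m a ℤ.* (X a · X a) n)
    ≡⟨ Σ-cong n (λ a _ → term a) ⟩
  Σ n (λ a → + n ℤ.* (m a ℤ.* X a n) ℤ.- + a ℤ.* m a ℤ.* X a n)
    ≡⟨ trans (Σ-- n _ _) (cong (ℤ._- Σ n (λ a → + a ℤ.* m a ℤ.* X a n)) (Σ-* n (+ n) _)) ⟩
  + n ℤ.* Σ n (λ a → m a ℤ.* X a n) ℤ.- Σ n (λ a → + a ℤ.* m a ℤ.* X a n)
    ≡⟨ sym (cong₂ (λ u v → + n ℤ.* u ℤ.- v) (L-def m n) (L-def (λ a → + a ℤ.* m a) n)) ⟩
  (D (L m)) n ℤ.- L (λ a → + a ℤ.* m a) n ∎
  where
  open ≡-Reasoning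
  open Solver
  DX : ∀ a → + n ℤ.* X (suc a) n ≡ + suc a ℤ.* (X (suc a) n ℤ.+ (X (suc a) · X (suc a)) n)
  DX a = trans (D-X a n) (trans (S.solve 2 (λ r x → r S.:* x S.:* (S.con 1ℤ S.:+ x) S.:= r S.:* (x S.:+ x S.:* x)) reflˢ
                                  (const (+ suc a)) (X (suc a)) n)
                                (const-· (+ suc a) (X (suc a) +ˢ X (suc a) · X (suc a)) n))
    where module S = SeriesSolver
  term : ∀ a → + suc a ℤ.* m (suc a) ℤ.* (X (suc a) · X (suc a)) n ≡
               + n ℤ.* (m (suc a) ℤ.* X (suc a) n) ℤ.- + suc a ℤ.* m (suc a) ℤ.* X (suc a) n
  term a = begin
    + suc a ℤ.* m (suc a) ℤ.* y
      ≡⟨ Solver.solve 4 (λ r m x y → r :* m :* y := m :* (r :* (x :+ y)) :- r :* m :* x) refl (+ suc a) (m (suc a)) x y ⟩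
    m (suc a) ℤ.* (+ suc a ℤ.* (x ℤ.+ y)) ℤ.- + suc a ℤ.* m (suc a) ℤ.* x
      ≡⟨ cong (λ z → m (suc a) ℤ.* z ℤ.- + suc a ℤ.* m (suc a) ℤ.* x) (sym (DX a)) ⟩
    m (suc a) ℤ.* (+ n ℤ.* x) ℤ.- + suc a ℤ.* m (suc a) ℤ.* x
      ≡⟨ Solver.solve 4 (λ r m x n → m :* (n :* x) :- r :* m :* x := n :* (m :* x) :- r :* m :* x) refl (+ suc a) (m (suc a)) x (+ n) ⟩
    + n ℤ.* (m (suc a) ℤ.* x) ℤ.- + suc a ℤ.* m (suc a) ℤ.* x ∎
    where x = X (suc a) n
          y = (X (suc a) · X (suc a)) n

Combination : Set
Combination = List (ℤ × (ℕ → ℤ))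

combinationAt : Combination → ℕ → ℤ
combinationAt []             a = 0ℤ
combinationAt ((c , φ) ∷ ts) a = c ℤ.* φ a ℤ.+ combinationAt ts a

combinationˢ : Combination → Series
combinationˢ []             = const 0ℤ
combinationˢ ((c , φ) ∷ ts) = const c · L φ +ˢ combinationˢ ts

L-combination : ∀ ts → L (combinationAt ts) ≈ˢ combinationˢ ts
L-combination []             = λ n → trans (L-def _ n) (trans (Σ-zero n (λ a _ → refl)) (sym (const-zero n)))
L-combination ((c , φ) ∷ ts) = transˢ (L-+ (λ a → c ℤ.* φ a) (combinationAt ts)) (+ˢ-cong (L-* c φ) (L-combination ts))

-- Here h and k are one weight on triples a + b = c, read at (a, b) and at (a, c). The term c · m c
-- joins the sum of k in the last hypothesis because `diagonal` produces a second Lambert series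
-- besides D (L m).
convolution-identity :
  ∀ (h k : ℕ → ℕ → ℤ) (ts : Form) (m : ℕ → ℤ) (ls : Combination) →
  (∀ a b → h a b ≡ h b a) → (∀ a b → k a b ≡ k b a) → (∀ a b → k a (a ℕ.+ b) ≡ h a b) →
  (∀ a b → h a b ℤ.- k a b ≡ formAt ts a b) →
  (∀ a → k a a ≡ + a ℤ.* m a) →
  (∀ c → Σ c (λ a → k a (suc c)) ℤ.+ + suc c ℤ.* m (suc c) ≡ combinationAt ls (suc c)) →
  formˢ ts ≈ˢ combinationˢ ls +ˢ -ˢ (D (L m))
convolution-identity h k ts m ls h-sym k-sym k≡h form diag total n = begin
  formˢ ts n
    ≡⟨ sym (formˢ-square ts n) ⟩
  square n (λ a b → formAt ts a b ℤ.* (X a · X b) n)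
    ≡⟨ square-cong n (λ a b → cong (ℤ._* (X (suc a) · X (suc b)) n) (sym (form (suc a) (suc b)))) ⟩
  square n (λ a b → (h a b ℤ.- k a b) ℤ.* (X a · X b) n)
    ≡⟨ square-difference h k h-sym k-sym k≡h n ⟩
  L Ψ n ℤ.- Σ n (λ a → k a a ℤ.* (X a · X a) n)
    ≡⟨ cong (λ z → L Ψ n ℤ.- z) (trans (Σ-cong n (λ a _ → cong (ℤ._* (X (suc a) · X (suc a)) n) (diag (suc a)))) (diagonal m n)) ⟩
  L Ψ n ℤ.- ((D (L m)) n ℤ.- L (λ a → + a ℤ.* m a) n)
    ≡⟨ Solver.solve 3 (λ l d r → l :- (d :- r) := l :+ r :- d) refl (L Ψ n) ((D (L m)) n) (L (λ a → + a ℤ.* m a) n) ⟩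
  L Ψ n ℤ.+ L (λ a → + a ℤ.* m a) n ℤ.- (D (L m)) n
    ≡⟨ cong (ℤ._- (D (L m)) n) (trans (sym (L-+ Ψ (λ a → + a ℤ.* m a) n)) (trans (L-cong total n) (L-combination ls n))) ⟩
  combinationˢ ls n ℤ.- (D (L m)) n ∎
  where
  open ≡-Reasoning
  open Solver
  Ψ : ℕ → ℤ
  Ψ c = Σ (pred c) (λ a → k a c)

-- Weights carrying the signs (-1)^a.

sgn : ℕ → ℤ
sgn a = -1ℤ ℤ.^ a

sgn-suc : ∀ a → sgn (suc a) ≡ ℤ.- sgn a
sgn-suc a = ℤₚ.-1*i≡-i (sgn a)

sgn-+ : ∀ a b → sgn (a ℕ.+ b) ≡ sgn a ℤ.* sgn b
sgn-+ a b = ℤₚ.^-distribˡ-+-* -1ℤ a b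

sgn² : ∀ a → sgn a ℤ.* sgn a ≡ 1ℤ
sgn² zero    = refl
sgn² (suc a) = trans (cong₂ ℤ._*_ (sgn-suc a) (sgn-suc a))
  (trans (Solver.solve 1 (λ x → (:- x) :* (:- x) := x :* x) refl (sgn a)) (sgn² a))
  where open Solver

sgn-sgn-+ : ∀ a b → sgn a ℤ.* sgn (a ℕ.+ b) ≡ sgn b
sgn-sgn-+ a b = begin
  sgn a ℤ.* sgn (a ℕ.+ b)         ≡⟨ cong (sgn a ℤ.*_) (sgn-+ a b) ⟩
  sgn a ℤ.* (sgn a ℤ.* sgn b)     ≡⟨ sym (ℤₚ.*-assoc (sgn a) (sgn a) (sgn b)) ⟩
  sgn a ℤ.* sgn a ℤ.* sgn b       ≡⟨ cong (ℤ._* sgn b) (sgn² a) ⟩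
  1ℤ ℤ.* sgn b                    ≡⟨ ℤₚ.*-identityˡ (sgn b) ⟩
  sgn b ∎
  where open ≡-Reasoning

+-−-+ : ∀ a b → + (a ℕ.+ b) ℤ.- + a ≡ + b
+-−-+ a b = Solver.solve 2 (λ a b → a :+ b :- a := b) refl (+ a) (+ b)
  where open Solver

Σ-const : ∀ n c → Σ n (λ _ → c) ≡ + n ℤ.* c
Σ-const zero    c = refl
Σ-const (suc n) c = trans (cong (ℤ._+ c) (Σ-const n c))
  (Solver.solve 2 (λ n c → n :* c :+ c := (con 1ℤ :+ n) :* c) refl (+ n) c)
  where open Solver

-- The multiplication is a parameter so that the same powers serve for the abstract product of
-- `Polynomials`.
power : (ℤ → ℤ → ℤ) → ℤ → ℕ → ℤ
power _*_ x zero    = 1ℤ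
power _*_ x (suc k) = x * power _*_ x k

power≡^ : ∀ x k → power ℤ._*_ x k ≡ x ℤ.^ k
power≡^ x zero    = refl
power≡^ x (suc k) = cong (x ℤ.*_) (power≡^ x k)

alternating : ℕ → ℕ → ℤ
alternating k a = sgn a ℤ.* power ℤ._*_ (+ a) k

A : ℕ → Series
A k = L (alternating k)

-- The weight of a triple a + b = c is the sum of (-1)^x f(x) over its three members x. As f is
-- even, h - k retains only the two values of f at a + b and b - a. The function g makes (-1)^x g(x)
-- an antidifference of 2 (-1)^x f(x), and g 1 = 0 removes the boundary term.
module _ (f g : ℤ → ℤ) (f-even : ∀ x y → f (x ℤ.- y) ≡ f (y ℤ.- x)) (g-step : ∀ x → g (1ℤ ℤ.+ x) ℤ.+ g x ≡ ℤ.- (+ 2 ℤ.* f x))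
         (g1 : g 1ℤ ≡ 0ℤ) (f0 : f 0ℤ ≡ 0ℤ) (p : ℕ → ℤ) (p-def : ∀ a → f (+ a) ≡ + a ℤ.* p a)
         (ts : Form) (ls : Combination)
         (form : ∀ a b → sgn a ℤ.* sgn b ℤ.* (f (+ a ℤ.+ + b) ℤ.- f (+ b ℤ.- + a)) ≡ formAt ts a b)
         (total : ∀ c → sgn c ℤ.* (g (+ c) ℤ.+ (1ℤ ℤ.+ + c) ℤ.* f (+ c)) ≡ combinationAt ls c)
         where

  alternating-identity : formˢ ts ≈ˢ combinationˢ ls +ˢ -ˢ (D (L (λ a → + 2 ℤ.* (sgn a ℤ.* p a))))
  alternating-identity = convolution-identity h k ts (λ a → + 2 ℤ.* (sgn a ℤ.* p a)) ls h-sym k-sym k≡h form′ diag total′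
    where
    open ≡-Reasoning
    open Solver
    h k : ℕ → ℕ → ℤ
    h a b = sgn a ℤ.* f (+ a) ℤ.+ sgn b ℤ.* f (+ b) ℤ.+ sgn a ℤ.* sgn b ℤ.* f (+ a ℤ.+ + b)
    k a c = sgn a ℤ.* f (+ a) ℤ.+ sgn c ℤ.* f (+ c) ℤ.+ sgn a ℤ.* sgn c ℤ.* f (+ c ℤ.- + a)

    h-sym : ∀ a b → h a b ≡ h b a
    h-sym a b rewrite ℕₚ.+-comm a b =
      Solver.solve 5 (λ s t x y z → s :* x :+ t :* y :+ s :* t :* z := t :* y :+ s :* x :+ t :* s :* z) refl
        (sgn a) (sgn b) (f (+ a)) (f (+ b)) (f (+ (b ℕ.+ a)))

    k-sym : ∀ a b → k a b ≡ k b a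
    k-sym a b rewrite f-even (+ b) (+ a) =
      Solver.solve 5 (λ s t x y z → s :* x :+ t :* y :+ s :* t :* z := t :* y :+ s :* x :+ t :* s :* z) refl
        (sgn a) (sgn b) (f (+ a)) (f (+ b)) (f (+ a ℤ.- + b))

    k≡h : ∀ a b → k a (a ℕ.+ b) ≡ h a b
    k≡h a b = trans
      (cong₂ (λ u v → sgn a ℤ.* f (+ a) ℤ.+ u ℤ.* f (+ (a ℕ.+ b)) ℤ.+ v) (sgn-+ a b)
             (cong₂ (λ u v → u ℤ.* f v) (sgn-sgn-+ a b) (+-−-+ a b)))
      (Solver.solve 3 (λ x y z → x :+ z :+ y := x :+ y :+ z) refl
        (sgn a ℤ.* f (+ a)) (sgn b ℤ.* f (+ b)) (sgn a ℤ.* sgn b ℤ.* f (+ (a ℕ.+ b))))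

    form′ : ∀ a b → h a b ℤ.- k a b ≡ formAt ts a b
    form′ a b = trans
      (Solver.solve 5 (λ s x y u v → x :+ y :+ s :* u :- (x :+ y :+ s :* v) := s :* (u :- v)) refl
        (sgn a ℤ.* sgn b) (sgn a ℤ.* f (+ a)) (sgn b ℤ.* f (+ b)) (f (+ a ℤ.+ + b)) (f (+ b ℤ.- + a)))
      (form a b)

    diag : ∀ a → k a a ≡ + a ℤ.* (+ 2 ℤ.* (sgn a ℤ.* p a))
    diag a = trans
      (cong₂ (λ u v → sgn a ℤ.* u ℤ.+ sgn a ℤ.* u ℤ.+ sgn a ℤ.* sgn a ℤ.* v) (p-def a)
        (trans (cong f (ℤₚ.+-inverseʳ (+ a))) f0))
      (Solver.solve 3 (λ s x p → s :* (x :* p) :+ s :* (x :* p) :+ s :* s :* con 0ℤ := x :* (con (+ 2) :* (s :* p))) refl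
        (sgn a) (+ a) (p a))

    half : ∀ c → Σ c (λ a → sgn a ℤ.* sgn (suc c) ℤ.* f (+ suc c ℤ.- + a)) ≡ Σ c (λ a → sgn a ℤ.* f (+ a))
    half c = trans (Σ-cong c (λ i i<c → term (suc i) (c ∸ i)
        (cong suc (sym (ℕₚ.m+[n∸m]≡n (ℕₚ.<⇒≤ i<c))))))
      (Σ-reverse c (λ a → sgn a ℤ.* f (+ a)))
      where
      term : ∀ a b {c} → c ≡ a ℕ.+ b → sgn a ℤ.* sgn c ℤ.* f (+ c ℤ.- + a) ≡ sgn b ℤ.* f (+ b)
      term a b refl = cong₂ (λ u v → u ℤ.* f v) (sgn-sgn-+ a b) (+-−-+ a b)

    twice : ∀ c → Σ c (λ a → + 2 ℤ.* (sgn a ℤ.* f (+ a))) ≡ sgn (suc c) ℤ.* g (+ suc c)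
    twice c = trans (Σ-telescope c _ (λ a → sgn a ℤ.* g (+ a)) (λ i _ → step (suc i)))
      (trans (cong (λ z → sgn (suc c) ℤ.* g (+ suc c) ℤ.- sgn 1 ℤ.* z) g1)
             (Solver.solve 1 (λ x → x :- con (sgn 1) :* con 0ℤ := x) refl (sgn (suc c) ℤ.* g (+ suc c))))
      where
      step : ∀ a → + 2 ℤ.* (sgn a ℤ.* f (+ a)) ≡ sgn (suc a) ℤ.* g (+ suc a) ℤ.- sgn a ℤ.* g (+ a)
      step a = begin
        + 2 ℤ.* (sgn a ℤ.* f (+ a))
          ≡⟨ Solver.solve 2 (λ s f → con (+ 2) :* (s :* f) := :- (s :* (:- (con (+ 2) :* f)))) refl (sgn a) (f (+ a)) ⟩
        ℤ.- (sgn a ℤ.* (ℤ.- (+ 2 ℤ.* f (+ a))))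
          ≡⟨ cong (λ z → ℤ.- (sgn a ℤ.* z)) (sym (g-step (+ a))) ⟩
        ℤ.- (sgn a ℤ.* (g (+ suc a) ℤ.+ g (+ a)))
          ≡⟨ Solver.solve 3 (λ s x y → :- (s :* (x :+ y)) := (:- s) :* x :- s :* y) refl (sgn a) (g (+ suc a)) (g (+ a)) ⟩
        (ℤ.- sgn a) ℤ.* g (+ suc a) ℤ.- sgn a ℤ.* g (+ a)
          ≡⟨ cong (λ z → z ℤ.* g (+ suc a) ℤ.- sgn a ℤ.* g (+ a)) (sym (sgn-suc a)) ⟩
        sgn (suc a) ℤ.* g (+ suc a) ℤ.- sgn a ℤ.* g (+ a) ∎

    total′ : ∀ c → Σ c (λ a → k a (suc c)) ℤ.+ + suc c ℤ.* (+ 2 ℤ.* (sgn (suc c) ℤ.* p (suc c))) ≡ combinationAt ls (suc c)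
    total′ c = begin
      Σ c (λ a → k a (suc c)) ℤ.+ + suc c ℤ.* (+ 2 ℤ.* (s ℤ.* p (suc c)))
        ≡⟨ cong (ℤ._+ + suc c ℤ.* (+ 2 ℤ.* (s ℤ.* p (suc c))))
            (trans (Σ-+ c _ _) (cong₂ ℤ._+_ (Σ-+ c _ _) (half c))) ⟩
      (S ℤ.+ Σ c (λ _ → s ℤ.* F)) ℤ.+ S ℤ.+ + suc c ℤ.* (+ 2 ℤ.* (s ℤ.* p (suc c)))
        ≡⟨ cong₂ (λ u v → (S ℤ.+ u) ℤ.+ S ℤ.+ v) (Σ-const c (s ℤ.* F))
            (Solver.solve 3 (λ x s p → x :* (con (+ 2) :* (s :* p)) := con (+ 2) :* s :* (x :* p)) refl (+ suc c) s (p (suc c))) ⟩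
      (S ℤ.+ + c ℤ.* (s ℤ.* F)) ℤ.+ S ℤ.+ + 2 ℤ.* s ℤ.* (+ suc c ℤ.* p (suc c))
        ≡⟨ cong (λ z → (S ℤ.+ + c ℤ.* (s ℤ.* F)) ℤ.+ S ℤ.+ + 2 ℤ.* s ℤ.* z) (sym (p-def (suc c))) ⟩
      (S ℤ.+ + c ℤ.* (s ℤ.* F)) ℤ.+ S ℤ.+ + 2 ℤ.* s ℤ.* F
        -- The constant summand s F occurs c times in the sum and the diagonal adds two more, which
        -- gives 1 + suc c.
        ≡⟨ Solver.solve 4 (λ S c s F → S :+ c :* (s :* F) :+ S :+ con (+ 2) :* s :* F :=
                               con (+ 2) :* S :+ s :* ((con 1ℤ :+ (con 1ℤ :+ c)) :* F)) refl S (+ c) s F ⟩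
      + 2 ℤ.* S ℤ.+ s ℤ.* ((1ℤ ℤ.+ + suc c) ℤ.* F)
        ≡⟨ cong (ℤ._+ s ℤ.* ((1ℤ ℤ.+ + suc c) ℤ.* F)) (trans (sym (Σ-* c (+ 2) _)) (twice c)) ⟩
      s ℤ.* g (+ suc c) ℤ.+ s ℤ.* ((1ℤ ℤ.+ + suc c) ℤ.* F)
        ≡⟨ sym (ℤₚ.*-distribˡ-+ s _ _) ⟩
      s ℤ.* (g (+ suc c) ℤ.+ (1ℤ ℤ.+ + suc c) ℤ.* F)
        ≡⟨ total (suc c) ⟩
      combinationAt ls (suc c) ∎
      where
      s = sgn (suc c)
      F = f (+ suc c)
      S = Σ c (λ a → sgn a ℤ.* f (+ a))

-- For weights whose products also involve unsigned factors. Signs are separate arguments, so that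
-- every hypothesis is a polynomial identity: swap and flip exchange a with b and a with c, M is the
-- diagonal divided by a, and T sums F by telescoping.
module _ (F : ℤ → ℤ → ℤ → ℤ → ℤ → ℤ → ℤ) (T : ℤ → ℤ → ℤ → ℤ → ℤ → ℤ) (M : ℤ → ℤ → ℤ)
         (F-swap : ∀ s a t b v c → F s a t b v c ≡ F t b s a v c)
         (F-flip : ∀ s a t c → F s a (s ℤ.* t) (c ℤ.- a) t c ≡ F t c (t ℤ.* s) (a ℤ.- c) s a)
         (F-diag : ∀ s x → F s x 1ℤ 0ℤ s x ≡ x ℤ.* M s x)
         (T-step : ∀ s x t c → F s x (s ℤ.* t) (c ℤ.- x) t c ≡ T (ℤ.- s) (1ℤ ℤ.+ x) ((ℤ.- s) ℤ.* t) t c ℤ.- T s x (s ℤ.* t) t c)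
         (ts : Form) (ls : Combination)
         (form : ∀ a b → F (sgn a) (+ a) (sgn b) (+ b) (sgn a ℤ.* sgn b) (+ a ℤ.+ + b)
                     ℤ.- F (sgn a) (+ a) (sgn a ℤ.* sgn b) (+ b ℤ.- + a) (sgn b) (+ b) ≡ formAt ts a b)
         (total : ∀ c → T (sgn c) (+ c) 1ℤ (sgn c) (+ c) ℤ.- T -1ℤ 1ℤ (-1ℤ ℤ.* sgn c) (sgn c) (+ c)
                      ℤ.+ + c ℤ.* M (sgn c) (+ c) ≡ combinationAt ls c)
         where

  symmetric-identity : formˢ ts ≈ˢ combinationˢ ls +ˢ -ˢ (D (L (λ a → M (sgn a) (+ a))))
  symmetric-identity = convolution-identity h k ts (λ a → M (sgn a) (+ a)) ls
    (λ a b → trans (F-swap _ _ _ _ _ _) (cong₂ (F (sgn b) (+ b) (sgn a) (+ a)) (ℤₚ.*-comm (sgn a) (sgn b)) (ℤₚ.+-comm (+ a) (+ b))))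
    (λ a b → F-flip _ _ _ _)
    (λ a b → trans (cong₂ (λ t x → F (sgn a) (+ a) t x (sgn (a ℕ.+ b)) (+ (a ℕ.+ b))) (sgn-sgn-+ a b) (+-−-+ a b))
                   (cong (λ v → F (sgn a) (+ a) (sgn b) (+ b) v (+ (a ℕ.+ b))) (sgn-+ a b)))
    form
    (λ a → trans (cong₂ (λ t x → F (sgn a) (+ a) t x (sgn a) (+ a)) (sgn² a) (ℤₚ.+-inverseʳ (+ a))) (F-diag _ _))
    (λ c → trans (cong (ℤ._+ + suc c ℤ.* M (sgn (suc c)) (+ suc c)) (trans
        (Σ-telescope c _ (λ a → T (sgn a) (+ a) (sgn a ℤ.* sgn (suc c)) (sgn (suc c)) (+ suc c)) (λ i _ → step (suc i) c))
        (cong (λ w → T (sgn (suc c)) (+ suc c) w (sgn (suc c)) (+ suc c)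
                       ℤ.- T -1ℤ 1ℤ (-1ℤ ℤ.* sgn (suc c)) (sgn (suc c)) (+ suc c)) (sgn² (suc c)))))
      (total (suc c)))
    where
    h k : ℕ → ℕ → ℤ
    h a b = F (sgn a) (+ a) (sgn b) (+ b) (sgn a ℤ.* sgn b) (+ a ℤ.+ + b)
    k a c = F (sgn a) (+ a) (sgn a ℤ.* sgn c) (+ c ℤ.- + a) (sgn c) (+ c)
    step : ∀ a c → k a (suc c) ≡ T (sgn (suc a)) (+ suc a) (sgn (suc a) ℤ.* sgn (suc c)) (sgn (suc c)) (+ suc c)
                             ℤ.- T (sgn a) (+ a) (sgn a ℤ.* sgn (suc c)) (sgn (suc c)) (+ suc c)
    step a c rewrite sgn-suc a = T-step (sgn a) (+ a) (sgn (suc c)) (+ suc c)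

-- Polynomial identities

-- The multiplication is abstract because ℤ._*_ unfolds at every comparison, which makes
-- checking identities of high degree exponentially slow.
module Polynomials (_*_ : ℤ → ℤ → ℤ) (isCommutativeRing : IsCommutativeRing _≡_ ℤ._+_ _*_ ℤ.-_ 0ℤ 1ℤ)
                   (*-agrees : ∀ x y → x ℤ.* y ≡ x * y) where

  private
    ring : CommutativeRing 0ℓ 0ℓ
    ring = record { isCommutativeRing = isCommutativeRing }

    embedding : ℤ.+-*-rawRing -Raw-AlmostCommutative⟶ fromCommutativeRing ring
    embedding = record
      { ⟦_⟧    = λ x → x
      ; +-homo = λ x y → refl
      ; *-homo = *-agrees
      ; -‿homo = λ x → refl
      ; 0-homo = refl
      ; 1-homo = refl
      }

    open RingSolver ℤ.+-*-rawRing (fromCommutativeRing ring) embedding (λ x y → dec⇒maybe (x ℤₚ.≟ y))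

    powᵉ : ∀ {n} → ℕ → Polynomial n → Polynomial n
    powᵉ zero    x = con 1ℤ
    powᵉ (suc k) x = x :* powᵉ k x

    bilinearᵉ : ∀ {n} → List (ℤ × ℕ × ℕ) → (s t a b : Polynomial n) → Polynomial n
    bilinearᵉ []                 s t a b = con 0ℤ
    bilinearᵉ ((c , i , j) ∷ ts) s t a b = con c :* ((s :* powᵉ i a) :* (t :* powᵉ j b)) :+ bilinearᵉ ts s t a b

    linearᵉ : ∀ {n} → List (ℤ × ℕ) → (s x : Polynomial n) → Polynomial n
    linearᵉ []             s x = con 0ℤ
    linearᵉ ((c , i) ∷ cs) s x = con c :* (s :* powᵉ i x) :+ linearᵉ cs s x

    eulerianᵉ : ∀ {n} → ℕ → List (ℤ × ℕ) → Polynomial n → Polynomial n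
    eulerianᵉ k cs x = linearᵉ cs (con 1ℤ) x :- (con 1ℤ :+ x) :* powᵉ k x

  pow : ℕ → ℤ → ℤ
  pow k x = power _*_ x k

  bilinear : List (ℤ × ℕ × ℕ) → (s t a b : ℤ) → ℤ
  bilinear []                 s t a b = 0ℤ
  bilinear ((c , i , j) ∷ ts) s t a b = (c * ((s * power _*_ a i) * (t * power _*_ b j))) ℤ.+ bilinear ts s t a b

  linear : List (ℤ × ℕ) → (s x : ℤ) → ℤ
  linear []             s x = 0ℤ
  linear ((c , i) ∷ cs) s x = (c * (s * power _*_ x i)) ℤ.+ linear cs s x

  -- For the right coefficients this is an Euler polynomial up to scaling, and (-1)^x times it is
  -- twice the alternating sum of the k-th powers below x.
  eulerian : ℕ → List (ℤ × ℕ) → ℤ → ℤ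
  eulerian k cs x = linear cs 1ℤ x ℤ.- ((1ℤ ℤ.+ x) * pow k x)

  -- The coefficients are 2 binom(4, i) for odd i, from (a + b)^4 - (b - a)^4. The lists for 6, 8
  -- and 10 arise in the same way.
  terms-4 : List (ℤ × ℕ × ℕ)
  terms-4 = (+ 8 , 1 , 3) ∷ (+ 8 , 3 , 1) ∷ []

  -- Chosen so that `eulerian 4` is minus the Euler polynomial x^4 - 2 x^3 + x; the leading x^5
  -- cancels against (1 + x) x^4. The later lists do the same for the Euler polynomials of degrees
  -- 6, 8 and 10.
  coefficients-4 : List (ℤ × ℕ)
  coefficients-4 = (-[1+ 0 ] , 1) ∷ (+ 2 , 3) ∷ (+ 1 , 5) ∷ []

  even-4 : ∀ x y → pow 4 (x ℤ.- y) ≡ pow 4 (y ℤ.- x)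
  even-4 = solve 2 (λ x y → powᵉ 4 (x :- y) := powᵉ 4 (y :- x)) refl

  step-4 : ∀ x → eulerian 4 coefficients-4 (1ℤ ℤ.+ x) ℤ.+ eulerian 4 coefficients-4 x ≡ ℤ.- ((+ 2) * pow 4 x)
  step-4 = solve 1 (λ x → eulerianᵉ 4 coefficients-4 (con 1ℤ :+ x) :+ eulerianᵉ 4 coefficients-4 x
                        := :- (con (+ 2) :* powᵉ 4 x)) refl

  expand-4 : ∀ s t a b → (s * t) * (pow 4 (a ℤ.+ b) ℤ.- pow 4 (b ℤ.- a)) ≡ bilinear terms-4 s t a b
  expand-4 = solve 4 (λ s t a b → (s :* t) :* (powᵉ 4 (a :+ b) :- powᵉ 4 (b :- a)) := bilinearᵉ terms-4 s t a b) refl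

  total-4 : ∀ s x → s * (eulerian 4 coefficients-4 x ℤ.+ ((1ℤ ℤ.+ x) * pow 4 x)) ≡ linear coefficients-4 s x
  total-4 = solve 2 (λ s x → s :* (eulerianᵉ 4 coefficients-4 x :+ (con 1ℤ :+ x) :* powᵉ 4 x)
                          := linearᵉ coefficients-4 s x) refl

  terms-6 : List (ℤ × ℕ × ℕ)
  terms-6 = (+ 12 , 1 , 5) ∷ (+ 40 , 3 , 3) ∷ (+ 12 , 5 , 1) ∷ []

  coefficients-6 : List (ℤ × ℕ)
  coefficients-6 = (+ 3 , 1) ∷ (-[1+ 4 ] , 3) ∷ (+ 3 , 5) ∷ (+ 1 , 7) ∷ []

  even-6 : ∀ x y → pow 6 (x ℤ.- y) ≡ pow 6 (y ℤ.- x)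
  even-6 = solve 2 (λ x y → powᵉ 6 (x :- y) := powᵉ 6 (y :- x)) refl

  step-6 : ∀ x → eulerian 6 coefficients-6 (1ℤ ℤ.+ x) ℤ.+ eulerian 6 coefficients-6 x ≡ ℤ.- ((+ 2) * pow 6 x)
  step-6 = solve 1 (λ x → eulerianᵉ 6 coefficients-6 (con 1ℤ :+ x) :+ eulerianᵉ 6 coefficients-6 x
                        := :- (con (+ 2) :* powᵉ 6 x)) refl

  expand-6 : ∀ s t a b → (s * t) * (pow 6 (a ℤ.+ b) ℤ.- pow 6 (b ℤ.- a)) ≡ bilinear terms-6 s t a b
  expand-6 = solve 4 (λ s t a b → (s :* t) :* (powᵉ 6 (a :+ b) :- powᵉ 6 (b :- a)) := bilinearᵉ terms-6 s t a b) refl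

  total-6 : ∀ s x → s * (eulerian 6 coefficients-6 x ℤ.+ ((1ℤ ℤ.+ x) * pow 6 x)) ≡ linear coefficients-6 s x
  total-6 = solve 2 (λ s x → s :* (eulerianᵉ 6 coefficients-6 x :+ (con 1ℤ :+ x) :* powᵉ 6 x)
                          := linearᵉ coefficients-6 s x) refl

  terms-8 : List (ℤ × ℕ × ℕ)
  terms-8 = (+ 16 , 1 , 7) ∷ (+ 112 , 3 , 5) ∷ (+ 112 , 5 , 3) ∷ (+ 16 , 7 , 1) ∷ []

  coefficients-8 : List (ℤ × ℕ)
  coefficients-8 = (-[1+ 16 ] , 1) ∷ (+ 28 , 3) ∷ (-[1+ 13 ] , 5) ∷ (+ 4 , 7) ∷ (+ 1 , 9) ∷ []

  even-8 : ∀ x y → pow 8 (x ℤ.- y) ≡ pow 8 (y ℤ.- x)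
  even-8 = solve 2 (λ x y → powᵉ 8 (x :- y) := powᵉ 8 (y :- x)) refl

  step-8 : ∀ x → eulerian 8 coefficients-8 (1ℤ ℤ.+ x) ℤ.+ eulerian 8 coefficients-8 x ≡ ℤ.- ((+ 2) * pow 8 x)
  step-8 = solve 1 (λ x → eulerianᵉ 8 coefficients-8 (con 1ℤ :+ x) :+ eulerianᵉ 8 coefficients-8 x
                        := :- (con (+ 2) :* powᵉ 8 x)) refl

  expand-8 : ∀ s t a b → (s * t) * (pow 8 (a ℤ.+ b) ℤ.- pow 8 (b ℤ.- a)) ≡ bilinear terms-8 s t a b
  expand-8 = solve 4 (λ s t a b → (s :* t) :* (powᵉ 8 (a :+ b) :- powᵉ 8 (b :- a)) := bilinearᵉ terms-8 s t a b) refl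

  total-8 : ∀ s x → s * (eulerian 8 coefficients-8 x ℤ.+ ((1ℤ ℤ.+ x) * pow 8 x)) ≡ linear coefficients-8 s x
  total-8 = solve 2 (λ s x → s :* (eulerianᵉ 8 coefficients-8 x :+ (con 1ℤ :+ x) :* powᵉ 8 x)
                          := linearᵉ coefficients-8 s x) refl

  terms-10 : List (ℤ × ℕ × ℕ)
  terms-10 = (+ 20 , 1 , 9) ∷ (+ 240 , 3 , 7) ∷ (+ 504 , 5 , 5) ∷ (+ 240 , 7 , 3) ∷ (+ 20 , 9 , 1) ∷ []

  coefficients-10 : List (ℤ × ℕ)
  coefficients-10 = (+ 155 , 1) ∷ (-[1+ 254 ] , 3) ∷ (+ 126 , 5) ∷ (-[1+ 29 ] , 7) ∷ (+ 5 , 9) ∷ (+ 1 , 11) ∷ []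

  even-10 : ∀ x y → pow 10 (x ℤ.- y) ≡ pow 10 (y ℤ.- x)
  even-10 = solve 2 (λ x y → powᵉ 10 (x :- y) := powᵉ 10 (y :- x)) refl

  step-10 : ∀ x → eulerian 10 coefficients-10 (1ℤ ℤ.+ x) ℤ.+ eulerian 10 coefficients-10 x ≡ ℤ.- ((+ 2) * pow 10 x)
  step-10 = solve 1 (λ x → eulerianᵉ 10 coefficients-10 (con 1ℤ :+ x) :+ eulerianᵉ 10 coefficients-10 x
                        := :- (con (+ 2) :* powᵉ 10 x)) refl

  expand-10 : ∀ s t a b → (s * t) * (pow 10 (a ℤ.+ b) ℤ.- pow 10 (b ℤ.- a)) ≡ bilinear terms-10 s t a b
  expand-10 = solve 4 (λ s t a b → (s :* t) :* (powᵉ 10 (a :+ b) :- powᵉ 10 (b :- a)) := bilinearᵉ terms-10 s t a b) refl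

  total-10 : ∀ s x → s * (eulerian 10 coefficients-10 x ℤ.+ ((1ℤ ℤ.+ x) * pow 10 x)) ≡ linear coefficients-10 s x
  total-10 = solve 2 (λ s x → s :* (eulerianᵉ 10 coefficients-10 x :+ (con 1ℤ :+ x) :* powᵉ 10 x)
                          := linearᵉ coefficients-10 s x) refl

  pair-terms : List (ℤ × ℕ × ℕ)
  pair-terms = (+ 1 , 3 , 7) ∷ (+ 1 , 7 , 3) ∷ (-[1+ 1 ] , 5 , 5) ∷ []

  pair-weight : ∀ s t a b → ((s * t) * pow 3 (a * b)) * pow 2 (pow 2 a ℤ.- pow 2 b) ≡ bilinear pair-terms s t a b
  pair-weight = solve 4 (λ s t a b → ((s :* t) :* powᵉ 3 (a :* b)) :* powᵉ 2 (powᵉ 2 a :- powᵉ 2 b)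
                                  := bilinearᵉ pair-terms s t a b) refl

  divisor-weight : ∀ x → power _*_ x 3 * (((+ 17) ℤ.+ ((+ 8) * power _*_ x 2)) ℤ.+ ((+ 2) * power _*_ x 4)) ≡
    ((+ 17) * power _*_ x 3) ℤ.+ (((+ 8) * power _*_ x 5) ℤ.+ (((+ 2) * power _*_ x 7) ℤ.+ 0ℤ))
  divisor-weight = solve 1 (λ x → powᵉ 3 x :* (con (+ 17) :+ con (+ 8) :* powᵉ 2 x :+ con (+ 2) :* powᵉ 4 x) :=
    con (+ 17) :* powᵉ 3 x :+ (con (+ 8) :* powᵉ 5 x :+ (con (+ 2) :* powᵉ 7 x :+ con 0ℤ))) refl

  -- The hypothesis is the shape of `9N₁₁≈` at an odd index; its zeros are the constant series and B
  -- E² there. The factor 16 stays on both sides to keep the arithmetic integral: 298368 = 16 ·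
  -- 18648, 272 = 16 · 17, 22112 = 32 · 691.
  collect : ∀ t s₁₁ s₃ s₅ s₇ p →
    (+ 9) * (0ℤ ℤ.+ ((+ 16) * (ℤ.- s₁₁))) ≡
      ((+ 691) * (0ℤ ℤ.+ ((+ 272) * (ℤ.- s₃)) ℤ.+ ((+ 128) * (ℤ.- s₅)) ℤ.+ ((+ 32) * (ℤ.- s₇)) ℤ.+ ((+ 256) * (p ℤ.+ p))))
      ℤ.+ ((+ 298368) * t) ℤ.+ ((+ 144) * 0ℤ) →
    (+ 16) * ((+ 18648) * t) ≡
      (+ 16) * ((-[1+ 8 ] * s₁₁) ℤ.+ ((+ 691) * (((+ 17) * s₃) ℤ.+ ((+ 8) * s₅) ℤ.+ ((+ 2) * s₇))) ℤ.- ((+ 22112) * p))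
  collect t s₁₁ s₃ s₅ s₇ p eq = trans
    (solve 5 (λ t s₃ s₅ s₇ p → con (+ 16) :* (con (+ 18648) :* t) := rhsᵉ t s₃ s₅ s₇ p :- restᵉ s₃ s₅ s₇ p) refl t s₃ s₅ s₇ p)
    (trans (cong (ℤ._- rest) (sym eq))
    (solve 5 (λ s₁₁ s₃ s₅ s₇ p → con (+ 9) :* (con 0ℤ :+ con (+ 16) :* (:- s₁₁)) :- restᵉ s₃ s₅ s₇ p :=
      con (+ 16) :* (con -[1+ 8 ] :* s₁₁ :+ con (+ 691) :* (con (+ 17) :* s₃ :+ con (+ 8) :* s₅ :+ con (+ 2) :* s₇) :- con (+ 22112) :* p))
      refl s₁₁ s₃ s₅ s₇ p))
    where
    rest : ℤ
    rest = (+ 691) * (((+ 272) * (ℤ.- s₃)) ℤ.+ ((+ 128) * (ℤ.- s₅)) ℤ.+ ((+ 32) * (ℤ.- s₇)) ℤ.+ ((+ 256) * (p ℤ.+ p)))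
    restᵉ : ∀ {n} → (s₃ s₅ s₇ p : Polynomial n) → Polynomial n
    restᵉ s₃ s₅ s₇ p = con (+ 691) :* (con (+ 272) :* (:- s₃) :+ con (+ 128) :* (:- s₅) :+ con (+ 32) :* (:- s₇) :+ con (+ 256) :* (p :+ p))
    rhsᵉ : ∀ {n} → (t s₃ s₅ s₇ p : Polynomial n) → Polynomial n
    rhsᵉ t s₃ s₅ s₇ p =
      con (+ 691) :* (con 0ℤ :+ con (+ 272) :* (:- s₃) :+ con (+ 128) :* (:- s₅) :+ con (+ 32) :* (:- s₇) :+ con (+ 256) :* (p :+ p))
      :+ con (+ 298368) :* t :+ con (+ 144) :* con 0ℤ

  -- F₄ and F₆ are weights on triples a + b = c with signs s = (-1)^a, t = (-1)^b, v = (-1)^c. With c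
  -- and the sign t of c fixed, T₄ and T₆ are antidifferences in x of the weights at
  -- (a, b) = (x, c - x), found by linear algebra; s is the sign of x and w stands for s t.
  F₄ : (s a t b v c : ℤ) → ℤ
  F₄ s a t b v c = (+ 6) * (((s * (((+ 2) * (a * a)) ℤ.- (b * b) ℤ.- (c * c)))
                       ℤ.+ (t * (((+ 2) * (b * b)) ℤ.- (a * a) ℤ.- (c * c))))
                       ℤ.+ (v * (((+ 2) * (c * c)) ℤ.- (a * a) ℤ.- (b * b))))

  T₄ : (s x w t c : ℤ) → ℤ
  T₄ s x w t c =
    (s * (((+ 3) * c) ℤ.+ ((+ 6) * (c * c)) ℤ.+ ((+ 3) * x) ℤ.- ((+ 6) * (x * c)) ℤ.- ((+ 3) * (x * x)))) ℤ.+
    (w * (((+ 3) * x) ℤ.- ((+ 6) * c) ℤ.- ((+ 3) * (c * c)) ℤ.+ ((+ 12) * (x * c)) ℤ.- ((+ 3) * (x * x)))) ℤ.+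
    (t * (((+ 6) * (x * (c * c))) ℤ.- ((+ 2) * x) ℤ.- ((+ 6) * (x * c)) ℤ.+ ((+ 6) * (x * x))
          ℤ.+ ((+ 6) * ((x * x) * c)) ℤ.- ((+ 4) * (x * (x * x)))))

  M₄ : (s x : ℤ) → ℤ
  M₄ s x = (+ 12) * ((s * x) ℤ.- x)

  F₆ : (s a t b v c : ℤ) → ℤ
  F₆ s a t b v c = (+ 24) * ((a * (b * c)) * ((s * a) ℤ.+ (t * b) ℤ.- (v * c)))

  T₆ : (s x w t c : ℤ) → ℤ
  T₆ s x w t c =
    (s * (c * ((+ 3) ℤ.+ (x * (((+ 12) * c) ℤ.- ((+ 18) * x) ℤ.- ((+ 12) * (c * x)) ℤ.+ ((+ 12) * (x * x))))))) ℤ.+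
    (w * (c * (-[1+ 2 ] ℤ.+ ((+ 6) * (c * c)) ℤ.+ (x * (((+ 18) * x) ℤ.- ((+ 24) * c) ℤ.- ((+ 12) * (c * c))
                ℤ.+ ((+ 24) * (c * x)) ℤ.- ((+ 12) * (x * x))))))) ℤ.+
    (t * ((x * (c * c)) * ((+ 4) ℤ.+ ((+ 12) * c) ℤ.- ((+ 12) * x) ℤ.- ((+ 12) * (c * x)) ℤ.+ ((+ 8) * (x * x)))))

  private
    F₄ᵉ F₆ᵉ : ∀ {n} → (s a t b v c : Polynomial n) → Polynomial n
    F₄ᵉ s a t b v c = con (+ 6) :* (((s :* ((con (+ 2) :* (a :* a)) :- (b :* b) :- (c :* c)))
                         :+ (t :* ((con (+ 2) :* (b :* b)) :- (a :* a) :- (c :* c))))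
                         :+ (v :* ((con (+ 2) :* (c :* c)) :- (a :* a) :- (b :* b))))
    F₆ᵉ s a t b v c = con (+ 24) :* ((a :* (b :* c)) :* ((s :* a) :+ (t :* b) :- (v :* c)))

    T₄ᵉ T₆ᵉ : ∀ {n} → (s x w t c : Polynomial n) → Polynomial n
    T₄ᵉ s x w t c =
      (s :* ((con (+ 3) :* c) :+ (con (+ 6) :* (c :* c)) :+ (con (+ 3) :* x) :- (con (+ 6) :* (x :* c)) :- (con (+ 3) :* (x :* x)))) :+
      (w :* ((con (+ 3) :* x) :- (con (+ 6) :* c) :- (con (+ 3) :* (c :* c)) :+ (con (+ 12) :* (x :* c)) :- (con (+ 3) :* (x :* x)))) :+
      (t :* ((con (+ 6) :* (x :* (c :* c))) :- (con (+ 2) :* x) :- (con (+ 6) :* (x :* c)) :+ (con (+ 6) :* (x :* x))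
            :+ (con (+ 6) :* ((x :* x) :* c)) :- (con (+ 4) :* (x :* (x :* x)))))
    T₆ᵉ s x w t c =
      (s :* (c :* (con (+ 3) :+ (x :* ((con (+ 12) :* c) :- (con (+ 18) :* x) :- (con (+ 12) :* (c :* x)) :+ (con (+ 12) :* (x :* x))))))) :+
      (w :* (c :* (con (-[1+ 2 ]) :+ (con (+ 6) :* (c :* c)) :+ (x :* ((con (+ 18) :* x) :- (con (+ 24) :* c) :- (con (+ 12) :* (c :* c))
                  :+ (con (+ 24) :* (c :* x)) :- (con (+ 12) :* (x :* x))))))) :+
      (t :* ((x :* (c :* c)) :* (con (+ 4) :+ (con (+ 12) :* c) :- (con (+ 12) :* x) :- (con (+ 12) :* (c :* x)) :+ (con (+ 8) :* (x :* x)))))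

  F₄-swap : ∀ s a t b v c → F₄ s a t b v c ≡ F₄ t b s a v c
  F₄-swap = solve 6 (λ s a t b v c → F₄ᵉ s a t b v c := F₄ᵉ t b s a v c) refl

  F₆-swap : ∀ s a t b v c → F₆ s a t b v c ≡ F₆ t b s a v c
  F₆-swap = solve 6 (λ s a t b v c → F₆ᵉ s a t b v c := F₆ᵉ t b s a v c) refl

  -- Exchanging a and c turns b = c - a into -b. F₄ is even in b, while in F₆ both a b c and the
  -- linear factor change sign.
  F₄-flip : ∀ s a t c → F₄ s a (s * t) (c ℤ.- a) t c ≡ F₄ t c (t * s) (a ℤ.- c) s a
  F₄-flip = solve 4 (λ s a t c → F₄ᵉ s a (s :* t) (c :- a) t c := F₄ᵉ t c (t :* s) (a :- c) s a) refl

  F₆-flip : ∀ s a t c → F₆ s a (s * t) (c ℤ.- a) t c ≡ F₆ t c (t * s) (a ℤ.- c) s a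
  F₆-flip = solve 4 (λ s a t c → F₆ᵉ s a (s :* t) (c :- a) t c := F₆ᵉ t c (t :* s) (a :- c) s a) refl

  F₄-diag : ∀ s x → F₄ s x 1ℤ 0ℤ s x ≡ x * M₄ s x
  F₄-diag = solve 2 (λ s x → F₄ᵉ s x (con 1ℤ) (con 0ℤ) s x := x :* (con (+ 12) :* ((s :* x) :- x))) refl

  -- The factor a b c vanishes at b = 0. The relation obtained from F₆ therefore has no derivative,
  -- and A 5 becomes algebraic in the lower series.
  F₆-diag : ∀ s x → F₆ s x 1ℤ 0ℤ s x ≡ x * 0ℤ
  F₆-diag = solve 2 (λ s x → F₆ᵉ s x (con 1ℤ) (con 0ℤ) s x := x :* con 0ℤ) refl

  T₄-step : ∀ s x t c → F₄ s x (s * t) (c ℤ.- x) t c ≡ T₄ (ℤ.- s) (1ℤ ℤ.+ x) ((ℤ.- s) * t) t c ℤ.- T₄ s x (s * t) t c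
  T₄-step = solve 4 (λ s x t c → F₄ᵉ s x (s :* t) (c :- x) t c :=
    T₄ᵉ (:- s) (con 1ℤ :+ x) ((:- s) :* t) t c :- T₄ᵉ s x (s :* t) t c) refl

  T₆-step : ∀ s x t c → F₆ s x (s * t) (c ℤ.- x) t c ≡ T₆ (ℤ.- s) (1ℤ ℤ.+ x) ((ℤ.- s) * t) t c ℤ.- T₆ s x (s * t) t c
  T₆-step = solve 4 (λ s x t c → F₆ᵉ s x (s :* t) (c :- x) t c :=
    T₆ᵉ (:- s) (con 1ℤ :+ x) ((:- s) :* t) t c :- T₆ᵉ s x (s :* t) t c) refl

  -- These are the products of U · e, namely A 1 · A 1 and A 1 · L₁. `F₆-form` likewise gives those
  -- of e · B.
  F₄-form : ∀ s a t b → F₄ s a t b (s * t) (a ℤ.+ b) ℤ.- F₄ s a (s * t) (b ℤ.- a) t b ≡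
    ((+ 48) * ((s * power _*_ a 1) * (t * power _*_ b 1))) ℤ.+
    ((-[1+ 23 ] * ((s * power _*_ a 1) * b)) ℤ.+ ((-[1+ 23 ] * (a * (t * power _*_ b 1))) ℤ.+ 0ℤ))
  F₄-form = solve 4 (λ s a t b → F₄ᵉ s a t b (s :* t) (a :+ b) :- F₄ᵉ s a (s :* t) (b :- a) t b :=
    (con (+ 48) :* ((s :* powᵉ 1 a) :* (t :* powᵉ 1 b))) :+
    ((con (-[1+ 23 ]) :* ((s :* powᵉ 1 a) :* b)) :+ ((con (-[1+ 23 ]) :* (a :* (t :* powᵉ 1 b))) :+ con 0ℤ))) refl

  F₆-form : ∀ s a t b → F₆ s a t b (s * t) (a ℤ.+ b) ℤ.- F₆ s a (s * t) (b ℤ.- a) t b ≡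
    ((+ 48) * ((s * power _*_ a 3) * b)) ℤ.+ (((+ 48) * (a * (t * power _*_ b 3))) ℤ.+
    ((-[1+ 47 ] * ((s * power _*_ a 1) * (t * power _*_ b 3))) ℤ.+ ((-[1+ 47 ] * ((s * power _*_ a 3) * (t * power _*_ b 1))) ℤ.+ 0ℤ)))
  F₆-form = solve 4 (λ s a t b → F₆ᵉ s a t b (s :* t) (a :+ b) :- F₆ᵉ s a (s :* t) (b :- a) t b :=
    (con (+ 48) :* ((s :* powᵉ 3 a) :* b)) :+ ((con (+ 48) :* (a :* (t :* powᵉ 3 b))) :+
    ((con (-[1+ 47 ]) :* ((s :* powᵉ 1 a) :* (t :* powᵉ 3 b))) :+
     ((con (-[1+ 47 ]) :* ((s :* powᵉ 3 a) :* (t :* powᵉ 1 b))) :+ con 0ℤ)))) refl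

  T₄-total : ∀ t c → T₄ t c 1ℤ t c ℤ.- T₄ -1ℤ 1ℤ (-1ℤ * t) t c ℤ.+ (c * M₄ t c) ≡
    ((+ 10) * (t * power _*_ c 1)) ℤ.+ ((-[1+ 5 ] * c) ℤ.+ (((+ 8) * (t * power _*_ c 3)) ℤ.+ 0ℤ))
  T₄-total = solve 2 (λ t c → T₄ᵉ t c (con 1ℤ) t c :- T₄ᵉ (con -1ℤ) (con 1ℤ) (con -1ℤ :* t) t c
      :+ (c :* (con (+ 12) :* ((t :* c) :- c))) :=
    (con (+ 10) :* (t :* powᵉ 1 c)) :+ ((con (-[1+ 5 ]) :* c) :+ ((con (+ 8) :* (t :* powᵉ 3 c)) :+ con 0ℤ))) refl

  T₆-total : ∀ t c → T₆ t c 1ℤ t c ℤ.- T₆ -1ℤ 1ℤ (-1ℤ * t) t c ℤ.+ (c * 0ℤ) ≡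
    (-[1+ 3 ] * (t * power _*_ c 5)) ℤ.+ ((-[1+ 5 ] * c) ℤ.+ (((+ 6) * (t * power _*_ c 1)) ℤ.+ ((-[1+ 7 ] * (t * power _*_ c 3)) ℤ.+ 0ℤ)))
  T₆-total = solve 2 (λ t c → T₆ᵉ t c (con 1ℤ) t c :- T₆ᵉ (con -1ℤ) (con 1ℤ) (con -1ℤ :* t) t c :+ (c :* con 0ℤ) :=
    (con (-[1+ 3 ]) :* (t :* powᵉ 5 c)) :+ ((con (-[1+ 5 ]) :* c) :+
    ((con (+ 6) :* (t :* powᵉ 1 c)) :+ ((con (-[1+ 7 ]) :* (t :* powᵉ 3 c)) :+ con 0ℤ)))) refl

open Polynomials ℤ._*_ ℤₚ.+-*-isCommutativeRing (λ _ _ → refl) public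

-- The Liouville relations between the series A k.

toForm : List (ℤ × ℕ × ℕ) → Form
toForm = map (λ { (c , i , j) → c , alternating i , alternating j })

toCombination : List (ℤ × ℕ) → Combination
toCombination = map (λ { (c , i) → c , alternating i })

formAt-toForm : ∀ ts a b → bilinear ts (sgn a) (sgn b) (+ a) (+ b) ≡ formAt (toForm ts) a b
formAt-toForm []                 a b = refl
formAt-toForm ((c , i , j) ∷ ts) a b = cong (λ z → c ℤ.* (alternating i a ℤ.* alternating j b) ℤ.+ z) (formAt-toForm ts a b)

combinationAt-toCombination : ∀ cs a → linear cs (sgn a) (+ a) ≡ combinationAt (toCombination cs) a
combinationAt-toCombination []             a = refl
combinationAt-toCombination ((c , i) ∷ cs) a = cong (λ z → c ℤ.* alternating i a ℤ.+ z) (combinationAt-toCombination cs a)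

D-L-* : ∀ c φ → D (L (λ a → c ℤ.* φ a)) ≈ˢ const c · D (L φ)
D-L-* c φ n = trans (cong (+ n ℤ.*_) (trans (L-* c φ n) (const-· c (L φ) n)))
  (trans (Solver.solve 3 (λ n c x → n :* (c :* x) := c :* (n :* x)) refl (+ n) c (L φ n))
         (sym (const-· c (D (L φ)) n)))
  where open Solver

from-alternating : ∀ k ts cs → let f = pow (suc k) ; g = eulerian (suc k) cs in
  (∀ x y → f (x ℤ.- y) ≡ f (y ℤ.- x)) → (∀ x → g (1ℤ ℤ.+ x) ℤ.+ g x ≡ ℤ.- (+ 2 ℤ.* f x)) → g 1ℤ ≡ 0ℤ → f 0ℤ ≡ 0ℤ →
  (∀ a b → sgn a ℤ.* sgn b ℤ.* (f (+ a ℤ.+ + b) ℤ.- f (+ b ℤ.- + a)) ≡ bilinear ts (sgn a) (sgn b) (+ a) (+ b)) →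
  (∀ c → sgn c ℤ.* (g (+ c) ℤ.+ (1ℤ ℤ.+ + c) ℤ.* f (+ c)) ≡ linear cs (sgn c) (+ c)) →
  formˢ (toForm ts) ≈ˢ combinationˢ (toCombination cs) +ˢ -ˢ (const (+ 2) · D (A k))
from-alternating k ts cs f-even g-step g1 f0 expand total n = trans
  (alternating-identity (pow (suc k)) (eulerian (suc k) cs) f-even g-step g1 f0
    (λ a → power ℤ._*_ (+ a) k) (λ a → refl) (toForm ts) (toCombination cs)
    (λ a b → trans (expand a b) (formAt-toForm ts a b)) (λ c → trans (total c) (combinationAt-toCombination cs c)) n)
  (cong (λ z → combinationˢ (toCombination cs) n ℤ.- z) (D-L-* (+ 2) (alternating k) n))

-- A full-size number is the exponent k of f: the relation contains A (k + 1) with coefficient 1 and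
-- the derivative of A (k - 1). The subscripts in `identity-₄` and `identity-₆` are weights of
-- modular forms.
identity-4 : formˢ (toForm terms-4) ≈ˢ combinationˢ (toCombination coefficients-4) +ˢ -ˢ (const (+ 2) · D (A 3))
identity-4 = from-alternating 3 terms-4 coefficients-4 even-4 step-4 refl refl
  (λ a b → expand-4 (sgn a) (sgn b) (+ a) (+ b)) (λ c → total-4 (sgn c) (+ c))

identity-6 : formˢ (toForm terms-6) ≈ˢ combinationˢ (toCombination coefficients-6) +ˢ -ˢ (const (+ 2) · D (A 5))
identity-6 = from-alternating 5 terms-6 coefficients-6 even-6 step-6 refl refl
  (λ a b → expand-6 (sgn a) (sgn b) (+ a) (+ b)) (λ c → total-6 (sgn c) (+ c))

identity-8 : formˢ (toForm terms-8) ≈ˢ combinationˢ (toCombination coefficients-8) +ˢ -ˢ (const (+ 2) · D (A 7))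
identity-8 = from-alternating 7 terms-8 coefficients-8 even-8 step-8 refl refl
  (λ a b → expand-8 (sgn a) (sgn b) (+ a) (+ b)) (λ c → total-8 (sgn c) (+ c))

identity-10 : formˢ (toForm terms-10) ≈ˢ combinationˢ (toCombination coefficients-10) +ˢ -ˢ (const (+ 2) · D (A 9))
identity-10 = from-alternating 9 terms-10 coefficients-10 even-10 step-10 refl refl
  (λ a b → expand-10 (sgn a) (sgn b) (+ a) (+ b)) (λ c → total-10 (sgn c) (+ c))

form-₄ form-₆ : Form
form-₄ = (+ 48 , alternating 1 , alternating 1) ∷ (-[1+ 23 ] , alternating 1 , +_) ∷ (-[1+ 23 ] , +_ , alternating 1) ∷ []
form-₆ = (+ 48 , alternating 3 , +_) ∷ (+ 48 , +_ , alternating 3) ∷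
         (-[1+ 47 ] , alternating 1 , alternating 3) ∷ (-[1+ 47 ] , alternating 3 , alternating 1) ∷ []

combination-₄ combination-₆ : Combination
combination-₄ = (+ 10 , alternating 1) ∷ (-[1+ 5 ] , +_) ∷ (+ 8 , alternating 3) ∷ []
combination-₆ = (-[1+ 3 ] , alternating 5) ∷ (-[1+ 5 ] , +_) ∷ (+ 6 , alternating 1) ∷ (-[1+ 7 ] , alternating 3) ∷ []

identity-₄ : formˢ form-₄ ≈ˢ combinationˢ combination-₄ +ˢ -ˢ (D (L (λ a → M₄ (sgn a) (+ a))))
identity-₄ = symmetric-identity F₄ T₄ M₄ F₄-swap F₄-flip F₄-diag T₄-step form-₄ combination-₄
  (λ a b → F₄-form (sgn a) (+ a) (sgn b) (+ b)) (λ c → T₄-total (sgn c) (+ c))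

identity-₆ : formˢ form-₆ ≈ˢ combinationˢ combination-₆ +ˢ -ˢ (D (L (λ a → 0ℤ)))
identity-₆ = symmetric-identity F₆ T₆ (λ _ _ → 0ℤ) F₆-swap F₆-flip F₆-diag T₆-step form-₆ combination-₆
  (λ a b → F₆-form (sgn a) (+ a) (sgn b) (+ b)) (λ c → T₆-total (sgn c) (+ c))

open SeriesSolver

-- The ring generated by e, U and B

-- e, B and E are modular forms of level 2 and weights 2, 4 and 4; P and U are quasimodular of
-- weight 2, with P = 3 U - 2 e the Eisenstein series E₂.
L₁ e U B E P : Series
L₁ = L +_
e = const 1ℤ +ˢ const (+ 12) · L₁ +ˢ -ˢ (const (+ 12) · A 1)
U = const 1ℤ +ˢ -ˢ (const (+ 8) · A 1)
B = const 1ℤ +ˢ const (+ 16) · A 3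
E = e · e +ˢ -ˢ B
P = const 1ℤ +ˢ -ˢ (const (+ 24) · L₁)

-- Scaled so as to be homogeneous polynomials in e and B with integral coefficients; 2N₉ is
-- doubled because the recurrence produces 2N₉ rather than 31 - 8 A 9.
N₅ N₇ 2N₉ N₁₁ : Series
N₅  = const 1ℤ +ˢ -ˢ (const (+ 8) · A 5)
N₇  = const (+ 17) +ˢ const (+ 32) · A 7
2N₉ = const (+ 62) +ˢ -ˢ (const (+ 16) · A 9)
N₁₁ = const (+ 691) +ˢ const (+ 16) · A 11

-- Differentiation of polynomials in e, U and B.

infix 4 _′≈_
_′≈_ : Series → Series → Set
f ′≈ g = D f ≈ˢ g

const-′ : ∀ c → const c ′≈ const 0ℤ
const-′ = D-const

+-′ : ∀ {f f′ g g′} → f ′≈ f′ → g ′≈ g′ → f +ˢ g ′≈ f′ +ˢ g′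
+-′ {f} {g = g} p q = transˢ (D-+ f g) (+ˢ-cong p q)

neg-′ : ∀ {f f′} → f ′≈ f′ → -ˢ f ′≈ -ˢ f′
neg-′ {f} p = transˢ (D-neg f) (-ˢ-cong p)

·-′ : ∀ {f f′ g g′} → f ′≈ f′ → g ′≈ g′ → f · g ′≈ f′ · g +ˢ f · g′
·-′ {f} {f′} {g} {g′} p q = transˢ (D-· f g) (+ˢ-cong (·-cong p (reflˢ {g})) (·-cong (reflˢ {f}) q))

-- The solver proves x ≈ y only up to a multiple of a known relation l ≈ r.
adjust : ∀ {l r x} k y → l ≈ˢ r → x ≈ˢ y +ˢ k · (r +ˢ -ˢ l) → x ≈ˢ y
adjust {l} {r} k y l≈r x≈ = transˢ x≈ (transˢ
  (+ˢ-cong (reflˢ {y}) (·-cong (reflˢ {k}) (+ˢ-cong (reflˢ {r}) (-ˢ-cong l≈r))))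
  (solve 3 (λ y k r → y :+ k :* (r :- r) := y) reflˢ y k r))

affine-′ : ∀ c k f → const c +ˢ const k · f ′≈ const k · D f
affine-′ c k f = transˢ (+-′ (const-′ c) (·-′ {g = f} (const-′ k) reflˢ))
  (solve 3 (λ k f d → con 0ℤ :+ (con 0ℤ :* f :+ k :* d) := k :* d) reflˢ (const k) f (D f))

affine-neg-′ : ∀ c k f → const c +ˢ -ˢ (const k · f) ′≈ -ˢ (const k · D f)
affine-neg-′ c k f = transˢ (+-′ (const-′ c) (neg-′ (·-′ {g = f} (const-′ k) reflˢ)))
  (solve 3 (λ k f d → con 0ℤ :- (con 0ℤ :* f :+ k :* d) := :- (k :* d)) reflˢ (const k) f (D f))

-- Twice `identity-₄`: its derivative term is D of 12 (L₁ - A 1), which is D e. The factor 2 avoids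
-- the fraction in (U e - B) / 2.
e-′ : const (+ 2) · D e ≈ˢ U · e +ˢ -ˢ B
e-′ = adjust (const (+ 2)) (U · e +ˢ -ˢ B) identity (transˢ
  (·-cong (reflˢ {const (+ 2)}) (+-′ (affine-′ 1ℤ (+ 12) L₁) (neg-′ (·-′ {g = A 1} (const-′ (+ 12)) reflˢ))))
  (solve 5 (λ l a₁ a₃ l′ a₁′ →
      con (+ 2) :* (con (+ 12) :* l′ :- (con 0ℤ :* a₁ :+ con (+ 12) :* a₁′)) :=
      (con 1ℤ :- con (+ 8) :* a₁) :* (con 1ℤ :+ con (+ 12) :* l :- con (+ 12) :* a₁) :- (con 1ℤ :+ con (+ 16) :* a₃)
      :+ con (+ 2) :* ((con (+ 10) :* a₁ :+ (con -[1+ 5 ] :* l :+ (con (+ 8) :* a₃ :+ con 0ℤ)) :- con (+ 12) :* (a₁′ :- l′))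
        :- (con (+ 48) :* (a₁ :* a₁) :+ (con -[1+ 23 ] :* (a₁ :* l) :+ (con -[1+ 23 ] :* (l :* a₁) :+ con 0ℤ)))))
    reflˢ L₁ (A 1) (A 3) (D L₁) (D (A 1))))
  where
  M₄-series : L (λ a → M₄ (sgn a) (+ a)) ≈ˢ const (+ 12) · (A 1 +ˢ -ˢ L₁)
  M₄-series = transˢ (L-* (+ 12) (λ a → sgn a ℤ.* + a ℤ.- + a))
    (·-cong (reflˢ {const (+ 12)}) (transˢ (L-cong pointwise) (transˢ (L-combination ((1ℤ , alternating 1) ∷ (-1ℤ , +_) ∷ []))
      (solve 2 (λ a l → con 1ℤ :* a :+ (con -1ℤ :* l :+ con 0ℤ) := a :- l) reflˢ (A 1) L₁))))
    where
    pointwise : ∀ a → sgn (suc a) ℤ.* + suc a ℤ.- + suc a ≡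
                      combinationAt ((1ℤ , alternating 1) ∷ (-1ℤ , +_) ∷ []) (suc a)
    pointwise a = Solver.solve 2 (λ s x → s Solver.:* x Solver.:- x Solver.:=
      Solver.con 1ℤ Solver.:* (s Solver.:* (x Solver.:* Solver.con 1ℤ)) Solver.:+ (Solver.con -1ℤ Solver.:* x Solver.:+ Solver.con 0ℤ))
                    refl (sgn (suc a)) (+ suc a)
  identity = transˢ identity-₄ (+ˢ-cong (reflˢ {combinationˢ combination-₄}) (-ˢ-cong (transˢ (D-cong M₄-series)
    (transˢ (·-′ {g = A 1 +ˢ -ˢ L₁} (const-′ (+ 12)) (+-′ {A 1} reflˢ (neg-′ {L₁} reflˢ)))
      (solve 4 (λ a l a′ l′ → con 0ℤ :* (a :- l) :+ con (+ 12) :* (a′ :- l′) := con (+ 12) :* (a′ :- l′)) reflˢ (A 1) L₁ (D (A 1)) (D L₁))))))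

-- Twice `identity-₆`. This relation closes the differential system: `identity-4` alone leaves A 5
-- in the derivative of B.
N₅≈ : N₅ ≈ˢ e · B
N₅≈ = adjust (const (+ 2)) (e · B) identity
  (solve 4 (λ a₁ l a₃ a₅ → con 1ℤ :- con (+ 8) :* a₅ :=
    (con 1ℤ :+ con (+ 12) :* l :- con (+ 12) :* a₁) :* (con 1ℤ :+ con (+ 16) :* a₃) :+ con (+ 2) :*
      ((con -[1+ 3 ] :* a₅ :+ (con -[1+ 5 ] :* l :+ (con (+ 6) :* a₁ :+ (con -[1+ 7 ] :* a₃ :+ con 0ℤ))))
        :- (con (+ 48) :* (a₃ :* l) :+ (con (+ 48) :* (l :* a₃) :+ (con -[1+ 47 ] :* (a₁ :* a₃) :+ (con -[1+ 47 ] :* (a₃ :* a₁) :+ con 0ℤ))))))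
    reflˢ (A 1) L₁ (A 3) (A 5))
  where
  D-L-0 : D (L (λ _ → 0ℤ)) ≈ˢ const 0ℤ
  D-L-0 = transˢ (D-cong (L-combination [])) (const-′ 0ℤ)
  identity = transˢ identity-₆ (transˢ (+ˢ-cong (reflˢ {combinationˢ combination-₆}) (-ˢ-cong D-L-0))
    (solve 1 (λ x → x :- con 0ℤ := x) reflˢ (combinationˢ combination-₆)))

B-′ : B ′≈ U · B +ˢ -ˢ (e · B)
B-′ = transˢ (affine-′ 1ℤ (+ 16) (A 3)) (transˢ
  (adjust (const -[1+ 7 ]) (U · B +ˢ -ˢ N₅) identity-4
    (solve 4 (λ a₁ a₃ a₅ a₃′ → con (+ 16) :* a₃′ :=
      (con 1ℤ :- con (+ 8) :* a₁) :* (con 1ℤ :+ con (+ 16) :* a₃) :- (con 1ℤ :- con (+ 8) :* a₅) :+ con -[1+ 7 ] :*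
        ((con -[1+ 0 ] :* a₁ :+ (con (+ 2) :* a₃ :+ (con (+ 1) :* a₅ :+ con 0ℤ)) :- con (+ 2) :* a₃′)
         :- (con (+ 8) :* (a₁ :* a₃) :+ (con (+ 8) :* (a₃ :* a₁) :+ con 0ℤ))))
      reflˢ (A 1) (A 3) (A 5) (D (A 3))))
  (+ˢ-cong (reflˢ {U · B}) (-ˢ-cong N₅≈)))

eB-′ : e · B ′≈ D e · B +ˢ e · (U · B +ˢ -ˢ (e · B))
eB-′ = ·-′ {e} reflˢ B-′

-- The pattern for `2N₉≈` and `N₁₁≈` too. A Liouville relation gives the new series through products
-- of earlier ones and the derivative of the preceding one; the earlier ones are replaced by
-- polynomials in e and B, which are differentiated by `e-′` and `B-′`. The quasimodular U must
-- cancel.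
N₇≈ : N₇ ≈ˢ const (+ 9) · (B · B) +ˢ const (+ 8) · ((e · e) · B)
N₇≈ = transˢ step₁ (transˢ step₂ step₃)
  where
  step₁ : N₇ ≈ˢ const (+ 12) · (U · N₅) +ˢ const (+ 5) · (B · B) +ˢ const -[1+ 7 ] · (-ˢ (const (+ 8) · D (A 5)))
  step₁ = adjust (const (+ 32)) _ identity-6
    (solve 5 (λ a₁ a₃ a₅ a₇ a₅′ → con (+ 17) :+ con (+ 32) :* a₇ :=
      con (+ 12) :* ((con 1ℤ :- con (+ 8) :* a₁) :* (con 1ℤ :- con (+ 8) :* a₅))
      :+ con (+ 5) :* ((con 1ℤ :+ con (+ 16) :* a₃) :* (con 1ℤ :+ con (+ 16) :* a₃))
      :+ con -[1+ 7 ] :* (:- (con (+ 8) :* a₅′)) :+ con (+ 32) :*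
        ((con (+ 3) :* a₁ :+ (con -[1+ 4 ] :* a₃ :+ (con (+ 3) :* a₅ :+ (con (+ 1) :* a₇ :+ con 0ℤ))) :- con (+ 2) :* a₅′)
         :- (con (+ 12) :* (a₁ :* a₅) :+ (con (+ 40) :* (a₃ :* a₃) :+ (con (+ 12) :* (a₅ :* a₁) :+ con 0ℤ)))))
      reflˢ (A 1) (A 3) (A 5) (A 7) (D (A 5)))
  step₂ = +ˢ-cong (+ˢ-cong (·-cong (reflˢ {const (+ 12)}) (·-cong (reflˢ {U}) N₅≈)) (reflˢ {const (+ 5) · (B · B)}))
    (·-cong (reflˢ {const -[1+ 7 ]}) (transˢ (symˢ (affine-neg-′ 1ℤ (+ 8) (A 5))) (transˢ (D-cong N₅≈) eB-′)))
  -- The multiplier of `e-′` is minus half the coefficient of D e, so that D e disappears.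
  step₃ = adjust (const (+ 4) · B) _ e-′
    (solve 4 (λ e U B e′ →
      con (+ 12) :* (U :* (e :* B)) :+ con (+ 5) :* (B :* B) :+ con -[1+ 7 ] :* (e′ :* B :+ e :* (U :* B :- e :* B)) :=
      con (+ 9) :* (B :* B) :+ con (+ 8) :* ((e :* e) :* B) :+ (con (+ 4) :* B) :* ((U :* e :- B) :- con (+ 2) :* e′))
      reflˢ e U B (D e))

B²-′ : B · B ′≈ (U · B +ˢ -ˢ (e · B)) · B +ˢ B · (U · B +ˢ -ˢ (e · B))
B²-′ = ·-′ B-′ B-′

e²-′ : e · e ′≈ D e · e +ˢ e · D e
e²-′ = ·-′ {e} {D e} {e} reflˢ reflˢ

scale-′ : ∀ k {f f′} → f ′≈ f′ → const k · f ′≈ const k · f′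
scale-′ k {f} {f′} p = transˢ (·-′ (const-′ k) p)
  (solve 3 (λ k f f′ → con 0ℤ :* f :+ k :* f′ := k :* f′) reflˢ (const k) f f′)

2N₉≈ : 2N₉ ≈ˢ const (+ 54) · (e · (B · B)) +ˢ const (+ 8) · ((e · e) · (e · B))
2N₉≈ = transˢ step₁ (transˢ step₂ step₃)
  where
  step₁ : 2N₉ ≈ˢ const (+ 2) · (U · N₇) +ˢ const (+ 28) · (B · N₅) +ˢ -ˢ (const (+ 32) · D (A 7))
  step₁ = adjust (const -[1+ 15 ]) _ identity-8
    (solve 6 (λ a₁ a₃ a₅ a₇ a₉ a₇′ → con (+ 62) :- con (+ 16) :* a₉ :=
      con (+ 2) :* ((con 1ℤ :- con (+ 8) :* a₁) :* (con (+ 17) :+ con (+ 32) :* a₇))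
      :+ con (+ 28) :* ((con 1ℤ :+ con (+ 16) :* a₃) :* (con 1ℤ :- con (+ 8) :* a₅))
      :- con (+ 32) :* a₇′ :+ con -[1+ 15 ] :*
        ((con -[1+ 16 ] :* a₁ :+ (con (+ 28) :* a₃ :+ (con -[1+ 13 ] :* a₅ :+ (con (+ 4) :* a₇ :+ (con (+ 1) :* a₉ :+ con 0ℤ)))) :- con (+ 2) :* a₇′)
         :- (con (+ 16) :* (a₁ :* a₇) :+ (con (+ 112) :* (a₃ :* a₅) :+ (con (+ 112) :* (a₅ :* a₃) :+ (con (+ 16) :* (a₇ :* a₁) :+ con 0ℤ))))))
      reflˢ (A 1) (A 3) (A 5) (A 7) (A 9) (D (A 7)))
  step₂ = +ˢ-cong (+ˢ-cong (·-cong (reflˢ {const (+ 2)}) (·-cong (reflˢ {U}) N₇≈))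
                           (·-cong (reflˢ {const (+ 28)}) (·-cong (reflˢ {B}) N₅≈)))
    (-ˢ-cong (transˢ (symˢ (affine-′ (+ 17) (+ 32) (A 7))) (transˢ (D-cong N₇≈)
      (+-′ (scale-′ (+ 9) B²-′) (scale-′ (+ 8) (·-′ e²-′ B-′))))))
  step₃ = adjust (const (+ 8) · (e · B)) _ e-′
    (solve 4 (λ e U B e′ → let B′ = U :* B :- e :* B in
      con (+ 2) :* (U :* (con (+ 9) :* (B :* B) :+ con (+ 8) :* ((e :* e) :* B))) :+ con (+ 28) :* (B :* (e :* B))
      :- (con (+ 9) :* (B′ :* B :+ B :* B′) :+ con (+ 8) :* ((e′ :* e :+ e :* e′) :* B :+ (e :* e) :* B′)) :=
      con (+ 54) :* (e :* (B :* B)) :+ con (+ 8) :* ((e :* e) :* (e :* B))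
      :+ (con (+ 8) :* (e :* B)) :* ((U :* e :- B) :- con (+ 2) :* e′))
      reflˢ e U B (D e))

-- Substituting e² = B + E leaves the products B³, B² E and B E². Only B³ has a constant term, hence
-- its coefficient 691.
N₁₁≈ : N₁₁ ≈ˢ const (+ 691) · (B · (B · B)) +ˢ const (+ 518) · ((B · B) · E) +ˢ const (+ 16) · ((B · E) · E)
N₁₁≈ = transˢ step₁ (transˢ step₂ step₃)
  where
  step₁ : N₁₁ ≈ˢ const (+ 5) · (U · 2N₉) +ˢ const (+ 15) · (B · N₇) +ˢ const (+ 126) · (N₅ · N₅)
                   +ˢ const -[1+ 1 ] · (-ˢ (const (+ 16) · D (A 9)))
  step₁ = adjust (const (+ 16)) _ identity-10
    (solve 7 (λ a₁ a₃ a₅ a₇ a₉ a₁₁ a₉′ → con (+ 691) :+ con (+ 16) :* a₁₁ :=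
      con (+ 5) :* ((con 1ℤ :- con (+ 8) :* a₁) :* (con (+ 62) :- con (+ 16) :* a₉))
      :+ con (+ 15) :* ((con 1ℤ :+ con (+ 16) :* a₃) :* (con (+ 17) :+ con (+ 32) :* a₇))
      :+ con (+ 126) :* ((con 1ℤ :- con (+ 8) :* a₅) :* (con 1ℤ :- con (+ 8) :* a₅))
      :+ con -[1+ 1 ] :* (:- (con (+ 16) :* a₉′)) :+ con (+ 16) :*
        ((con (+ 155) :* a₁ :+ (con -[1+ 254 ] :* a₃ :+ (con (+ 126) :* a₅ :+ (con -[1+ 29 ] :* a₇ :+ (con (+ 5) :* a₉ :+ (con (+ 1) :* a₁₁ :+ con 0ℤ)))))
           :- con (+ 2) :* a₉′)
         :- (con (+ 20) :* (a₁ :* a₉) :+ (con (+ 240) :* (a₃ :* a₇) :+ (con (+ 504) :* (a₅ :* a₅)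
              :+ (con (+ 240) :* (a₇ :* a₃) :+ (con (+ 20) :* (a₉ :* a₁) :+ con 0ℤ)))))))
      reflˢ (A 1) (A 3) (A 5) (A 7) (A 9) (A 11) (D (A 9)))
  step₂ = +ˢ-cong (+ˢ-cong (+ˢ-cong (·-cong (reflˢ {const (+ 5)}) (·-cong (reflˢ {U}) 2N₉≈))
                                    (·-cong (reflˢ {const (+ 15)}) (·-cong (reflˢ {B}) N₇≈)))
                           (·-cong (reflˢ {const (+ 126)}) (·-cong N₅≈ N₅≈)))
    (·-cong (reflˢ {const -[1+ 1 ]}) (transˢ (symˢ (affine-neg-′ (+ 62) (+ 16) (A 9))) (transˢ (D-cong 2N₉≈)
      (+-′ (scale-′ (+ 54) (·-′ {e} reflˢ B²-′)) (scale-′ (+ 8) (·-′ e²-′ eB-′))))))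
  step₃ = adjust (const (+ 54) · (B · B) +ˢ const (+ 24) · ((e · e) · B)) _ e-′
    (solve 4 (λ e U B e′ → let B′ = U :* B :- e :* B ; E = e :* e :- B in
      con (+ 5) :* (U :* (con (+ 54) :* (e :* (B :* B)) :+ con (+ 8) :* ((e :* e) :* (e :* B))))
      :+ con (+ 15) :* (B :* (con (+ 9) :* (B :* B) :+ con (+ 8) :* ((e :* e) :* B)))
      :+ con (+ 126) :* ((e :* B) :* (e :* B))
      :+ con -[1+ 1 ] :* (con (+ 54) :* (e′ :* (B :* B) :+ e :* (B′ :* B :+ B :* B′))
                          :+ con (+ 8) :* ((e′ :* e :+ e :* e′) :* (e :* B) :+ (e :* e) :* (e′ :* B :+ e :* B′))) :=
      con (+ 691) :* (B :* (B :* B)) :+ con (+ 518) :* ((B :* B) :* E) :+ con (+ 16) :* ((B :* E) :* E)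
      :+ (con (+ 54) :* (B :* B) :+ con (+ 24) :* ((e :* e) :* B)) :* ((U :* e :- B) :- con (+ 2) :* e′))
      reflˢ e U B (D e))

E-′ : E ′≈ U · E
E-′ = transˢ (+-′ e²-′ (neg-′ B-′)) (adjust (-ˢ e) _ e-′
  (solve 4 (λ e U B e′ → (e′ :* e :+ e :* e′) :- (U :* B :- e :* B) :=
    U :* (e :* e :- B) :+ (:- e) :* ((U :* e :- B) :- con (+ 2) :* e′)) reflˢ e U B (D e)))

Φ : Series
Φ = (B · B) · E

-- Logarithmic derivatives add: 2 (U - e) + U = 3 U - 2 e = P.
Φ-′ : Φ ′≈ P · Φ
Φ-′ = transˢ (·-′ B²-′ E-′)
  (solve 3 (λ a l B → let U = con 1ℤ :- con (+ 8) :* a ; e = con 1ℤ :+ con (+ 12) :* l :- con (+ 12) :* a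
                          B′ = U :* B :- e :* B ; E = e :* e :- B in
    (B′ :* B :+ B :* B′) :* E :+ (B :* B) :* (U :* E) := (con 1ℤ :- con (+ 24) :* l) :* ((B :* B) :* E)) reflˢ (A 1) L₁ B)

-- The logarithmic derivative is (U - e) + 2 U = 3 U - e, written out in A 1 and L₁ so that its
-- parity becomes visible.
BE²-′ : (B · E) · E ′≈ (const (+ 2) +ˢ -ˢ (const (+ 12) · (A 1 +ˢ L₁))) · ((B · E) · E)
BE²-′ = transˢ (·-′ (·-′ B-′ E-′) E-′)
  (solve 3 (λ a l B → let U = con 1ℤ :- con (+ 8) :* a ; e = con 1ℤ :+ con (+ 12) :* l :- con (+ 12) :* a
                          B′ = U :* B :- e :* B ; E = e :* e :- B in
    (B′ :* E :+ B :* (U :* E)) :* E :+ (B :* E) :* (U :* E) := (con (+ 2) :- con (+ 12) :* (a :+ l)) :* ((B :* E) :* E)) reflˢ (A 1) L₁ B)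

-- N₅ · N₅ = e² B² cancels the e² part of B · N₇.
9B³≈ : const (+ 9) · (B · (B · B)) ≈ˢ B · N₇ +ˢ -ˢ (const (+ 8) · (N₅ · N₅))
9B³≈ = symˢ (transˢ (+ˢ-cong (·-cong (reflˢ {B}) N₇≈) (-ˢ-cong (·-cong (reflˢ {const (+ 8)}) (·-cong N₅≈ N₅≈))))
  (solve 2 (λ e B → B :* (con (+ 9) :* (B :* B) :+ con (+ 8) :* ((e :* e) :* B)) :- con (+ 8) :* ((e :* B) :* (e :* B))
                 := con (+ 9) :* (B :* (B :* B))) reflˢ e B))

-- Uniqueness for D F = H F.

·-vanish-terms : ∀ m f g → (∀ i → i ≤ m → f i ≡ 0ℤ ⊎ g (m ∸ i) ≡ 0ℤ) → (f · g) m ≡ 0ℤ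
·-vanish-terms m f g e = go m f e
  where
  product : ∀ {x y} → x ≡ 0ℤ ⊎ y ≡ 0ℤ → x ℤ.* y ≡ 0ℤ
  product (inj₁ refl) = refl
  product {x} (inj₂ refl) = ℤₚ.*-zeroʳ x
  go : ∀ m f → (∀ i → i ≤ m → f i ≡ 0ℤ ⊎ g (m ∸ i) ≡ 0ℤ) → (f · g) m ≡ 0ℤ
  go zero    f e = trans (·-zero f g) (product (e 0 z≤n))
  go (suc m) f e = trans (·-suc f g m) (cong₂ ℤ._+_ (product (e 0 z≤n)) (go m (tail f) (λ i i≤m → e (suc i) (s≤s i≤m))))

-- Comparing coefficients, (n - H 0) F n is a sum of H (suc i) F (n - suc i), so only the
-- coefficient at n = H 0 is free.
vanish-on : ∀ F H (Q : ℕ → Set) → F ′≈ H · F → (∀ n → Q n → + n ≡ H 0 → F n ≡ 0ℤ) →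
            (∀ n → Q (suc n) → ∀ i → i ≤ n → H (suc i) ≡ 0ℤ ⊎ Q (n ∸ i)) → ∀ n → Q n → F n ≡ 0ℤ
vanish-on F H Q F-′ free closed = <-rec (λ n → Q n → F n ≡ 0ℤ) step
  where
  open ≡-Reasoning
  conclude : ∀ n → Q n → + n ℤ.* F n ≡ H 0 ℤ.* F n → F n ≡ 0ℤ
  conclude n q eq with ℤₚ.i*j≡0⇒i≡0∨j≡0 (+ n ℤ.- H 0) {F n} (begin
      (+ n ℤ.- H 0) ℤ.* F n         ≡⟨ Solver.solve 3 (λ n h f → (n Solver.:- h) Solver.:* f Solver.:= n Solver.:* f Solver.:- h Solver.:* f)
                                        refl (+ n) (H 0) (F n) ⟩
      + n ℤ.* F n ℤ.- H 0 ℤ.* F n   ≡⟨ cong (ℤ._- H 0 ℤ.* F n) eq ⟩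
      H 0 ℤ.* F n ℤ.- H 0 ℤ.* F n   ≡⟨ ℤₚ.+-inverseʳ (H 0 ℤ.* F n) ⟩
      0ℤ ∎)
  ... | inj₁ n-h≡0 = free n q (ℤₚ.i-j≡0⇒i≡j (+ n) (H 0) n-h≡0)
  ... | inj₂ Fn≡0  = Fn≡0
  step : ∀ n → (∀ {m} → m < n → Q m → F m ≡ 0ℤ) → Q n → F n ≡ 0ℤ
  step zero    rec q = conclude 0 q (trans (F-′ 0) (·-zero H F))
  step (suc n) rec q = conclude (suc n) q (begin
    + suc n ℤ.* F (suc n)                      ≡⟨ F-′ (suc n) ⟩
    (H · F) (suc n)                            ≡⟨ ·-suc H F n ⟩
    H 0 ℤ.* F (suc n) ℤ.+ (tail H · F) n       ≡⟨ cong (λ z → H 0 ℤ.* F (suc n) ℤ.+ z) (·-vanish-terms n (tail H) F term) ⟩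
    H 0 ℤ.* F (suc n) ℤ.+ 0ℤ                   ≡⟨ ℤₚ.+-identityʳ _ ⟩
    H 0 ℤ.* F (suc n) ∎)
    where
    term : ∀ i → i ≤ n → H (suc i) ≡ 0ℤ ⊎ F (n ∸ i) ≡ 0ℤ
    term i i≤n with closed n q i i≤n
    ... | inj₁ h≡0 = inj₁ h≡0
    ... | inj₂ q′  = inj₂ (rec (s≤s (ℕₚ.m∸n≤m n i)) q′)

-- The logarithmic derivative of the product

-- The fixpoint equation rearranges to q^r = X r · (1 - q^r), which brings D (1 - q^r) = -r q^r into
-- logarithmic form.
linear-′ : ∀ r → 1ˢ -ˢ q^ suc r ′≈ -ˢ (const (+ suc r) · X (suc r) · (1ˢ -ˢ q^ suc r))
linear-′ r = transˢ (transˢ (D-cong u≈) (transˢ (+-′ (const-′ 1ℤ) (neg-′ (D-q (suc r))))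
  (transˢ (+ˢ-cong (reflˢ {const 0ℤ}) (-ˢ-cong (·-cong (reflˢ {const (+ suc r)}) q≈)))
    (solve 3 (λ c x q → con 0ℤ :- c :* (x :* (con 1ℤ :- q)) := :- (c :* x :* (con 1ℤ :- q))) reflˢ (const (+ suc r)) x q))))
  (-ˢ-cong (·-cong (reflˢ {const (+ suc r) · x}) (symˢ u≈)))
  where
  x = X (suc r)
  q = q^ suc r
  u≈ : (1ˢ -ˢ q) ≈ˢ const 1ℤ +ˢ -ˢ q
  u≈ n = cong (ℤ._- q n) (1ˢ-const n)
  q≈ : q ≈ˢ x · (const 1ℤ +ˢ -ˢ q)
  q≈ = adjust (const 1ℤ) _ (X-fixpoint r)
    (solve 2 (λ x q → q := x :* (con 1ℤ :- q) :+ con 1ℤ :* (q :* (con 1ℤ :+ x) :- x)) reflˢ x q)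

power-′ : ∀ {f g} k → f ′≈ -ˢ (g · f) → f ^ˢ k ′≈ -ˢ (const (+ k) · g · f ^ˢ k)
power-′ {f} {g} zero    p = transˢ (D-cong 1ˢ-const) (transˢ (const-′ 1ℤ)
  (solve 2 (λ g y → con 0ℤ := :- (con 0ℤ :* g :* y)) reflˢ g 1ˢ))
power-′ {f} {g} (suc k) p = begin
  D (f *ˢ f ^ˢ k)
    ≈⟨ D-cong (·-def f (f ^ˢ k)) ⟩
  D (f · f ^ˢ k)
    ≈⟨ ·-′ p (power-′ k p) ⟩
  -ˢ (g · f) · f ^ˢ k +ˢ f · -ˢ (const (+ k) · g · f ^ˢ k)
    ≈⟨ solve 4 (λ f g y k → :- (g :* f) :* y :+ f :* (:- (k :* g :* y)) := :- ((con 1ℤ :+ k) :* g :* (f :* y)))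
        reflˢ f g (f ^ˢ k) (const (+ k)) ⟩
  -ˢ ((const 1ℤ +ˢ const (+ k)) · g · (f · f ^ˢ k))
    ≈⟨ -ˢ-cong (·-cong (·-cong const-suc (reflˢ {g})) (symˢ (·-def f (f ^ˢ k)))) ⟩
  -ˢ (const (+ suc k) · g · (f *ˢ f ^ˢ k)) ∎
  where
  open ≈ˢ-Reasoning
  const-suc : const 1ℤ +ˢ const (+ k) ≈ˢ const (+ suc k)
  const-suc zero    = refl
  const-suc (suc n) = refl

-- The exponent stays a variable, lest the 24-fold product be unfolded.
factor-′ : ∀ k r F → F ≡ (1ˢ -ˢ q^ suc r) ^ˢ k → F ′≈ -ˢ (const (+ k) · (const (+ suc r) · X (suc r)) · F)
factor-′ k r F refl = power-′ k (linear-′ r)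

eulerFactor²⁴-def : ∀ r → eulerFactor²⁴ r ≡ (1ˢ -ˢ q^ r) ^ˢ 24
eulerFactor²⁴-def r = refl

eulerFactor²⁴-′ : ∀ r → eulerFactor²⁴ (suc r) ′≈ -ˢ (const (+ 24) · (const (+ suc r) · X (suc r)) · eulerFactor²⁴ (suc r))
eulerFactor²⁴-′ r = factor-′ 24 r (eulerFactor²⁴ (suc r)) (eulerFactor²⁴-def (suc r))

partialL₁ : ℕ → Series
partialL₁ N n = Σ N (λ a → + a ℤ.* X a n)

module _ (F : ℕ → Series) (c : ℤ) (F-unit : ∀ r → F r ≈ 1ˢ mod-q^ r)
         (F-′ : ∀ r → F (suc r) ′≈ -ˢ (const c · (const (+ suc r) · X (suc r)) · F (suc r))) where

  ∏-′ : ∀ N → ∏[1⋯ N ] F ′≈ -ˢ (const c · partialL₁ N · ∏[1⋯ N ] F)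
  ∏-′ zero    = transˢ (D-cong 1ˢ-const) (transˢ (const-′ 1ℤ) (transˢ
    (solve 2 (λ c y → con 0ℤ := :- (c :* con 0ℤ :* y)) reflˢ (const c) 1ˢ)
    (-ˢ-cong (·-cong (·-cong (reflˢ {const c}) (λ { zero → refl ; (suc n) → refl })) (reflˢ {1ˢ})))))
  ∏-′ (suc N) = begin
    D (f *ˢ p)
      ≈⟨ D-cong (·-def f p) ⟩
    D (f · p)
      ≈⟨ ·-′ (F-′ N) (∏-′ N) ⟩
    -ˢ (const c · (const (+ suc N) · X (suc N)) · f) · p +ˢ f · -ˢ (const c · partialL₁ N · p)
      ≈⟨ solve 5 (λ c f p x s → :- (c :* x :* f) :* p :+ f :* (:- (c :* s :* p)) := :- (c :* (s :+ x) :* (f :* p)))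
          reflˢ (const c) f p (const (+ suc N) · X (suc N)) (partialL₁ N) ⟩
    -ˢ (const c · (partialL₁ N +ˢ const (+ suc N) · X (suc N)) · (f · p))
      ≈⟨ -ˢ-cong (·-cong (·-cong (reflˢ {const c}) (+ˢ-cong (reflˢ {partialL₁ N}) (const-· (+ suc N) (X (suc N))))) (symˢ (·-def f p))) ⟩
    -ˢ (const c · partialL₁ (suc N) · (f *ˢ p)) ∎
    where
    open ≈ˢ-Reasoning
    f = F (suc N)
    p = ∏[1⋯ N ] F

  -- Up to degree n the infinite product and L₁ agree with their truncations at n, so coefficient n
  -- is that of the finite product.
  ∏∞-′ : ∏∞ F ′≈ -ˢ (const c · L₁ · ∏∞ F)
  ∏∞-′ n = begin
    + n ℤ.* (∏[1⋯ n ] F) n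
      ≡⟨ ∏-′ n n ⟩
    ℤ.- (const c · partialL₁ n · ∏[1⋯ n ] F) n
      ≡⟨ cong ℤ.-_ (·-cong-≤ n
          (λ i i≤n → ·-cong-≤ i (λ _ _ → refl) (λ j j≤i → sym (L-truncate +_ (ℕₚ.≤-trans j≤i i≤n))))
          (λ i i≤n → ∏∞-limit F F-unit i n i≤n)) ⟩
    ℤ.- (const c · L₁ · ∏∞ F) n ∎
    where open ≡-Reasoning

-- The prefactor q supplies the constant term 1 of P = 1 - 24 L₁.
q·-′ : ∀ {η} → η ′≈ -ˢ (const (+ 24) · L₁ · η) → q^ 1 *ˢ η ′≈ P · (q^ 1 *ˢ η)
q·-′ {η} η-′ = begin
  D (q *ˢ η)
    ≈⟨ D-cong (·-def q η) ⟩
  D (q · η)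
    ≈⟨ ·-′ (D-q 1) η-′ ⟩
  const (+ 1) · q · η +ˢ q · -ˢ (const (+ 24) · L₁ · η)
    ≈⟨ solve 3 (λ q η l → con 1ℤ :* q :* η :+ q :* (:- (con (+ 24) :* l :* η)) := (con 1ℤ :- con (+ 24) :* l) :* (q :* η)) reflˢ q η L₁ ⟩
  P · (q · η)
    ≈⟨ ·-cong (reflˢ {P}) (symˢ (·-def q η)) ⟩
  P · (q *ˢ η) ∎
  where
  open ≈ˢ-Reasoning
  q = q^ 1

τ-′ : τ ′≈ P · τ
τ-′ = q·-′ {∏∞ eulerFactor²⁴} (∏∞-′ eulerFactor²⁴ (+ 24) eulerFactor²⁴-unit eulerFactor²⁴-′)

-- Identification of B² E with 64 Σ τ(n) q^n

L-one : ∀ φ → L φ 1 ≡ φ 1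
L-one φ = trans (L-def φ 1) (trans (ℤₚ.+-identityˡ _) (trans (cong (φ 1 ℤ.*_) (X-∣ {1} {0} (divides 1 refl))) (ℤₚ.*-identityʳ (φ 1))))

·-one : ∀ f g → (f · g) 1 ≡ f 0 ℤ.* g 1 ℤ.+ f 1 ℤ.* g 0
·-one f g = trans (·-suc f g 0) (cong (λ z → f 0 ℤ.* g 1 ℤ.+ z) (·-zero (tail f) g))

affine-zero : ∀ c k φ → (const c +ˢ const k · L φ) 0 ≡ c
affine-zero c k φ = trans (cong (λ z → c ℤ.+ z) (trans (const-· k (L φ) 0) (trans (cong (k ℤ.*_) (L-zero φ)) (ℤₚ.*-zeroʳ k)))) (ℤₚ.+-identityʳ c)

affine-one : ∀ c k φ → (const c +ˢ const k · L φ) 1 ≡ k ℤ.* φ 1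
affine-one c k φ = trans (ℤₚ.+-identityˡ _) (trans (const-· k (L φ) 1) (cong (k ℤ.*_) (L-one φ)))

scaled-zero : ∀ k φ → (const k · L φ) 0 ≡ 0ℤ
scaled-zero k φ = trans (const-· k (L φ) 0) (trans (cong (k ℤ.*_) (L-zero φ)) (ℤₚ.*-zeroʳ k))

-- Since B 0 = e 0 = 1 and E 0 = 0, only E 1 = 24 + 24 + 16 remains.
Φ-one : Φ 1 ≡ + 64
Φ-one = begin
  Φ 1
    ≡⟨ ·-one (B · B) E ⟩
  (B · B) 0 ℤ.* E 1 ℤ.+ (B · B) 1 ℤ.* E 0
    ≡⟨ cong₂ (λ x y → x ℤ.* E 1 ℤ.+ (B · B) 1 ℤ.* y) (trans (·-zero B B) (cong₂ ℤ._*_ B₀ B₀))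
             (cong₂ ℤ._-_ (trans (·-zero e e) (cong₂ ℤ._*_ e₀ e₀)) B₀) ⟩
  1ℤ ℤ.* E 1 ℤ.+ (B · B) 1 ℤ.* 0ℤ
    ≡⟨ Solver.solve 2 (λ x y → Solver.con 1ℤ Solver.:* x Solver.:+ y Solver.:* Solver.con 0ℤ Solver.:= x) refl (E 1) ((B · B) 1) ⟩
  (e · e) 1 ℤ.- B 1
    ≡⟨ cong₂ ℤ._-_ (trans (·-one e e) (cong₂ (λ x y → x ℤ.* y ℤ.+ y ℤ.* x) e₀ e₁)) (affine-one 1ℤ (+ 16) (alternating 3)) ⟩
  + 64 ∎
  where
  open ≡-Reasoning
  B₀ : B 0 ≡ 1ℤ
  B₀ = affine-zero 1ℤ (+ 16) (alternating 3)
  e₀ : e 0 ≡ 1ℤ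
  e₀ = cong₂ ℤ._-_ (affine-zero 1ℤ (+ 12) +_) (scaled-zero (+ 12) (alternating 1))
  e₁ : e 1 ≡ + 24
  e₁ = cong₂ ℤ._-_ (affine-one 1ℤ (+ 12) +_) (trans (const-· (+ 12) (A 1) 1) (cong (+ 12 ℤ.*_) (L-one (alternating 1))))

-- P has constant term 1, so the difference of the two solutions could be nonzero only through its
-- coefficient at 1, which is 64 - 64.
Φ-unique : ∀ t → t ′≈ P · t → t 1 ≡ 1ℤ → Φ ≈ˢ const (+ 64) · t
Φ-unique t t-′ t-one n = ℤₚ.i-j≡0⇒i≡j (Φ n) _ (vanish-on (Φ +ˢ -ˢ (const (+ 64) · t)) P (λ _ → ⊤)
  (transˢ (+-′ Φ-′ (neg-′ (scale-′ (+ 64) t-′)))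
    (solve 3 (λ p f t → p :* f :- con (+ 64) :* (p :* t) := p :* (f :- con (+ 64) :* t)) reflˢ P Φ t))
  free (λ _ _ _ _ → inj₂ tt) n tt)
  where
  P₀ : P 0 ≡ 1ℤ
  P₀ = cong (λ z → 1ℤ ℤ.- z) (scaled-zero (+ 24) +_)
  free : ∀ n → ⊤ → + n ≡ P 0 → Φ n ℤ.- (const (+ 64) · t) n ≡ 0ℤ
  free n _ n≡P₀ with ℤₚ.+-injective (trans n≡P₀ P₀)
  ... | refl = cong₂ ℤ._-_ Φ-one (trans (const-· (+ 64) t 1) (cong (+ 64 ℤ.*_) t-one))

Φ≈64τ : Φ ≈ˢ const (+ 64) · τ
Φ≈64τ = Φ-unique τ τ-′ refl

-- Odd coefficients

sgn-odd : ∀ a → 2 ∤ a → sgn a ≡ -1ℤ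
sgn-odd zero          2∤a = ⊥-elim (2∤a (divides 0 refl))
sgn-odd (suc zero)    2∤a = refl
sgn-odd (suc (suc a)) 2∤a = trans (sgn-suc (suc a)) (trans (cong ℤ.-_ (sgn-suc a))
  (trans (ℤₚ.neg-involutive (sgn a)) (sgn-odd a (λ 2∣a → 2∤a (∣m∣n⇒∣m+n (divides 1 refl) 2∣a)))))

-- Every divisor of an odd number is odd.
L-odd : ∀ {φ ψ n} → 2 ∤ n → (∀ a → 2 ∤ a → φ a ≡ ψ a) → L φ n ≡ L ψ n
L-odd {φ} {ψ} {n} 2∤n e = trans (L-def φ n) (trans (Σ-cong n (λ a _ → term n (suc a) 2∤n)) (sym (L-def ψ n)))
  where
  term : ∀ n a → 2 ∤ n → φ a ℤ.* X a n ≡ ψ a ℤ.* X a n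
  term zero    a 2∤n = ⊥-elim (2∤n (divides 0 refl))
  term (suc n) a 2∤n with a ∣? suc n
  ... | yes a∣n = cong (ℤ._* X a (suc n)) (e a (λ 2∣a → 2∤n (∣-trans 2∣a a∣n)))
  ... | no  a∤n = trans (cong (φ a ℤ.*_) (X-∤ a∤n)) (trans (ℤₚ.*-zeroʳ (φ a))
                    (sym (trans (cong (ψ a ℤ.*_) (X-∤ a∤n)) (ℤₚ.*-zeroʳ (ψ a)))))

-- For odd n, a term with i odd has vanishing H-coefficient, because A 1 and L₁ cancel there. A term
-- with i even leaves n - i odd, hence falls under the induction. The free coefficient sits at 2,
-- outside the odd indices.
BE²-odd : ∀ n → 2 ∤ n → ((B · E) · E) n ≡ 0ℤ
BE²-odd = vanish-on ((B · E) · E) H (2 ∤_) BE²-′ free closed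
  where
  open ≡-Reasoning
  H = const (+ 2) +ˢ -ˢ (const (+ 12) · (A 1 +ˢ L₁))
  H₀ : H 0 ≡ + 2
  H₀ = cong (λ z → + 2 ℤ.- z) (trans (const-· (+ 12) (A 1 +ˢ L₁) 0) (cong (+ 12 ℤ.*_) (cong₂ ℤ._+_ (L-zero (alternating 1)) (L-zero +_))))
  free : ∀ n → 2 ∤ n → + n ≡ H 0 → ((B · E) · E) n ≡ 0ℤ
  free n 2∤n n≡H₀ with ℤₚ.+-injective (trans n≡H₀ H₀)
  ... | refl = ⊥-elim (2∤n (divides 1 refl))
  H-odd : ∀ i → 2 ∤ suc i → H (suc i) ≡ 0ℤ
  H-odd i 2∤i = cong (λ z → 0ℤ ℤ.- z) (trans (const-· (+ 12) (A 1 +ˢ L₁) (suc i)) (cong (+ 12 ℤ.*_) (begin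
    A 1 (suc i) ℤ.+ L₁ (suc i)                         ≡⟨ cong (ℤ._+ L₁ (suc i)) (L-odd 2∤i (λ a 2∤a →
                                                            trans (cong (ℤ._* (+ a ℤ.* 1ℤ)) (sgn-odd a 2∤a)) (cong (-1ℤ ℤ.*_) (ℤₚ.*-identityʳ (+ a))))) ⟩
    L (λ a → -1ℤ ℤ.* + a) (suc i) ℤ.+ L₁ (suc i)       ≡⟨ cong (ℤ._+ L₁ (suc i)) (trans (L-* -1ℤ +_ (suc i)) (const-· -1ℤ L₁ (suc i))) ⟩
    -1ℤ ℤ.* L₁ (suc i) ℤ.+ L₁ (suc i)                  ≡⟨ cong (ℤ._+ L₁ (suc i)) (ℤₚ.-1*i≡-i (L₁ (suc i))) ⟩
    ℤ.- L₁ (suc i) ℤ.+ L₁ (suc i)                      ≡⟨ ℤₚ.+-inverseˡ (L₁ (suc i)) ⟩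
    0ℤ ∎)))
  closed : ∀ n → 2 ∤ suc n → ∀ i → i ≤ n → H (suc i) ≡ 0ℤ ⊎ 2 ∤ (n ∸ i)
  closed n 2∤n i i≤n with 2 ∣? suc i
  ... | no  2∤i = inj₁ (H-odd i 2∤i)
  ... | yes 2∣i = inj₂ (λ 2∣n∸i → 2∤n (subst (2 ∣_) (cong suc (ℕₚ.m+[n∸m]≡n i≤n)) (∣m∣n⇒∣m+n 2∣i 2∣n∸i)))

-- Sums over lists

∑-++ : ∀ {a} {A : Set a} (xs ys : List A) (f : A → ℤ) → ∑ (xs ++ ys) f ≡ ∑ xs f ℤ.+ ∑ ys f
∑-++ []       ys f = sym (ℤₚ.+-identityˡ (∑ ys f))
∑-++ (x ∷ xs) ys f = trans (cong (λ z → f x ℤ.+ z) (∑-++ xs ys f)) (sym (ℤₚ.+-assoc (f x) (∑ xs f) (∑ ys f)))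

∑-map : ∀ {a b} {A : Set a} {B : Set b} (g : A → B) (xs : List A) (f : B → ℤ) → ∑ (map g xs) f ≡ ∑ xs (f ∘ g)
∑-map g []       f = refl
∑-map g (x ∷ xs) f = cong (λ z → f (g x) ℤ.+ z) (∑-map g xs f)

∑-filter : ∀ {a p} {A : Set a} {P : A → Set p} (P? : Decidable P) (xs : List A) (f : A → ℤ) →
           ∑ (filter P? xs) f ≡ ∑ xs (λ x → if does (P? x) then f x else 0ℤ)
∑-filter P? []       f = refl
∑-filter P? (x ∷ xs) f with P? x
... | yes _ = cong (λ z → f x ℤ.+ z) (∑-filter P? xs f)
... | no  _ = trans (∑-filter P? xs f) (sym (ℤₚ.+-identityˡ _))

∑-cartesianProduct : ∀ {a b} {A : Set a} {B : Set b} (xs : List A) (ys : List B) (f : A × B → ℤ) →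
                     ∑ (cartesianProduct xs ys) f ≡ ∑ xs (λ x → ∑ ys (λ y → f (x , y)))
∑-cartesianProduct []       ys f = refl
∑-cartesianProduct (x ∷ xs) ys f = trans (∑-++ (map (x ,_) ys) (cartesianProduct xs ys) f)
  (cong₂ ℤ._+_ (∑-map (x ,_) ys f) (∑-cartesianProduct xs ys f))

∑-[1⋯] : ∀ n f → ∑ [1⋯ n ] f ≡ Σ n f
∑-[1⋯] n f = trans (∑-map suc (upTo n) f) (go n)
  where
  go : ∀ n → ∑ (upTo n) (f ∘ suc) ≡ Σ n f
  go zero    = refl
  go (suc n) = trans (cong (λ xs → ∑ xs (f ∘ suc)) (sym (Listₚ.upTo-∷ʳ n)))
    (trans (∑-++ (upTo n) (n ∷ []) (f ∘ suc)) (cong₂ ℤ._+_ (go n) (ℤₚ.+-identityʳ (f (suc n)))))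

∑-filter-square : ∀ {p} {P : ℕ × ℕ → Set p} (P? : Decidable P) n f →
  ∑ (filter P? (cartesianProduct [1⋯ n ] [1⋯ n ])) f ≡ square n (λ a b → if does (P? (a , b)) then f (a , b) else 0ℤ)
∑-filter-square P? n f = trans (∑-filter P? (cartesianProduct [1⋯ n ] [1⋯ n ]) f)
  (trans (∑-cartesianProduct [1⋯ n ] [1⋯ n ] g)
  (trans (∑-[1⋯] n (λ a → ∑ [1⋯ n ] (λ b → g (a , b)))) (Σ-cong n (λ a _ → ∑-[1⋯] n (λ b → g (suc a , b))))))
  where
  g : ℕ × ℕ → ℤ
  g x = if does (P? x) then f x else 0ℤ

if-dec : ∀ {p} {P : Set p} (P? : Dec P) {x y z : ℤ} → (P → x ≡ z) → (¬ P → y ≡ z) → (if does P? then x else y) ≡ z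
if-dec (yes p) then-eq else-eq = then-eq p
if-dec (no ¬p) then-eq else-eq = else-eq ¬p

∑-divisors : ∀ n f → ∑ (divisors (suc n)) f ≡ L f (suc n)
∑-divisors n f = trans (∑-filter (_∣? suc n) [1⋯ suc n ] f) (trans (∑-[1⋯] (suc n) (λ d → if does (d ∣? suc n) then f d else 0ℤ))
  (trans (Σ-cong (suc n) (λ d _ → term (suc d))) (sym (L-def f (suc n)))))
  where
  term : ∀ d → (if does (d ∣? suc n) then f d else 0ℤ) ≡ f d ℤ.* X d (suc n)
  term d = if-dec (d ∣? suc n)
    (λ d∣n → sym (trans (cong (f d ℤ.*_) (X-∣ d∣n)) (ℤₚ.*-identityʳ (f d))))
    (λ d∤n → sym (trans (cong (f d ℤ.*_) (X-∤ d∤n)) (ℤₚ.*-zeroʳ (f d))))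

-- Solutions of a y + b z = n

q-diagonal : ∀ n → (q^ n) n ≡ 1ℤ
q-diagonal zero    = refl
q-diagonal (suc n) = q-diagonal n

q-off : ∀ r n → r ≢ n → (q^ r) n ≡ 0ℤ
q-off zero    zero    r≢n = ⊥-elim (r≢n refl)
q-off zero    (suc n) r≢n = refl
q-off (suc r) zero    r≢n = refl
q-off (suc r) (suc n) r≢n = q-off r n (r≢n ∘ cong suc)

-- At most one exponent (a + 1) y equals n, and then y ≤ n ≤ N, so the cut-off N loses nothing.
X-geometric : ∀ a N n → n ≤ N → X (suc a) n ≡ Σ N (λ y → (q^ (suc a ℕ.* y)) n)
X-geometric a N zero    _   = trans (X-zero (suc a)) (sym (Σ-zero N (λ y _ → refl)))
X-geometric a N (suc m) m<N with suc a ∣? suc m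
... | no  a∤m = trans (X-∤ a∤m) (sym (Σ-zero N (λ y _ → q-off (suc a ℕ.* suc y) (suc m)
      (λ ay≡m → a∤m (divides (suc y) (trans (sym ay≡m) (ℕₚ.*-comm (suc a) (suc y))))))))
... | yes a∣m@(divides (suc j) m≡ja) = trans (X-∣ a∣m) (sym (trans
      (Σ-single N j (ℕₚ.≤-trans j<m m<N) (λ i i≢j → q-off (suc a ℕ.* suc i) (suc m)
        (λ ai≡m → i≢j (ℕₚ.suc-injective (ℕₚ.*-cancelˡ-≡ (suc i) (suc j) (suc a) (trans ai≡m (sym aj≡m)))))))
      (trans (cong (λ r → (q^ r) (suc m)) aj≡m) (q-diagonal m))))
  where
  aj≡m : suc a ℕ.* suc j ≡ suc m
  aj≡m = trans (ℕₚ.*-comm (suc a) (suc j)) (sym m≡ja)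
  j<m : suc j ≤ suc m
  j<m = subst (suc j ≤_) (sym m≡ja) (ℕₚ.m≤m*n (suc j) (suc a))

X-·-X : ∀ a b n → (X (suc a) · X (suc b)) n ≡ square n (λ y z → (q^ (suc a ℕ.* y ℕ.+ suc b ℕ.* z)) n)
X-·-X a b n = trans (·-cong-≤ n (λ i i≤n → X-geometric a n i i≤n) (λ i i≤n → X-geometric b n i i≤n))
  (trans (Σ-·-Σ n n (λ y → q^ (suc a ℕ.* y)) (λ z → q^ (suc b ℕ.* z)) n)
         (square-cong n (λ y z → q-+ (suc a ℕ.* suc y) (suc b ℕ.* suc z) n)))

∑-solutions : ∀ n a b → (∑[ y ∈ solutions n (suc a) (suc b) ] 1ℤ) ≡ (X (suc a) · X (suc b)) n
∑-solutions n a b = trans (∑-filter-square (solution? n (suc a) (suc b)) n (λ _ → 1ℤ))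
  (trans (square-cong n term) (sym (X-·-X a b n)))
  where
  term : ∀ y z → (if does (solution? n (suc a) (suc b) (suc y , suc z)) then 1ℤ else 0ℤ)
               ≡ (q^ (suc a ℕ.* suc y ℕ.+ suc b ℕ.* suc z)) n
  term y z = if-dec (solution? n (suc a) (suc b) (suc y , suc z))
    (λ (_ , _ , eq) → sym (trans (cong (λ r → (q^ r) n) eq) (q-diagonal n)))
    (λ ¬sol → sym (q-off (suc a ℕ.* suc y ℕ.+ suc b ℕ.* suc z) n (λ eq → ¬sol (s≤s z≤n , s≤s z≤n , eq))))

-- For m₂ < m₁, a solution with y₁, y₂ ≥ 1 forces m₁ + m₂ ≤ n, and gcd m₁ m₂ divides m₁ y₁ + m₂ y₂ =
-- n. A pair a < c outside the list thus has coefficient 0 in X c · X a.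
∑-admissiblePairs : ∀ n (g : ℕ → ℕ → ℤ) →
  ∑ (admissiblePairs n) (λ (m₁ , m₂) → g m₁ m₂ ℤ.* (∑[ y ∈ solutions n m₁ m₂ ] 1ℤ))
    ≡ triangle n (λ a c → g c a ℤ.* (X c · X a) n)
∑-admissiblePairs n g = trans (∑-filter-square (admissible? n) n _) (Σ-cong n (λ c c<n →
  trans (Σ-extend (ℕₚ.<⇒≤ c<n) (λ a c≤a → outside c a c≤a)) (Σ-cong c (λ a a<c → inside c a a<c))))
  where
  f : ℕ × ℕ → ℤ
  f (m₁ , m₂) = g m₁ m₂ ℤ.* (∑[ y ∈ solutions n m₁ m₂ ] 1ℤ)
  outside : ∀ c a → c ≤ a → (if does (admissible? n (suc c , suc a)) then f (suc c , suc a) else 0ℤ) ≡ 0ℤ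
  outside c a c≤a = if-dec (admissible? n (suc c , suc a)) (λ (a<c , _) → ⊥-elim (ℕₚ.<⇒≱ (ℕₚ.≤-pred a<c) c≤a)) (λ _ → refl)
  solvable⇒admissible : ∀ c a y z → a < c → suc c ℕ.* suc y ℕ.+ suc a ℕ.* suc z ≡ n → Admissible n (suc c , suc a)
  solvable⇒admissible c a y z a<c refl = s≤s a<c , s≤s z≤n
    , ℕₚ.+-mono-≤ (ℕₚ.m≤m*n (suc c) (suc y)) (ℕₚ.m≤m*n (suc a) (suc z))
    , ∣m∣n⇒∣m+n (∣m⇒∣m*n (suc y) (gcd[m,n]∣m (suc c) (suc a))) (∣m⇒∣m*n (suc z) (gcd[m,n]∣n (suc c) (suc a)))
  inside : ∀ c a → a < c → (if does (admissible? n (suc c , suc a)) then f (suc c , suc a) else 0ℤ)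
                         ≡ g (suc c) (suc a) ℤ.* (X (suc c) · X (suc a)) n
  inside c a a<c = if-dec (admissible? n (suc c , suc a))
    (λ _ → cong (g (suc c) (suc a) ℤ.*_) (∑-solutions n c a))
    (λ ¬adm → sym (trans (cong (g (suc c) (suc a) ℤ.*_) (trans (X-·-X c a n)
      (Σ-zero n (λ y _ → Σ-zero n (λ z _ → q-off (suc c ℕ.* suc y ℕ.+ suc a ℕ.* suc z) n
        (λ eq → ¬adm (solvable⇒admissible c a y z a<c eq)))))))
      (ℤₚ.*-zeroʳ (g (suc c) (suc a)))))

-- The sum over pairs as a bilinear form.

weight : ℕ → ℕ → ℤ
weight a b = -1ℤ ℤ.^ (a ℕ.+ b) ℤ.* (+ a ℤ.* + b) ℤ.^ 3 ℤ.* ((+ a) ℤ.^ 2 ℤ.- (+ b) ℤ.^ 2) ℤ.^ 2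

weight-form : ∀ a b → weight a b ≡ formAt (toForm pair-terms) a b
weight-form a b = trans (cong₂ ℤ._*_ (cong₂ ℤ._*_ (sgn-+ a b) (sym (power≡^ (+ a ℤ.* + b) 3)))
    (trans (cong₂ (λ x y → (x ℤ.- y) ℤ.^ 2) (sym (power≡^ (+ a) 2)) (sym (power≡^ (+ b) 2)))
           (sym (power≡^ (pow 2 (+ a) ℤ.- pow 2 (+ b)) 2))))
  (trans (pair-weight (sgn a) (sgn b) (+ a) (+ b)) (formAt-toForm pair-terms a b))

weight-sym : ∀ a b → weight a b ≡ weight b a
weight-sym a b = cong₂ ℤ._*_ (cong₂ ℤ._*_ (cong sgn (ℕₚ.+-comm a b)) (cong (ℤ._^ 3) (ℤₚ.*-comm (+ a) (+ b))))
  (square-swap ((+ a) ℤ.^ 2) ((+ b) ℤ.^ 2))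
  where
  square-swap : ∀ x y → (x ℤ.- y) ℤ.^ 2 ≡ (y ℤ.- x) ℤ.^ 2
  square-swap = Solver.solve 2 (λ x y → (x Solver.:- y) Solver.:^ 2 Solver.:= (y Solver.:- x) Solver.:^ 2) refl

weight-diagonal : ∀ a → weight a a ≡ 0ℤ
weight-diagonal a = trans (cong (λ z → -1ℤ ℤ.^ (a ℕ.+ a) ℤ.* (+ a ℤ.* + a) ℤ.^ 3 ℤ.* z ℤ.^ 2) (ℤₚ.+-inverseʳ ((+ a) ℤ.^ 2)))
  (ℤₚ.*-zeroʳ (-1ℤ ℤ.^ (a ℕ.+ a) ℤ.* (+ a ℤ.* + a) ℤ.^ 3))

pairSum : ℕ → ℤ
pairSum n = triangle n (λ a c → weight c a ℤ.* (X c · X a) n)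

-- The weight is symmetric and its factor m₁² - m₂² vanishes on the diagonal, so the full square is
-- twice the triangle.
pairSum-form : ∀ n → formˢ (toForm pair-terms) n ≡ pairSum n ℤ.+ pairSum n
pairSum-form n = begin
  formˢ (toForm pair-terms) n
    ≡⟨ sym (formˢ-square (toForm pair-terms) n) ⟩
  square n (λ a b → formAt (toForm pair-terms) a b ℤ.* (X a · X b) n)
    ≡⟨ square-cong n (λ a b → cong (ℤ._* (X (suc a) · X (suc b)) n) (sym (weight-form (suc a) (suc b)))) ⟩
  square n (λ a b → weight a b ℤ.* (X a · X b) n)
    ≡⟨ square-split n _ ⟩
  triangle n (λ a c → weight a c ℤ.* (X a · X c) n) ℤ.+ pairSum n ℤ.+ Σ n (λ a → weight a a ℤ.* (X a · X a) n)
    ≡⟨ cong₂ (λ x y → x ℤ.+ pairSum n ℤ.+ y)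
        (triangle-cong n (λ a c _ → cong₂ ℤ._*_ (weight-sym (suc a) (suc c)) (·-comm (X (suc a)) (X (suc c)) n)))
        (Σ-zero n (λ a _ → cong (ℤ._* (X (suc a) · X (suc a)) n) (weight-diagonal (suc a)))) ⟩
  pairSum n ℤ.+ pairSum n ℤ.+ 0ℤ
    ≡⟨ ℤₚ.+-identityʳ _ ⟩
  pairSum n ℤ.+ pairSum n ∎
  where open ≡-Reasoning

-- The identity over ℤ

σ : ℕ → ℕ → ℤ
σ k n = L (λ d → (+ d) ℤ.^ k) n

A-odd : ∀ k n → 2 ∤ n → A k n ≡ ℤ.- σ k n
A-odd k n 2∤n = begin
  A k n                               ≡⟨ L-odd 2∤n (λ a 2∤a → cong₂ ℤ._*_ (sgn-odd a 2∤a) (power≡^ (+ a) k)) ⟩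
  L (λ a → -1ℤ ℤ.* (+ a) ℤ.^ k) n     ≡⟨ trans (L-* -1ℤ _ n) (const-· -1ℤ _ n) ⟩
  -1ℤ ℤ.* σ k n                       ≡⟨ ℤₚ.-1*i≡-i (σ k n) ⟩
  ℤ.- σ k n ∎
  where open ≡-Reasoning

-- Multiplication by 9 lets `9B³≈` replace B³. The other constants are 298368 = 9 · 518 · 64 and 144
-- = 9 · 16, while 16 · 32 and 8 · 64 both equal 512, so the products combine to 256 times the pair
-- form.
9N₁₁≈ : const (+ 9) · N₁₁ ≈ˢ
  const (+ 691) · (const (+ 9) +ˢ const (+ 272) · A 3 +ˢ const (+ 128) · A 5 +ˢ const (+ 32) · A 7
                   +ˢ const (+ 256) · formˢ (toForm pair-terms))
  +ˢ const (+ 298368) · τ +ˢ const (+ 144) · ((B · E) · E)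
9N₁₁≈ = transˢ (·-cong (reflˢ {const (+ 9)}) (transˢ N₁₁≈ (+ˢ-cong (+ˢ-cong (reflˢ {const (+ 691) · (B · (B · B))})
                  (·-cong (reflˢ {const (+ 518)}) Φ≈64τ)) (reflˢ {const (+ 16) · ((B · E) · E)}))))
  (adjust (const (+ 691)) _ (symˢ 9B³≈)
    (solve 7 (λ b a₃ a₅ a₇ t y z →
      con (+ 9) :* (con (+ 691) :* b :+ con (+ 518) :* (con (+ 64) :* t) :+ con (+ 16) :* y) :=
      con (+ 691) :* (con (+ 9) :+ con (+ 272) :* a₃ :+ con (+ 128) :* a₅ :+ con (+ 32) :* a₇
        :+ con (+ 256) :* (con (+ 1) :* (a₃ :* a₇) :+ (con (+ 1) :* (a₇ :* a₃) :+ (con -[1+ 1 ] :* (a₅ :* a₅) :+ con 0ℤ))))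
      :+ con (+ 298368) :* t :+ con (+ 144) :* y
      :+ con (+ 691) :* (con (+ 9) :* b :- ((con 1ℤ :+ con (+ 16) :* a₃) :* (con (+ 17) :+ con (+ 32) :* a₇)
                                            :- con (+ 8) :* ((con 1ℤ :- con (+ 8) :* a₅) :* (con 1ℤ :- con (+ 8) :* a₅)))))
      reflˢ (B · (B · B)) (A 3) (A 5) (A 7) τ ((B · E) · E) B))

const-·-at : ∀ k f n {v} → f n ≡ v → (const k · f) n ≡ k ℤ.* v
const-·-at k f n fn≡v = trans (const-· k f n) (cong (k ℤ.*_) fn≡v)

integral-identity : ∀ n → 2 ∤ suc n → + 18648 ℤ.* τ (suc n) ≡
  -[1+ 8 ] ℤ.* σ 11 (suc n)
  ℤ.+ + 691 ℤ.* (+ 17 ℤ.* σ 3 (suc n) ℤ.+ + 8 ℤ.* σ 5 (suc n) ℤ.+ + 2 ℤ.* σ 7 (suc n))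
  ℤ.- + 22112 ℤ.* pairSum (suc n)
integral-identity m 2∤n = ℤₚ.*-cancelˡ-≡ (+ 16) lhs rhs
  (collect (τ n) (σ 11 n) (σ 3 n) (σ 5 n) (σ 7 n) (pairSum n) (trans (sym left) (trans (9N₁₁≈ n) right)))
  where
  n = suc m
  lhs rhs : ℤ
  lhs = + 18648 ℤ.* τ n
  rhs = -[1+ 8 ] ℤ.* σ 11 n ℤ.+ + 691 ℤ.* (+ 17 ℤ.* σ 3 n ℤ.+ + 8 ℤ.* σ 5 n ℤ.+ + 2 ℤ.* σ 7 n) ℤ.- + 22112 ℤ.* pairSum n
  left : (const (+ 9) · N₁₁) n ≡ + 9 ℤ.* (0ℤ ℤ.+ + 16 ℤ.* (ℤ.- σ 11 n))
  left = const-·-at (+ 9) N₁₁ n (cong (λ z → 0ℤ ℤ.+ z) (const-·-at (+ 16) (A 11) n (A-odd 11 n 2∤n)))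
  right = cong₂ ℤ._+_ (cong₂ ℤ._+_
      (const-·-at (+ 691) _ n (cong₂ ℤ._+_ (cong₂ ℤ._+_ (cong₂ ℤ._+_ (cong (λ z → 0ℤ ℤ.+ z)
        (const-·-at (+ 272) (A 3) n (A-odd 3 n 2∤n))) (const-·-at (+ 128) (A 5) n (A-odd 5 n 2∤n)))
        (const-·-at (+ 32) (A 7) n (A-odd 7 n 2∤n))) (const-·-at (+ 256) (formˢ (toForm pair-terms)) n (pairSum-form n))))
      (const-· (+ 298368) τ n))
    (const-·-at (+ 144) ((B · E) · E) n (BE²-odd n 2∤n))

∑-divisors-weight : ∀ n →
  (∑[ d ∈ divisors (suc n) ] (+ d) ℤ.^ 3 ℤ.* (+ 17 ℤ.+ + 8 ℤ.* (+ d) ℤ.^ 2 ℤ.+ + 2 ℤ.* (+ d) ℤ.^ 4)) ≡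
  + 17 ℤ.* σ 3 (suc n) ℤ.+ + 8 ℤ.* σ 5 (suc n) ℤ.+ + 2 ℤ.* σ 7 (suc n)
∑-divisors-weight n = trans (∑-divisors n (λ d → (+ d) ℤ.^ 3 ℤ.* (+ 17 ℤ.+ + 8 ℤ.* (+ d) ℤ.^ 2 ℤ.+ + 2 ℤ.* (+ d) ℤ.^ 4)))
  (trans (L-cong (λ d → pointwise (+ suc d)) (suc n))
  (trans (L-combination ((+ 17 , cube) ∷ (+ 8 , fifth) ∷ (+ 2 , seventh) ∷ []) (suc n))
  (trans (cong₂ ℤ._+_ (const-· (+ 17) (L cube) (suc n))
      (cong₂ ℤ._+_ (const-· (+ 8) (L fifth) (suc n)) (cong (ℤ._+ 0ℤ) (const-· (+ 2) (L seventh) (suc n)))))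
    (regroup (+ 17 ℤ.* σ 3 (suc n)) (+ 8 ℤ.* σ 5 (suc n)) (+ 2 ℤ.* σ 7 (suc n))))))
  where
  cube fifth seventh : ℕ → ℤ
  cube d    = (+ d) ℤ.^ 3
  fifth d   = (+ d) ℤ.^ 5
  seventh d = (+ d) ℤ.^ 7
  regroup : ∀ x y z → x ℤ.+ (y ℤ.+ (z ℤ.+ 0ℤ)) ≡ x ℤ.+ y ℤ.+ z
  regroup x y z = trans (cong (λ w → x ℤ.+ (y ℤ.+ w)) (ℤₚ.+-identityʳ z)) (sym (ℤₚ.+-assoc x y z))
  pointwise : ∀ x → x ℤ.^ 3 ℤ.* (+ 17 ℤ.+ + 8 ℤ.* x ℤ.^ 2 ℤ.+ + 2 ℤ.* x ℤ.^ 4) ≡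
    + 17 ℤ.* x ℤ.^ 3 ℤ.+ (+ 8 ℤ.* x ℤ.^ 5 ℤ.+ (+ 2 ℤ.* x ℤ.^ 7 ℤ.+ 0ℤ))
  pointwise x = trans (cong₂ ℤ._*_ (sym (power≡^ x 3))
      (cong₂ (λ u v → + 17 ℤ.+ + 8 ℤ.* u ℤ.+ + 2 ℤ.* v) (sym (power≡^ x 2)) (sym (power≡^ x 4))))
    (trans (divisor-weight x) (cong₂ (λ u v → + 17 ℤ.* u ℤ.+ v) (power≡^ x 3)
      (cong₂ (λ u v → + 8 ℤ.* u ℤ.+ (+ 2 ℤ.* v ℤ.+ 0ℤ)) (power≡^ x 5) (power≡^ x 7))))

-- Passage to the rationals.

fromℤ-+ : ∀ x y → fromℤ (x ℤ.+ y) ≡ fromℤ x ℚ.+ fromℤ y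
fromℤ-+ x y = ℚₚ.toℚᵘ-injective (ℚᵘₚ.≃-trans (ℚₚ.toℚᵘ-fromℚᵘ (ℚᵘ.mkℚᵘ (x ℤ.+ y) 0)) (ℚᵘₚ.≃-sym
  (ℚᵘₚ.≃-trans (ℚₚ.toℚᵘ-homo-+ (fromℤ x) (fromℤ y))
  (ℚᵘₚ.≃-trans (ℚᵘₚ.+-cong (ℚₚ.toℚᵘ-fromℚᵘ (ℚᵘ.mkℚᵘ x 0)) (ℚₚ.toℚᵘ-fromℚᵘ (ℚᵘ.mkℚᵘ y 0)))
    (ℚᵘ.*≡* (cong (ℤ._* 1ℤ) (cong₂ ℤ._+_ (ℤₚ.*-identityʳ x) (ℤₚ.*-identityʳ y))))))))

fromℤ-* : ∀ x y → fromℤ (x ℤ.* y) ≡ fromℤ x ℚ.* fromℤ y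
fromℤ-* x y = ℚₚ.toℚᵘ-injective (ℚᵘₚ.≃-trans (ℚₚ.toℚᵘ-fromℚᵘ (ℚᵘ.mkℚᵘ (x ℤ.* y) 0)) (ℚᵘₚ.≃-sym
  (ℚᵘₚ.≃-trans (ℚₚ.toℚᵘ-homo-* (fromℤ x) (fromℤ y))
    (ℚᵘₚ.*-cong (ℚₚ.toℚᵘ-fromℚᵘ (ℚᵘ.mkℚᵘ x 0)) (ℚₚ.toℚᵘ-fromℚᵘ (ℚᵘ.mkℚᵘ y 0))))))

-- Division by 72: 18648 = 72 · 259, 9 / 72 = 1/8 and 22112 / 72 = 2764/9.
rational-identity : ∀ t s d p → + 18648 ℤ.* t ≡ -[1+ 8 ] ℤ.* s ℤ.+ + 691 ℤ.* d ℤ.- + 22112 ℤ.* p →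
  (+ 259 ℚ./ 1) ℚ.* fromℤ t ≡
    ℚ.- (+ 1 ℚ./ 8) ℚ.* fromℤ s ℚ.+ (+ 691 ℚ./ 72) ℚ.* fromℤ d ℚ.- (+ 2764 ℚ./ 9) ℚ.* fromℤ p
rational-identity t s d p eq = begin
  (+ 259 ℚ./ 1) ℚ.* fromℤ t
    -- The closed product of 1/72 and 18648 evaluates to the normalised rational 259/1; the other
    -- coefficients are matched in the same way below.
    ≡⟨ scaled (+ 18648) t ⟩
  c ℚ.* fromℤ (+ 18648 ℤ.* t)
    ≡⟨ cong (λ z → c ℚ.* fromℤ z) (trans eq (cong (λ w → x ℤ.+ y ℤ.+ w) (ℤₚ.neg-distribˡ-* (+ 22112) p))) ⟩
  c ℚ.* fromℤ (x ℤ.+ y ℤ.+ z)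
    ≡⟨ cong (c ℚ.*_) (trans (fromℤ-+ (x ℤ.+ y) z) (cong (ℚ._+ fromℤ z) (fromℤ-+ x y))) ⟩
  c ℚ.* (fromℤ x ℚ.+ fromℤ y ℚ.+ fromℤ z)
    ≡⟨ trans (ℚₚ.*-distribˡ-+ c (fromℤ x ℚ.+ fromℤ y) (fromℤ z)) (cong (ℚ._+ c ℚ.* fromℤ z) (ℚₚ.*-distribˡ-+ c (fromℤ x) (fromℤ y))) ⟩
  c ℚ.* fromℤ x ℚ.+ c ℚ.* fromℤ y ℚ.+ c ℚ.* fromℤ z
    ≡⟨ sym (cong₂ ℚ._+_ (cong₂ ℚ._+_ (scaled -[1+ 8 ] s) (scaled (+ 691) d))
         (trans (ℚₚ.neg-distribˡ-* (+ 2764 ℚ./ 9) (fromℤ p)) (scaled -[1+ 22111 ] p))) ⟩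
  ℚ.- (+ 1 ℚ./ 8) ℚ.* fromℤ s ℚ.+ (+ 691 ℚ./ 72) ℚ.* fromℤ d ℚ.- (+ 2764 ℚ./ 9) ℚ.* fromℤ p ∎
  where
  open ≡-Reasoning
  c = + 1 ℚ./ 72
  x y z : ℤ
  x = -[1+ 8 ] ℤ.* s
  y = + 691 ℤ.* d
  z = -[1+ 22111 ] ℤ.* p
  scaled : ∀ k x → (c ℚ.* fromℤ k) ℚ.* fromℤ x ≡ c ℚ.* fromℤ (k ℤ.* x)
  scaled k x = trans (ℚₚ.*-assoc c (fromℤ k) (fromℤ x)) (cong (c ℚ.*_) (sym (fromℤ-* k x)))

open import Data.Rational.Base using (_/_; _+_; _-_; _*_; -_)

theorem1p9 : (n : ℕ) → 3 ≤ n → 2 ∤ n →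
    (+ 259 / 1) * fromℤ (τ n)
    ≡ - (+ 1 / (2 ℕ.^ 3)) * fromℤ (∑[ d ∈ divisors n ] (+ d) ℤ.^ 11)
    + (+ 691 / (2 ℕ.^ 3 ℕ.* 3 ℕ.^ 2)) * fromℤ (∑[ d ∈ divisors n ] (+ d) ℤ.^ 3 ℤ.* (+ 17 ℤ.+ + 8 ℤ.* (+ d) ℤ.^ 2 ℤ.+ + 2 ℤ.* (+ d) ℤ.^ 4))
    - ((+ 691 ℤ.* (+ 2) ℤ.^ 2) / (3 ℕ.^ 2)) * fromℤ (∑ (admissiblePairs n) (λ (m₁ , m₂) →
    -1ℤ ℤ.^ (m₁ ℕ.+ m₂) ℤ.* (+ m₁ ℤ.* + m₂) ℤ.^ 3 ℤ.* ((+ m₁) ℤ.^ 2 ℤ.- (+ m₂) ℤ.^ 2) ℤ.^ 2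
    ℤ.* (∑[ y ∈ solutions n m₁ m₂ ] 1ℤ)))
-- The three sums are exchanged at once; the coefficients written with powers of 2 and 3 reduce to
-- 1/8, 691/72 and 2764/9 by computation.
theorem1p9 (suc n) _ 2∤n = subst
  (λ (s , d , p) → (+ 259 / 1) * fromℤ (τ (suc n)) ≡
    - (+ 1 / 8) * fromℤ s + (+ 691 / 72) * fromℤ d - (+ 2764 / 9) * fromℤ p)
  (sym (cong₂ _,_ (∑-divisors n (λ d → (+ d) ℤ.^ 11))
    (cong₂ _,_ (∑-divisors-weight n) (∑-admissiblePairs (suc n) weight))))
  (rational-identity (τ (suc n)) (σ 11 (suc n))
    (+ 17 ℤ.* σ 3 (suc n) ℤ.+ + 8 ℤ.* σ 5 (suc n) ℤ.+ + 2 ℤ.* σ 7 (suc n)) (pairSum (suc n)) (integral-identity n 2∤n))
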